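{- Let $N\in\mathbb N$ and set $n=2^N$. Define $\tilde q$ as the law of the matching $M$ in $[n]$ sampled as follows. 1. Sample $K\sim\mathrm{Unif}(\{1,\dots,\lg n\})$ and, conditionally on $K$, sample $D\sim\mathrm{Unif}\bigl((n/2^{K+1},\,n/2^K]\bigr)$. 2. Define $M_0=\bigcup_{\ell=0}^{2^{K-1}-1}\bigl(\ell n/2^{K-1}+E_{D,K}\bigr)$ and $M_r=r n/2^{K+1}+M_0$ for $r\in\{1,2,3\}$. 3. Sample $R\sim\mathrm{Unif}(\{0,1,2,3\})$ and set $M=M_R$. Then $|M|=\tfrac14 n$ deterministically. The parallel randomised sorter associated to $\tilde q$ requires order $(\log n)^2$ rounds to sort a length-$n$ list in the worst case, both in expectation and with polynomially small failure probability.
   Context: Write $[n]=\{0,1,\dots,n-1\}$ for the set of positions and $\lg n=\log_2 n$; $\log$ is the natural logarithm. Addition, differences and distances of positions are calculated modulo $n$. $\mathrm{Unif}$ of a set denotes the uniform distribution on it; for the interval $(n/2^{K+1},n/2^K]$ it is the uniform distribution on the integers in that interval. The draw of $R$ is independent of $(K,D)$. For $d,k\in\mathbb N$, $E_{d,k}$ is the collection of the pairs $\{i,i+d\}$ with $i$ running from $0$ to $n/2^{k+1}-1$. For a real number $a$ and a collection $S$ of pairs, $a+S=\{\{a+i,a+j\}:\{i,j\}\in S\}$. A matching in $[n]$ is a collection of disjoint pairs in $[n]$; $|M|$ is the number of pairs in $M$. A list of length $n$ is a sequence indexed by $[n]$ with values (labels) in a totally ordered set; it is sorted if its entries are in ascending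 order. To sort a pair of positions $\{i,j\}$ with $i<j$ means: swap the entries at positions $i$ and $j$ if the entry in position $i$ is larger than that in position $j$, and otherwise do nothing. Given a probability measure $\tilde q$ on the set of matchings in $[n]$, a step (round) of the associated parallel randomised sorter chooses a matching $M\sim\tilde q$, independently of the past, and sorts the entries at the endpoints of each pair in $M$. "Order $f(n)$" means $\Theta(f(n))$, i.e. bounded above and below by positive constant multiples of $f(n)$. "Worst case" refers to the initial list. "Both in expectation and with polynomially small failure probability" means that the bound on the number of rounds holds in expectation and also with failure probability polynomially small in the length $n$.
   Formalization: For K = lg n (D = 1) the text's E_{D,K} is empty and the shifts are half-integers, so |M| = n/4 fails; there M_R is formed with lg n − 1 in place of K, i.e. pairs {i,i+1} with i ≡ R mod 4. N ≥ 2 is required, and the label order is taken decidable. -}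

module Defs where

open import Algebra.Definitions.RawSemiring using (_^_)
open import Data.Bool using (if_then_else_)
open import Data.Fin as Fin using (Fin; toℕ)
import Data.Fin.Properties as Fin
open import Data.Fin.Permutation.Components using (transpose)
open import Data.Integer using (+_)
open import Data.List as List using (List; []; _∷_; upTo; concatMap; foldl; filter)
open import Data.List.Relation.Unary.All using (All)
open import Data.List.Relation.Unary.Unique.Propositional using (Unique)
open import Data.Nat as ℕ using (ℕ; zero; suc; _+_; _*_; _∸_; _⊓_)
import Data.Nat.DivMod as ℕ
import Data.Nat.Properties as ℕ
open import Data.Product using (_×_; _,_; ∃-syntax)
open import Data.Rational as ℚ using (ℚ; 0ℚ; 1ℚ)
open import Data.Sum using (_⊎_)
open import Data.Vec as Vec using (Vec; []; _∷_)
open import Function using (_∘_)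
open import Level using (Level; _⊔_)
open import Relation.Binary using (DecTotalOrder)
open import Relation.Nullary using (does)
open import Relation.Nullary.Decidable using (_×-dec_; _⊎-dec_; _→-dec_; ¬?)
open import Relation.Unary using (Pred; Decidable)

private
  variable
    a b p : Level
    A : Set a
    B : Set b

fromℕ : ℕ → ℚ
fromℕ m = + m ℚ./ 1

-- Finitely supported laws, as lists of weighted outcomes.
Dist : Set a → Set a
Dist A = List (ℚ × A)

pure : A → Dist A
pure x = (1ℚ , x) ∷ []

infixl 1 _>>=_
_>>=_ : Dist A → (A → Dist B) → Dist B
μ >>= k = concatMap (λ (w , x) → List.map (λ (v , y) → w ℚ.* v , y) (k x)) μ

-- The value on [] is junk; every list it is applied to below is non-empty
-- (as long as N ≥ 1) and free of repetitions.
unif : List A → Dist A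
unif []       = []
unif (x ∷ xs) = List.map (λ y → + 1 ℚ./ suc (List.length xs) , y) (x ∷ xs)

iid : Dist A → (t : ℕ) → Dist (Vec A t)
iid μ zero    = pure []
iid μ (suc t) = μ >>= λ x → iid μ t >>= λ xs → pure (x ∷ xs)

𝔼 : Dist A → (A → ℚ) → ℚ
𝔼 μ f = List.foldr (λ (w , x) s → w ℚ.* f x ℚ.+ s) 0ℚ μ

ℙ : Dist A → {P : Pred A p} → Decidable P → ℚ
ℙ μ P? = 𝔼 μ (λ x → if does (P? x) then 1ℚ else 0ℚ)

-- All weights produced by pure, unif, _>>=_ and iid are positive, so the
-- outcomes listed are exactly those of positive probability.
Surely : {A : Set a} → Pred A p → Dist A → Set (a ⊔ p)
Surely P = All (λ (_ , x) → P x)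

-- n = 2 ^ N throughout.
Pos : ℕ → Set
Pos N = Fin (2 ℕ.^ N)

Pairs : ℕ → Set
Pairs N = List (Pos N × Pos N)

-- All endpoints are distinct: each entry is a genuine pair, and different
-- entries are disjoint.  In particular List.length counts the pairs.
IsMatching : ∀ {N} → Pairs N → Set
IsMatching M = Unique (concatMap (λ (i , j) → i ∷ j ∷ []) M)

module _ (N : ℕ) where

  infix 8 n/2^_
  n/2^_ : ℕ → ℕ
  n/2^ k = (2 ℕ.^ N ℕ./ 2 ℕ.^ k) {{ℕ.m^n≢0 2 k}}

  pos : ℕ → Pos N
  pos i = (i ℕ.mod 2 ℕ.^ N) {{ℕ.m^n≢0 2 N}}

  E : (d k : ℕ) → Pairs N
  E d k = List.map (λ i → pos i , pos (i + d)) (upTo (n/2^ (k + 1)))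

  shift : ℕ → Pairs N → Pairs N
  shift s = List.map (λ (i , j) → pos (s + toℕ i) , pos (s + toℕ j))

  M₀ : (d k : ℕ) → Pairs N
  M₀ d k = concatMap (λ ℓ → shift (ℓ * n/2^ (k ∸ 1)) (E d k))
                     (upTo (2 ℕ.^ (k ∸ 1)))

  M[_] : ℕ → (d k : ℕ) → Pairs N
  M[ r ] d k = shift (r * n/2^ (k + 1)) (M₀ d k)

  -- The integers d with n/2^{k+1} < d ≤ n/2^k, with denominators cleared
  -- because n/2^{k+1} = 1/2 when k = N.
  distances : ℕ → List ℕ
  distances k = filter (λ d → (2 ℕ.^ N ℕ.<? d * 2 ℕ.^ (k + 1))
                              ×-dec (d * 2 ℕ.^ k ℕ.≤? 2 ℕ.^ N))
                       (upTo (suc (2 ℕ.^ N)))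

  -- For K < N the matching is M_R(D , K).  For K = N (so D = 1) the cell
  -- width n/2^{K+1} would be 1/2, and the formula for M_R(D , K) does not
  -- describe n/4 pairs of integers.  There the cells have the least
  -- possible width 1, i.e. the matching is M_R(1 , N - 1), which consists
  -- of the pairs {i , i+1} with i ≡ R (mod 4).  Hence for every K each
  -- pair {i , i+D} lies in M for exactly one of the four values of R.
  q̃ : Dist (Pairs N)
  q̃ = unif (List.map suc (upTo N)) >>= λ K →
      unif (distances K)           >>= λ D →
      unif (upTo 4)                >>= λ R →
      pure (M[ R ] D (K ⊓ (N ∸ 1)))

module Sorter {a ℓ₁ ℓ₂} (O : DecTotalOrder a ℓ₁ ℓ₂) (N : ℕ) where
  open DecTotalOrder O using (Carrier; _≤_; _≤?_)

  Labelling : Set a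
  Labelling = Pos N → Carrier

  Sorted : Pred Labelling ℓ₂
  Sorted x = ∀ i j → i Fin.≤ j → x i ≤ x j

  sorted? : Decidable Sorted
  sorted? x = Fin.all? λ i → Fin.all? λ j → (i Fin.≤? j) →-dec (x i ≤? x j)

  compareSwap : (i j : Pos N) → Labelling → Labelling
  compareSwap i j x = if does (x i ≤? x j) then x else x ∘ transpose i j

  sortPair : Labelling → Pos N × Pos N → Labelling
  sortPair x (i , j) =
    if does (i Fin.≤? j) then compareSwap i j x else compareSwap j i x

  -- The pairs of a matching are disjoint, so the order is immaterial.
  step : Labelling → Pairs N → Labelling
  step = foldl sortPair

  -- T ≤ t, where T is the number of rounds needed to sort x.
  SortedWithin : ∀ {t} → Labelling → Pred (Vec (Pairs N) t) ℓ₂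
  SortedWithin x []       = Sorted x
  SortedWithin x (M ∷ Ms) = Sorted x ⊎ SortedWithin (step x M) Ms

  sortedWithin? : ∀ {t} (x : Labelling) → Decidable (SortedWithin {t} x)
  sortedWithin? x []       = sorted? x
  sortedWithin? x (M ∷ Ms) = sorted? x ⊎-dec sortedWithin? (step x M) Ms

  -- min (T , t)
  cappedRounds : ∀ {t} → Labelling → Vec (Pairs N) t → ℕ
  cappedRounds x []       = 0
  cappedRounds x (M ∷ Ms) =
    if does (sorted? x) then 0 else suc (cappedRounds (step x M) Ms)

  ℙ[T≤_] : ℕ → Labelling → ℚ
  ℙ[T≤ t ] x = ℙ (iid (q̃ N) t) (sortedWithin? x)

  ℙ[T>_] : ℕ → Labelling → ℚ
  ℙ[T> t ] x = ℙ (iid (q̃ N) t) (¬? ∘ sortedWithin? x)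

  𝔼[T∧_] : ℕ → Labelling → ℚ
  𝔼[T∧ t ] x = 𝔼 (iid (q̃ N) t) (fromℕ ∘ cappedRounds x)

  -- T takes values in ℕ ∪ {∞}, and 𝔼[T] = sup_t 𝔼[min (T , t)] by monotone
  -- convergence.  The next two say 𝔼[T] ≤ B and B ≤ 𝔼[T].
  𝔼[T]≤ : Labelling → ℚ → Set
  𝔼[T]≤ x B = ∀ t → 𝔼[T∧ t ] x ℚ.≤ B

  𝔼[T]≥ : Labelling → ℚ → Set
  𝔼[T]≥ x B = ∀ ε → 0ℚ ℚ.< ε → ∃[ t ] B ℚ.≤ 𝔼[T∧ t ] x ℚ.+ ε

-- (lg n)², which is a constant multiple of (log n)².
lg² : ℕ → ℚ
lg² N = fromℕ (N * N)

-- q ≤ n^(-1/e) for q ≥ 0, n = 2 ^ N.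
PolySmall : (e N : ℕ) → ℚ → Set
PolySmall e N q = fromℕ (2 ℕ.^ N) ℚ.* _^_ ℚ.+-*-rawSemiring q e ℚ.≤ 1ℚ

{-# OPTIONS --safe #-}
-- Upper bound.  Replace the labels by the indicators of exceeding a threshold.
-- Sorting an inverted pair of positions i < j then lowers the number of
-- inversions by exactly j - i, while the pair is compared in a given round with
-- probability at least 1/(4 N (j - i)).  So the expected number of inversions
-- decreases by a factor 1 - 1/(4N) in each round.  Summing over the thresholds
-- gives a potential that is at most n³ initially and at least 1 as long as the
-- list is unsorted.
--
-- Lower bound.  Take a single low label, in position n/2 - 1.  The number
-- g(h) = ∏_{i ≤ h} (2i-1)/(2i), of order h^{-1/2}, grows in expectation by a
-- factor of at most 1 + 1/N per round, where h is the position of the low label.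
-- It has to reach g(0) = 1.
module Submission where

open import Defs

-- The law of `D` is harmonic up to a factor 2: averaging over the dyadic scales gives each
-- `d ≤ n/2` a probability between `1/(N d)` and `2/(N d)`, and `R` keeps a cyclic pair at that
-- distance with chance 1/4. In the upper bound the gain `j - i` cancels the `1/d`, so inversions of
-- every length contribute alike. In the lower bound a decreasing `g` is wanted whose harmonic drift
-- `∑ (g(h-d) - g(h))/d` is of order `g(h)`, without a logarithm. The powers `h^(-s)` with
-- `0 < s < 1` have this property because `1/d` is scale invariant; `s = 1/2` is taken because its
-- convolution with `1/d` can be computed exactly. The obstacle is that distances are cyclic. A pair
-- that wraps around has linear distance `n - D ≥ D`. It can only help the upper bound, but it could
-- carry a low label from the end of the list to the front in one round. Hence the low label starts
-- just below the middle, and the half above it stays free of low labels. All estimates are made in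
-- ℚ: Bernoulli's inequality replaces exponentials, and squares and sixteenth powers replace roots.

module Development where

  open import Data.Bool using (true; false; if_then_else_)
  open import Data.Empty using (⊥-elim)
  open import Data.Fin as Fin using (Fin; toℕ)
  import Data.Fin.Properties as Fin
  open import Data.Fin.Permutation.Components using (transpose; transpose-inverse)
  import Data.Integer as ℤ
  import Data.Integer.Properties as ℤ
  open import Data.List as List using (List; []; _∷_; _++_; length; upTo; applyUpTo; concatMap)
  import Data.List.Properties as List
  open import Data.List.Relation.Unary.All as All using (All; []; _∷_)
  import Data.List.Relation.Unary.All.Properties as All
  open import Data.List.Relation.Unary.AllPairs using ([]; _∷_)
  open import Data.List.Membership.Propositional using (_∈_)
  import Data.List.Membership.Propositional.Properties as ∈
  import Data.List.Relation.Unary.AllPairs as AllPairs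
  import Data.List.Relation.Unary.AllPairs.Properties as AllPairs
  open import Data.List.Relation.Unary.Unique.Propositional using (Unique)
  import Data.List.Relation.Unary.Unique.Propositional.Properties as Unique
  open import Data.Nat as ℕ using (ℕ; zero; suc; z≤n; s≤s; _∸_)
  import Data.Nat.DivMod as ℕ
  import Data.Nat.Properties as ℕ
  import Data.Nat.Divisibility as ℕ
  import Data.Nat.Tactic.RingSolver as ℕSolver
  open import Data.Product using (_×_; _,_; proj₁; proj₂; ∃-syntax)
  open import Data.Rational hiding (pos)
  open import Data.Rational.Properties hiding (_≟_; _≤?_)
  import Data.Rational.Properties as ℚ
  import Data.Rational.Unnormalised as ℚᵘ
  import Data.Rational.Unnormalised.Properties as ℚᵘ
  open import Data.Sum using (_⊎_; inj₁; inj₂)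
  open import Data.Vec using (Vec; []; _∷_)
  open import Function using (_∘_; id)
  open import Level using (Level; 0ℓ)
  open import Relation.Binary using (DecTotalOrder)
  open import Relation.Binary.PropositionalEquality
  open import Relation.Nullary using (¬_; Dec; yes; no; does)
  open import Relation.Nullary.Decidable using (dec⇒maybe; dec-true; dec-false; _×-dec_; _→-dec_; ¬?)
  open import Relation.Unary using (Pred; Decidable)
  open import Tactic.RingSolver using (solve-∀)
  open import Tactic.RingSolver.Core.AlmostCommutativeRing using (AlmostCommutativeRing; fromCommutativeRing)
  open import Algebra.Definitions.RawSemiring +-*-rawSemiring using (_^_)
  import Algebra.Properties.CommutativeSemiring.Exp as Exp
  open import Algebra.Bundles using (CommutativeRing)

  private
    variable
      α β : Level
      A : Set α
      B : Set β

  ℚ-ring : AlmostCommutativeRing 0ℓ 0ℓ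
  ℚ-ring = fromCommutativeRing +-*-commutativeRing (λ x → dec⇒maybe (0ℚ ℚ.≟ x))

  -- Rational arithmetic

  ≤-by : ∀ {p q} r → 0ℚ ≤ r → p + r ≡ q → p ≤ q
  ≤-by {p} r 0≤r refl = subst (_≤ p + r) (+-identityʳ p) (+-monoʳ-≤ p 0≤r)

  p≤q⇒0≤q-p : ∀ {p q} → p ≤ q → 0ℚ ≤ q - p
  p≤q⇒0≤q-p {p} p≤q = ≤-trans (≤-reflexive (sym (+-inverseʳ p))) (+-monoˡ-≤ (- p) p≤q)

  0≤+ : ∀ {p q} → 0ℚ ≤ p → 0ℚ ≤ q → 0ℚ ≤ p + q
  0≤+ = +-mono-≤

  *-mono-≤ : ∀ {p q r s} → 0ℚ ≤ r → 0ℚ ≤ q → p ≤ q → r ≤ s → p * r ≤ q * s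
  *-mono-≤ {q = q} {r = r} 0≤r 0≤q p≤q r≤s = ≤-trans
    (*-monoʳ-≤-nonNeg r {{nonNegative 0≤r}} p≤q)
    (*-monoˡ-≤-nonNeg q {{nonNegative 0≤q}} r≤s)

  *-monoˡ : ∀ {p q r} → 0ℚ ≤ r → p ≤ q → r * p ≤ r * q
  *-monoˡ {r = r} 0≤r = *-monoˡ-≤-nonNeg r {{nonNegative 0≤r}}

  *-monoʳ : ∀ {p q r} → 0ℚ ≤ r → p ≤ q → p * r ≤ q * r
  *-monoʳ {r = r} 0≤r = *-monoʳ-≤-nonNeg r {{nonNegative 0≤r}}

  0≤* : ∀ {p q} → 0ℚ ≤ p → 0ℚ ≤ q → 0ℚ ≤ p * q
  0≤* {p} 0≤p 0≤q = ≤-trans (≤-reflexive (sym (*-zeroʳ p))) (*-monoˡ 0≤p 0≤q)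

  0≤1 : 0ℚ ≤ 1ℚ
  0≤1 = nonNegative⁻¹ 1ℚ

  *-cancelˡ-≤ : ∀ {p q r} → 0ℚ < r → r * p ≤ r * q → p ≤ q
  *-cancelˡ-≤ {r = r} 0<r = *-cancelˡ-≤-pos r {{positive 0<r}}

  *-cancelˡ-≡ : ∀ {p q r} → 0ℚ < r → r * p ≡ r * q → p ≡ q
  *-cancelˡ-≡ 0<r e = ≤-antisym (*-cancelˡ-≤ 0<r (≤-reflexive e)) (*-cancelˡ-≤ 0<r (≤-reflexive (sym e)))

  fromℕ-+ : ∀ m n → fromℕ (m ℕ.+ n) ≡ fromℕ m + fromℕ n
  fromℕ-+ m n = toℚᵘ-injective (begin
    toℚᵘ (fromℕ (m ℕ.+ n))                                ≈⟨ toℚᵘ-fromℚᵘ (ℚᵘ.mkℚᵘ (ℤ.+ (m ℕ.+ n)) 0) ⟩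
    ℚᵘ.mkℚᵘ (ℤ.+ (m ℕ.+ n)) 0                               ≈⟨ ℚᵘ.*≡* (cong₂ (λ a b → (a ℤ.+ b) ℤ.* ℤ.+ 1) (sym (ℤ.*-identityʳ (ℤ.+ m))) (sym (ℤ.*-identityʳ (ℤ.+ n)))) ⟩
    ℚᵘ.mkℚᵘ (ℤ.+ m) 0 ℚᵘ.+ ℚᵘ.mkℚᵘ (ℤ.+ n) 0                  ≈⟨ ℚᵘ.+-cong (toℚᵘ-fromℚᵘ (ℚᵘ.mkℚᵘ (ℤ.+ m) 0)) (toℚᵘ-fromℚᵘ (ℚᵘ.mkℚᵘ (ℤ.+ n) 0)) ⟨
    toℚᵘ (fromℕ m) ℚᵘ.+ toℚᵘ (fromℕ n)                    ≈⟨ toℚᵘ-homo-+ (fromℕ m) (fromℕ n) ⟨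
    toℚᵘ (fromℕ m + fromℕ n)                              ∎)
    where open ℚᵘ.≃-Reasoning

  fromℕ-* : ∀ m n → fromℕ (m ℕ.* n) ≡ fromℕ m * fromℕ n
  fromℕ-* zero    n = sym (*-zeroˡ (fromℕ n))
  fromℕ-* (suc m) n = begin
    fromℕ (n ℕ.+ m ℕ.* n)              ≡⟨ fromℕ-+ n (m ℕ.* n) ⟩
    fromℕ n + fromℕ (m ℕ.* n)          ≡⟨ cong (λ z → fromℕ n + z) (fromℕ-* m n) ⟩
    fromℕ n + fromℕ m * fromℕ n        ≡⟨ lemma (fromℕ m) (fromℕ n) ⟩
    (1ℚ + fromℕ m) * fromℕ n           ≡⟨ cong (_* fromℕ n) (fromℕ-+ 1 m) ⟨
    fromℕ (suc m) * fromℕ n            ∎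
    where
    open ≡-Reasoning
    lemma : ∀ a b → b + a * b ≡ (1ℚ + a) * b
    lemma = solve-∀ ℚ-ring

  fromℕ-suc : ∀ n → fromℕ (suc n) ≡ 1ℚ + fromℕ n
  fromℕ-suc = fromℕ-+ 1

  0≤fromℕ : ∀ n → 0ℚ ≤ fromℕ n
  0≤fromℕ zero    = ≤-refl
  0≤fromℕ (suc n) = subst (0ℚ ≤_) (sym (fromℕ-suc n)) (0≤+ 0≤1 (0≤fromℕ n))

  fromℕ-mono-≤ : ∀ {m n} → m ℕ.≤ n → fromℕ m ≤ fromℕ n
  fromℕ-mono-≤ {m} {n} m≤n = ≤-by (fromℕ (n ∸ m)) (0≤fromℕ (n ∸ m))
    (trans (sym (fromℕ-+ m (n ∸ m))) (cong fromℕ (ℕ.m+[n∸m]≡n m≤n)))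

  n<1+n : ∀ p → p < 1ℚ + p
  n<1+n p = subst (_< 1ℚ + p) (+-identityˡ p) (+-monoˡ-< p (positive⁻¹ 1ℚ))

  fromℕ-mono-< : ∀ {m n} → m ℕ.< n → fromℕ m < fromℕ n
  fromℕ-mono-< {m} {n} m<n = <-≤-trans (n<1+n (fromℕ m))
    (subst (_≤ fromℕ n) (fromℕ-suc m) (fromℕ-mono-≤ m<n))

  fromℕ-cancel-≤ : ∀ {m n} → fromℕ m ≤ fromℕ n → m ℕ.≤ n
  fromℕ-cancel-≤ {m} {n} p with m ℕ.≤? n
  ... | yes m≤n = m≤n
  ... | no  m≰n = ⊥-elim (<-irrefl refl (<-≤-trans (fromℕ-mono-< (ℕ.≰⇒> m≰n)) p))

  0<fromℕ-suc : ∀ n → 0ℚ < fromℕ (suc n)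
  0<fromℕ-suc n = fromℕ-mono-< {0} {suc n} (s≤s z≤n)

  -- recip m is 1/(m+1).
  recip : ℕ → ℚ
  recip m = ℤ.+ 1 / suc m

  recip-*ˡ : ∀ m → fromℕ (suc m) * recip m ≡ 1ℚ
  recip-*ˡ m = toℚᵘ-injective (begin
    toℚᵘ (fromℕ (suc m) * recip m)                        ≈⟨ toℚᵘ-homo-* (fromℕ (suc m)) (recip m) ⟩
    toℚᵘ (fromℕ (suc m)) ℚᵘ.* toℚᵘ (recip m)              ≈⟨ ℚᵘ.*-cong (toℚᵘ-fromℚᵘ (ℚᵘ.mkℚᵘ (ℤ.+ suc m) 0)) (toℚᵘ-fromℚᵘ (ℚᵘ.mkℚᵘ (ℤ.+ 1) m)) ⟩
    ℚᵘ.mkℚᵘ (ℤ.+ suc m) 0 ℚᵘ.* ℚᵘ.mkℚᵘ (ℤ.+ 1) m              ≈⟨ ℚᵘ.*≡* (cong ℤ.+_ (lemma (suc m))) ⟩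
    ℚᵘ.mkℚᵘ (ℤ.+ 1) 0                                       ∎)
    where
    open ℚᵘ.≃-Reasoning
    lemma : ∀ a → a ℕ.* 1 ℕ.* 1 ≡ 1 ℕ.* (1 ℕ.* a)
    lemma = ℕSolver.solve-∀

  0≤recip : ∀ m → 0ℚ ≤ recip m
  0≤recip m = nonNegative⁻¹ (recip m) {{normalize-nonNeg 1 (suc m)}}

  recip-cancelˡ : ∀ m p → fromℕ (suc m) * (recip m * p) ≡ p
  recip-cancelˡ m p = trans (sym (*-assoc (fromℕ (suc m)) (recip m) p))
    (trans (cong (_* p) (recip-*ˡ m)) (*-identityˡ p))

  ≤-recip : ∀ m {p q} → fromℕ (suc m) * p ≤ q → p ≤ recip m * q
  ≤-recip m {p} {q} h = *-cancelˡ-≤ (0<fromℕ-suc m)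
    (subst (fromℕ (suc m) * p ≤_) (sym (recip-cancelˡ m q)) h)

  recip-≤ : ∀ m {p q} → p ≤ fromℕ (suc m) * q → recip m * p ≤ q
  recip-≤ m {p} {q} h = *-cancelˡ-≤ (0<fromℕ-suc m)
    (subst (_≤ fromℕ (suc m) * q) (sym (recip-cancelˡ m p)) h)

  -- Finite sums

  sum : ℕ → (ℕ → ℚ) → ℚ
  sum zero    f = 0ℚ
  sum (suc n) f = f 0 + sum n (f ∘ suc)

  infix 5 sum
  syntax sum n (λ i → e) = ∑[ i < n ] e

  ∑-cong : ∀ n {f g : ℕ → ℚ} → (∀ i → i ℕ.< n → f i ≡ g i) → sum n f ≡ sum n g
  ∑-cong zero    eq = refl
  ∑-cong (suc n) eq = cong₂ _+_ (eq 0 (s≤s z≤n)) (∑-cong n (λ i i<n → eq (suc i) (s≤s i<n)))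

  ∑-mono : ∀ n {f g : ℕ → ℚ} → (∀ i → i ℕ.< n → f i ≤ g i) → sum n f ≤ sum n g
  ∑-mono zero    le = ≤-refl
  ∑-mono (suc n) le = +-mono-≤ (le 0 (s≤s z≤n)) (∑-mono n (λ i i<n → le (suc i) (s≤s i<n)))

  ∑-const : ∀ n c → sum n (λ _ → c) ≡ fromℕ n * c
  ∑-const zero    c = sym (*-zeroˡ c)
  ∑-const (suc n) c = trans (cong (c +_) (∑-const n c))
    (trans (lemma (fromℕ n) c) (cong (_* c) (sym (fromℕ-suc n))))
    where
    lemma : ∀ a b → b + a * b ≡ (1ℚ + a) * b
    lemma = solve-∀ ℚ-ring

  ∑-0 : ∀ n {f : ℕ → ℚ} → (∀ i → i ℕ.< n → f i ≡ 0ℚ) → sum n f ≡ 0ℚ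
  ∑-0 n eq = trans (∑-cong n eq) (trans (∑-const n 0ℚ) (*-zeroʳ (fromℕ n)))

  0≤∑ : ∀ n {f : ℕ → ℚ} → (∀ i → i ℕ.< n → 0ℚ ≤ f i) → 0ℚ ≤ sum n f
  0≤∑ n le = ≤-trans (≤-reflexive (sym (∑-0 n (λ _ _ → refl)))) (∑-mono n le)

  ∑-distrib-+ : ∀ n (f g : ℕ → ℚ) → sum n (λ i → f i + g i) ≡ sum n f + sum n g
  ∑-distrib-+ zero    f g = refl
  ∑-distrib-+ (suc n) f g = trans (cong (f 0 + g 0 +_) (∑-distrib-+ n (f ∘ suc) (g ∘ suc)))
    (lemma (f 0) (g 0) _ _)
    where
    lemma : ∀ a b c d → a + b + (c + d) ≡ a + c + (b + d)
    lemma = solve-∀ ℚ-ring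

  ∑-*ˡ : ∀ n c (f : ℕ → ℚ) → sum n (λ i → c * f i) ≡ c * sum n f
  ∑-*ˡ zero    c f = sym (*-zeroʳ c)
  ∑-*ˡ (suc n) c f = trans (cong (c * f 0 +_) (∑-*ˡ n c (f ∘ suc))) (sym (*-distribˡ-+ c _ _))

  ∑-*ʳ : ∀ n c (f : ℕ → ℚ) → sum n (λ i → f i * c) ≡ sum n f * c
  ∑-*ʳ n c f = trans (∑-cong n (λ i _ → *-comm (f i) c)) (trans (∑-*ˡ n c f) (*-comm c _))

  ∑-last : ∀ n (f : ℕ → ℚ) → sum (suc n) f ≡ sum n f + f n
  ∑-last zero    f = +-comm (f 0) 0ℚ
  ∑-last (suc n) f = trans (cong (f 0 +_) (∑-last n (f ∘ suc))) (sym (+-assoc (f 0) _ _))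

  ∑-split : ∀ m n (f : ℕ → ℚ) → sum (m ℕ.+ n) f ≡ sum m f + sum n (λ i → f (m ℕ.+ i))
  ∑-split zero    n f = sym (+-identityˡ _)
  ∑-split (suc m) n f = trans (cong (f 0 +_) (∑-split m n (f ∘ suc))) (sym (+-assoc (f 0) _ _))

  ∑-block : ∀ m n (f : ℕ → ℚ) → sum (m ℕ.* n) f ≡ ∑[ l < m ] ∑[ i < n ] f (l ℕ.* n ℕ.+ i)
  ∑-block zero    n f = refl
  ∑-block (suc m) n f = trans (∑-split n (m ℕ.* n) f) (cong (sum n f +_)
    (trans (∑-block m n (λ i → f (n ℕ.+ i)))
      (∑-cong m λ l _ → ∑-cong n λ i _ → cong f (sym (ℕ.+-assoc n (l ℕ.* n) i)))))

  ∑-swap : ∀ m n (f : ℕ → ℕ → ℚ) → ∑[ i < m ] ∑[ j < n ] f i j ≡ ∑[ j < n ] ∑[ i < m ] f i j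
  ∑-swap zero    n f = sym (∑-0 n (λ _ _ → refl))
  ∑-swap (suc m) n f = trans (cong (sum n (f 0) +_) (∑-swap m n (f ∘ suc)))
    (sym (∑-distrib-+ n (f 0) _))

  ∑-reverse : ∀ n (f : ℕ → ℚ) → sum n f ≡ ∑[ i < n ] f (n ∸ suc i)
  ∑-reverse zero    f = refl
  ∑-reverse (suc n) f = trans (∑-last n f) (trans (+-comm _ (f n)) (cong (f n +_) (∑-reverse n f)))

  ∑-extend : ∀ {m n} (f : ℕ → ℚ) → (∀ i → i ℕ.< n → 0ℚ ≤ f i) → m ℕ.≤ n → sum m f ≤ sum n f
  ∑-extend {m} {n} f 0≤f m≤n = ≤-by (∑[ i < n ∸ m ] f (m ℕ.+ i))
    (0≤∑ (n ∸ m) (λ i i<n∸m → 0≤f (m ℕ.+ i) (subst (m ℕ.+ i ℕ.<_) (ℕ.m+[n∸m]≡n m≤n) (ℕ.+-monoʳ-< m i<n∸m))))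
    (trans (sym (∑-split m (n ∸ m) f)) (cong (λ z → sum z f) (ℕ.m+[n∸m]≡n m≤n)))

  ∑-term : ∀ {n} (f : ℕ → ℚ) → (∀ i → i ℕ.< n → 0ℚ ≤ f i) → ∀ {i} → i ℕ.< n → f i ≤ sum n f
  ∑-term {n} f 0≤f {i} i<n = ≤-trans
    (≤-by (sum i f) (0≤∑ i (λ j j<i → 0≤f j (ℕ.<-trans j<i i<n)))
          (trans (+-comm (f i) _) (sym (∑-last i f))))
    (∑-extend f 0≤f i<n)

  -- Regroups the pairs `i < j` by their difference. When `n` grows by one, each difference gains
  -- exactly the pair that ends at the new position, and `∑-reverse` lists these pairs by their left
  -- endpoints.
  ∑-triangle : ∀ n (f : ℕ → ℕ → ℚ) →
    ∑[ d < n ] ∑[ i < n ∸ suc d ] f i (i ℕ.+ suc d) ≡ ∑[ j < n ] ∑[ i < j ] f i j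
  ∑-triangle zero    f = refl
  ∑-triangle (suc n) f = begin
    ∑[ d < suc n ] ∑[ i < n ∸ d ] f i (i ℕ.+ suc d)
      ≡⟨ ∑-last n _ ⟩
    (∑[ d < n ] ∑[ i < n ∸ d ] f i (i ℕ.+ suc d)) + (∑[ i < n ∸ n ] f i (i ℕ.+ suc n))
      ≡⟨ cong₂ _+_ (∑-cong n inner) (cong (λ z → ∑[ i < z ] f i (i ℕ.+ suc n)) (ℕ.n∸n≡0 n)) ⟩
    (∑[ d < n ] ((∑[ i < n ∸ suc d ] f i (i ℕ.+ suc d)) + f (n ∸ suc d) n)) + 0ℚ
      ≡⟨ +-identityʳ _ ⟩
    (∑[ d < n ] ((∑[ i < n ∸ suc d ] f i (i ℕ.+ suc d)) + f (n ∸ suc d) n))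
      ≡⟨ ∑-distrib-+ n _ _ ⟩
    (∑[ d < n ] ∑[ i < n ∸ suc d ] f i (i ℕ.+ suc d)) + (∑[ d < n ] f (n ∸ suc d) n)
      ≡⟨ cong₂ _+_ (∑-triangle n f) (sym (∑-reverse n (λ i → f i n))) ⟩
    (∑[ j < n ] ∑[ i < j ] f i j) + (∑[ i < n ] f i n)
      ≡⟨ ∑-last n _ ⟨
    ∑[ j < suc n ] ∑[ i < j ] f i j ∎
    where
    open ≡-Reasoning
    inner : ∀ d → d ℕ.< n → ∑[ i < n ∸ d ] f i (i ℕ.+ suc d) ≡ (∑[ i < n ∸ suc d ] f i (i ℕ.+ suc d)) + f (n ∸ suc d) n
    inner d d<n = begin
      ∑[ i < n ∸ d ] f i (i ℕ.+ suc d)                ≡⟨ cong (λ z → ∑[ i < z ] f i (i ℕ.+ suc d)) (ℕ.+-∸-assoc 1 d<n) ⟩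
      ∑[ i < suc (n ∸ suc d) ] f i (i ℕ.+ suc d)      ≡⟨ ∑-last (n ∸ suc d) _ ⟩
      (∑[ i < n ∸ suc d ] f i (i ℕ.+ suc d)) + f (n ∸ suc d) (n ∸ suc d ℕ.+ suc d)
        ≡⟨ cong (λ z → (∑[ i < n ∸ suc d ] f i (i ℕ.+ suc d)) + f (n ∸ suc d) z) (ℕ.m∸n+n≡m d<n) ⟩
      (∑[ i < n ∸ suc d ] f i (i ℕ.+ suc d)) + f (n ∸ suc d) n ∎

  [_≡ᵇ_] : ℕ → ℕ → ℚ
  [ i ≡ᵇ j ] = if i ℕ.≡ᵇ j then 1ℚ else 0ℚ

  ∑-delta : ∀ {n k} → k ℕ.< n → (f : ℕ → ℚ) → ∑[ i < n ] [ k ≡ᵇ i ] * f i ≡ f k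
  ∑-delta {suc n} {zero} _ f = trans (cong₂ _+_ (*-identityˡ (f 0)) (∑-0 n (λ i _ → *-zeroˡ (f (suc i))))) (+-identityʳ (f 0))
  ∑-delta {suc n} {suc k} (s≤s k<n) f = trans (cong₂ _+_ (*-zeroˡ (f 0)) (∑-delta k<n (f ∘ suc))) (+-identityˡ _)

  -- Expectations

  listSum : List A → (A → ℚ) → ℚ
  listSum xs f = List.foldr (λ x s → f x + s) 0ℚ xs

  listSum-upTo : ∀ n (f : ℕ → ℚ) → listSum (upTo n) f ≡ sum n f
  listSum-upTo n f = go n id
    where
    go : ∀ n h → listSum (applyUpTo h n) f ≡ sum n (f ∘ h)
    go zero    h = refl
    go (suc n) h = cong (f (h 0) +_) (go n (h ∘ suc))

  listSum-map : (h : A → B) (xs : List A) (f : B → ℚ) → listSum (List.map h xs) f ≡ listSum xs (f ∘ h)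
  listSum-map h []       f = refl
  listSum-map h (x ∷ xs) f = cong (f (h x) +_) (listSum-map h xs f)

  listSum-++ : (xs ys : List A) (f : A → ℚ) → listSum (xs ++ ys) f ≡ listSum xs f + listSum ys f
  listSum-++ []       ys f = sym (+-identityˡ _)
  listSum-++ (x ∷ xs) ys f = trans (cong (f x +_) (listSum-++ xs ys f)) (sym (+-assoc (f x) _ _))

  listSum-concatMap : (h : A → List B) (xs : List A) (f : B → ℚ) →
    listSum (concatMap h xs) f ≡ listSum xs (λ x → listSum (h x) f)
  listSum-concatMap h []       f = refl
  listSum-concatMap h (x ∷ xs) f =
    trans (listSum-++ (h x) (concatMap h xs) f) (cong (listSum (h x) f +_) (listSum-concatMap h xs f))

  listSum-cong : (xs : List A) {f g : A → ℚ} → (∀ x → f x ≡ g x) → listSum xs f ≡ listSum xs g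
  listSum-cong []       eq = refl
  listSum-cong (x ∷ xs) eq = cong₂ _+_ (eq x) (listSum-cong xs eq)

  listSum-cong-All : {xs : List A} {f g : A → ℚ} → All (λ x → f x ≡ g x) xs → listSum xs f ≡ listSum xs g
  listSum-cong-All []         = refl
  listSum-cong-All (eq ∷ eqs) = cong₂ _+_ eq (listSum-cong-All eqs)

  𝔼-cong : (μ : Dist A) {f g : A → ℚ} → (∀ x → f x ≡ g x) → 𝔼 μ f ≡ 𝔼 μ g
  𝔼-cong []            eq = refl
  𝔼-cong ((w , x) ∷ μ) eq = cong₂ _+_ (cong (w *_) (eq x)) (𝔼-cong μ eq)

  𝔼-+ : (μ : Dist A) (f g : A → ℚ) → 𝔼 μ (λ x → f x + g x) ≡ 𝔼 μ f + 𝔼 μ g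
  𝔼-+ []            f g = refl
  𝔼-+ ((w , x) ∷ μ) f g = trans (cong (w * (f x + g x) +_) (𝔼-+ μ f g)) (lemma w (f x) (g x) _ _)
    where
    lemma : ∀ w a b c d → w * (a + b) + (c + d) ≡ (w * a + c) + (w * b + d)
    lemma = solve-∀ ℚ-ring

  𝔼-*ˡ : (μ : Dist A) (c : ℚ) (f : A → ℚ) → 𝔼 μ (λ x → c * f x) ≡ c * 𝔼 μ f
  𝔼-*ˡ []            c f = sym (*-zeroʳ c)
  𝔼-*ˡ ((w , x) ∷ μ) c f = trans (cong (w * (c * f x) +_) (𝔼-*ˡ μ c f)) (lemma w c (f x) _)
    where
    lemma : ∀ w c a d → w * (c * a) + c * d ≡ c * (w * a + d)
    lemma = solve-∀ ℚ-ring

  𝔼-∑ : (μ : Dist A) (n : ℕ) (f : ℕ → A → ℚ) → 𝔼 μ (λ x → ∑[ i < n ] f i x) ≡ ∑[ i < n ] 𝔼 μ (f i)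
  𝔼-∑ μ zero    f = trans (𝔼-*ˡ μ 0ℚ (λ _ → 0ℚ)) (*-zeroˡ (𝔼 μ (λ _ → 0ℚ)))
  𝔼-∑ μ (suc n) f = trans (𝔼-+ μ (f 0) _) (cong (𝔼 μ (f 0) +_) (𝔼-∑ μ n (f ∘ suc)))

  𝔼-++ : (μ ν : Dist A) (f : A → ℚ) → 𝔼 (μ ++ ν) f ≡ 𝔼 μ f + 𝔼 ν f
  𝔼-++ []            ν f = sym (+-identityˡ _)
  𝔼-++ ((w , x) ∷ μ) ν f = trans (cong (w * f x +_) (𝔼-++ μ ν f)) (sym (+-assoc (w * f x) _ _))

  𝔼-scale : (w : ℚ) (μ : Dist A) (f : A → ℚ) →
    𝔼 (List.map (λ (v , y) → w * v , y) μ) f ≡ w * 𝔼 μ f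
  𝔼-scale w []            f = sym (*-zeroʳ w)
  𝔼-scale w ((v , x) ∷ μ) f = trans (cong (w * v * f x +_) (𝔼-scale w μ f)) (lemma w v (f x) _)
    where
    lemma : ∀ w v a d → w * v * a + w * d ≡ w * (v * a + d)
    lemma = solve-∀ ℚ-ring

  𝔼->>= : (μ : Dist A) (k : A → Dist B) (f : B → ℚ) → 𝔼 (μ >>= k) f ≡ 𝔼 μ (λ x → 𝔼 (k x) f)
  𝔼->>= []            k f = refl
  𝔼->>= ((w , x) ∷ μ) k f = trans (𝔼-++ (List.map _ (k x)) (μ >>= k) f)
    (cong₂ _+_ (𝔼-scale w (k x) f) (𝔼->>= μ k f))

  𝔼-pure : (x : A) (f : A → ℚ) → 𝔼 (pure x) f ≡ f x
  𝔼-pure x f = trans (+-identityʳ _) (*-identityˡ (f x))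

  𝔼-unif : (x : A) (xs : List A) (f : A → ℚ) →
    𝔼 (unif (x ∷ xs)) f ≡ recip (length xs) * listSum (x ∷ xs) f
  𝔼-unif {A = A} x xs f = go (recip (length xs)) (x ∷ xs)
    where
    go : ∀ w (ys : List A) → 𝔼 (List.map (λ y → w , y) ys) f ≡ w * listSum ys f
    go w []       = sym (*-zeroʳ w)
    go w (y ∷ ys) = trans (cong (w * f y +_) (go w ys)) (sym (*-distribˡ-+ w (f y) _))

  -- A `Dist` need not be a probability law. The signs of the weights give monotonicity of `𝔼`; the
  -- total mass lets constants pass through.
  Law : Dist A → Set _
  Law μ = All (λ p → 0ℚ ≤ proj₁ p) μ × 𝔼 μ (λ _ → 1ℚ) ≡ 1ℚ

  𝔼-mono-weights : {μ : Dist A} → All (λ p → 0ℚ ≤ proj₁ p) μ →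
    {f g : A → ℚ} → (∀ x → f x ≤ g x) → 𝔼 μ f ≤ 𝔼 μ g
  𝔼-mono-weights []         le = ≤-refl
  𝔼-mono-weights (0≤w ∷ ws) le = +-mono-≤ (*-monoˡ 0≤w (le _)) (𝔼-mono-weights ws le)

  𝔼-mono : {μ : Dist A} → Law μ → {f g : A → ℚ} → (∀ x → f x ≤ g x) → 𝔼 μ f ≤ 𝔼 μ g
  𝔼-mono (ws , _) = 𝔼-mono-weights ws

  𝔼-const : {μ : Dist A} → Law μ → ∀ c → 𝔼 μ (λ _ → c) ≡ c
  𝔼-const {μ = μ} (_ , total) c = begin
    𝔼 μ (λ _ → c)         ≡⟨ 𝔼-cong μ (λ _ → sym (*-identityʳ c)) ⟩
    𝔼 μ (λ _ → c * 1ℚ)    ≡⟨ 𝔼-*ˡ μ c (λ _ → 1ℚ) ⟩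
    c * 𝔼 μ (λ _ → 1ℚ)    ≡⟨ cong (c *_) total ⟩
    c * 1ℚ                ≡⟨ *-identityʳ c ⟩
    c                     ∎
    where open ≡-Reasoning

  Law-pure : (x : A) → Law (pure x)
  Law-pure x = 0≤1 ∷ [] , refl

  Law-unif : (x : A) (xs : List A) → Law (unif (x ∷ xs))
  Law-unif x xs = All.map⁺ (All.universal (λ _ → 0≤recip (length xs)) (x ∷ xs)) ,
    trans (𝔼-unif x xs (λ _ → 1ℚ))
      (trans (cong (recip (length xs) *_) (ones (x ∷ xs)))
        (trans (*-comm (recip (length xs)) (fromℕ (length (x ∷ xs)))) (recip-*ˡ (length xs))))
    where
    ones : (ys : List _) → listSum ys (λ _ → 1ℚ) ≡ fromℕ (length ys)
    ones []       = refl
    ones (y ∷ ys) = trans (cong (1ℚ +_) (ones ys)) (sym (fromℕ-suc (length ys)))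

  Law->>= : (μ : Dist A) (k : A → Dist B) → Law μ → Surely (Law ∘ k) μ → Law (μ >>= k)
  Law->>= {A = A} μ k (ws , total) ls =
    weights ws ls , trans (𝔼->>= μ k (λ _ → 1ℚ)) (trans (totals ls) total)
    where
    weights : {μ : Dist A} → All (λ p → 0ℚ ≤ proj₁ p) μ → Surely (Law ∘ k) μ → All (λ p → 0ℚ ≤ proj₁ p) (μ >>= k)
    weights []         []       = []
    weights (0≤w ∷ ws) (l ∷ ls) =
      All.++⁺ (All.map⁺ (All.map (0≤* 0≤w) (proj₁ l))) (weights ws ls)
    totals : {μ : Dist A} → Surely (Law ∘ k) μ → 𝔼 μ (λ x → 𝔼 (k x) (λ _ → 1ℚ)) ≡ 𝔼 μ (λ _ → 1ℚ)
    totals []                         = refl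
    totals {(w , x) ∷ μ} (l ∷ ls) = cong₂ _+_ (cong (w *_) (proj₂ l)) (totals ls)

  Surely-pure : ∀ {p} {P : Pred A p} {x : A} → P x → Surely P (pure x)
  Surely-pure px = px ∷ []

  Surely-unif : ∀ {p} {P : Pred A p} {xs : List A} → All P xs → Surely P (unif xs)
  Surely-unif []         = []
  Surely-unif (px ∷ pxs) = All.map⁺ (px ∷ pxs)

  Surely->>= : ∀ {p} {P : Pred B p} (μ : Dist A) (k : A → Dist B) →
    Surely (λ x → Surely P (k x)) μ → Surely P (μ >>= k)
  Surely->>= []            k []       = []
  Surely->>= ((w , x) ∷ μ) k (s ∷ ss) = All.++⁺ (All.map⁺ (All.map id s)) (Surely->>= μ k ss)

  Law-iid : {μ : Dist A} → Law μ → ∀ t → Law (iid μ t)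
  Law-iid l zero    = Law-pure []
  Law-iid {μ = μ} l (suc t) = Law->>= μ _ l (All.universal (λ (_ , x) →
    Law->>= (iid μ t) (λ xs → pure (x ∷ xs)) (Law-iid l t) (All.universal (λ _ → Law-pure _) _)) _)

  𝔼-iid-suc : (μ : Dist A) (t : ℕ) (f : Vec A (suc t) → ℚ) →
    𝔼 (iid μ (suc t)) f ≡ 𝔼 μ (λ x → 𝔼 (iid μ t) (λ xs → f (x ∷ xs)))
  𝔼-iid-suc μ t f = trans (𝔼->>= μ _ f) (𝔼-cong μ λ x →
    trans (𝔼->>= (iid μ t) _ f) (𝔼-cong (iid μ t) λ xs → 𝔼-pure (x ∷ xs) f))

  -- The matchings

  -- Adding `c * (m - 1)` undoes the addition of `c` modulo `m` without leaving ℕ.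
  %-cancelʳ : ∀ {x y} c m .{{_ : ℕ.NonZero m}} → (x ℕ.+ c) ℕ.% m ≡ (y ℕ.+ c) ℕ.% m → x ℕ.% m ≡ y ℕ.% m
  %-cancelʳ {x} {y} c m@(suc m-1) eq = begin
    x ℕ.% m                                                  ≡⟨ expand x ⟩
    ((x ℕ.+ c) ℕ.% m ℕ.+ (c ℕ.* m-1) ℕ.% m) ℕ.% m            ≡⟨ cong (λ z → (z ℕ.+ (c ℕ.* m-1) ℕ.% m) ℕ.% m) eq ⟩
    ((y ℕ.+ c) ℕ.% m ℕ.+ (c ℕ.* m-1) ℕ.% m) ℕ.% m            ≡⟨ expand y ⟨
    y ℕ.% m                                                  ∎
    where
    open ≡-Reasoning
    regroup : ∀ x c m → x ℕ.+ c ℕ.* suc m ≡ x ℕ.+ c ℕ.+ c ℕ.* m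
    regroup = ℕSolver.solve-∀
    expand : ∀ x → x ℕ.% m ≡ ((x ℕ.+ c) ℕ.% m ℕ.+ (c ℕ.* m-1) ℕ.% m) ℕ.% m
    expand x = trans (sym (ℕ.[m+kn]%n≡m%n x c m))
      (trans (cong (ℕ._% m) (regroup x c m-1)) (ℕ.%-distribˡ-+ (x ℕ.+ c) (c ℕ.* m-1) m))

  length-concatMap : (h : A → List B) {w : ℕ} → (∀ x → length (h x) ≡ w) →
    ∀ xs → length (concatMap h xs) ≡ length xs ℕ.* w
  length-concatMap h len []       = refl
  length-concatMap h len (x ∷ xs) =
    trans (List.length-++ (h x)) (cong₂ ℕ._+_ (len x) (length-concatMap h len xs))

  endpoints : List (A × A) → List A
  endpoints = concatMap (λ (i , j) → i ∷ j ∷ [])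

  -- `P` confines injectivity to the indices that occur, because reduction modulo `n` is injective
  -- only there. Disjointness of the two images also keeps each single pair from collapsing.
  endpoints-unique : ∀ {p} {P : Pred A p} (h₁ h₂ : A → B) →
    (∀ {x y} → P x → P y → h₁ x ≡ h₁ y → x ≡ y) →
    (∀ {x y} → P x → P y → h₂ x ≡ h₂ y → x ≡ y) →
    (∀ {x y} → P x → P y → h₁ x ≢ h₂ y) →
    ∀ {xs} → All P xs → Unique xs → Unique (endpoints (List.map (λ x → h₁ x , h₂ x) xs))
  endpoints-unique h₁ h₂ inj-h₁ inj-h₂ apart []         []       = []
  endpoints-unique h₁ h₂ inj-h₁ inj-h₂ apart (px ∷ pxs) (x∉ ∷ u) =
    (apart px px ∷ first pxs x∉) ∷ second pxs x∉ ∷ endpoints-unique h₁ h₂ inj-h₁ inj-h₂ apart pxs u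
    where
    first : ∀ {ys} → All _ ys → All _ ys → All _ (endpoints (List.map _ ys))
    first []         []          = []
    first (py ∷ pys) (x≢y ∷ x∉) = (x≢y ∘ inj-h₁ px py) ∷ apart px py ∷ first pys x∉
    second : ∀ {ys} → All _ ys → All _ ys → All _ (endpoints (List.map _ ys))
    second []         []          = []
    second (py ∷ pys) (x≢y ∷ x∉) = (apart py px ∘ sym) ∷ (x≢y ∘ inj-h₂ px py) ∷ second pys x∉

  toℕ-pos : ∀ N i → toℕ (pos N i) ≡ (i ℕ.% 2 ℕ.^ N) {{ℕ.m^n≢0 2 N}}
  toℕ-pos N i = Fin.toℕ-fromℕ< _

  toℕ-pos-< : ∀ N {i} → i ℕ.< 2 ℕ.^ N → toℕ (pos N i) ≡ i
  toℕ-pos-< N {i} i<n = trans (toℕ-pos N i) (ℕ.m<n⇒m%n≡m {{ℕ.m^n≢0 2 N}} i<n)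

  pos-toℕ : ∀ N i → pos N (toℕ i) ≡ i
  pos-toℕ N i = Fin.toℕ-injective (toℕ-pos-< N (Fin.toℕ<n i))

  pos-≡ : ∀ N {i j} → (i ℕ.% 2 ℕ.^ N) {{ℕ.m^n≢0 2 N}} ≡ (j ℕ.% 2 ℕ.^ N) {{ℕ.m^n≢0 2 N}} → pos N i ≡ pos N j
  pos-≡ N {i} {j} eq = Fin.toℕ-injective (trans (toℕ-pos N i) (trans eq (sym (toℕ-pos N j))))

  pos-shift : ∀ N s i → pos N (s ℕ.+ toℕ (pos N i)) ≡ pos N (s ℕ.+ i)
  pos-shift N s i = pos-≡ N (begin
    (s ℕ.+ toℕ (pos N i)) ℕ.% n          ≡⟨ cong (λ z → (s ℕ.+ z) ℕ.% n) (toℕ-pos N i) ⟩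
    (s ℕ.+ i ℕ.% n) ℕ.% n                ≡⟨ ℕ.%-distribˡ-+ s (i ℕ.% n) n ⟩
    (s ℕ.% n ℕ.+ i ℕ.% n ℕ.% n) ℕ.% n    ≡⟨ cong (λ z → (s ℕ.% n ℕ.+ z) ℕ.% n) (ℕ.m%n%n≡m%n i n) ⟩
    (s ℕ.% n ℕ.+ i ℕ.% n) ℕ.% n          ≡⟨ ℕ.%-distribˡ-+ s i n ⟨
    (s ℕ.+ i) ℕ.% n                      ∎)
    where
    open ≡-Reasoning
    n = 2 ℕ.^ N
    instance n≢0 = ℕ.m^n≢0 2 N

  n/2^-≡ : ∀ {N k} → k ℕ.≤ N → (n/2^_) N k ≡ 2 ℕ.^ (N ∸ k)
  n/2^-≡ {N} {k} k≤N = trans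
    (ℕ./-congˡ {{ℕ.m^n≢0 2 k}} (trans (cong (2 ℕ.^_) (sym (ℕ.m∸n+n≡m k≤N))) (ℕ.^-distribˡ-+-* 2 (N ∸ k) k)))
    (ℕ.m*n/n≡m (2 ℕ.^ (N ∸ k)) (2 ℕ.^ k) {{ℕ.m^n≢0 2 k}})

  -- For `1 ≤ k < N` the circle splits into `G` groups of four cells of integer width `w`; `M_r` has
  -- its left endpoints in the `r`-th cell of every group.
  module Cells (N k : ℕ) (1≤k : 1 ℕ.≤ k) (k<N : k ℕ.< N) where

    private
      n w G : ℕ
      n = 2 ℕ.^ N
      w = 2 ℕ.^ (N ∸ suc k)
      G = 2 ℕ.^ (k ∸ 1)
      instance
        n≢0 : ℕ.NonZero n
        n≢0 = ℕ.m^n≢0 2 N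
        w≢0 : ℕ.NonZero w
        w≢0 = ℕ.m^n≢0 2 (N ∸ suc k)
        4w≢0 : ℕ.NonZero (4 ℕ.* w)
        4w≢0 = ℕ.m*n≢0 4 w

    cell-width : (n/2^_) N (k ℕ.+ 1) ≡ w
    cell-width = trans (cong (n/2^_ N) (ℕ.+-comm k 1)) (n/2^-≡ k<N)

    group-width : (n/2^_) N (k ∸ 1) ≡ 4 ℕ.* w
    group-width = go k 1≤k k<N
      where
      go : ∀ k → 1 ℕ.≤ k → k ℕ.< N → (n/2^_) N (k ∸ 1) ≡ 4 ℕ.* 2 ℕ.^ (N ∸ suc k)
      go (suc k) _ k+1<N = trans (n/2^-≡ (ℕ.≤-trans (ℕ.n≤1+n k) (ℕ.<⇒≤ k+1<N)))
        (trans (cong (2 ℕ.^_) (trans (ℕ.+-∸-assoc 1 (ℕ.<⇒≤ k+1<N)) (cong suc (ℕ.+-∸-assoc 1 k+1<N))))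
          (double (2 ℕ.^ (N ∸ suc (suc k)))))
        where
        double : ∀ x → 2 ℕ.* (2 ℕ.* x) ≡ 4 ℕ.* x
        double = ℕSolver.solve-∀

    size : n ≡ G ℕ.* (4 ℕ.* w)
    size = trans (cong (2 ℕ.^_) (sym (ℕ.m+[n∸m]≡n (ℕ.≤-trans (ℕ.m∸n≤m k 1) (ℕ.<⇒≤ k<N)))))
      (trans (ℕ.^-distribˡ-+-* 2 (k ∸ 1) (N ∸ (k ∸ 1)))
        (cong (G ℕ.*_) (trans (sym (n/2^-≡ (ℕ.≤-trans (ℕ.m∸n≤m k 1) (ℕ.<⇒≤ k<N)))) group-width)))

    -- Left endpoints before reduction modulo `n`. They do not depend on `D`, so the nested shifts
    -- in the definition of the matching collapse to one map applied to this list.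
    starts : ℕ → List ℕ
    starts r = concatMap (λ ℓ → List.map (λ i → r ℕ.* w ℕ.+ (ℓ ℕ.* (4 ℕ.* w) ℕ.+ i)) (upTo w)) (upTo G)

    matching-starts : ∀ r D → M[_] N r D k ≡ List.map (λ a → pos N a , pos N (a ℕ.+ D)) (starts r)
    matching-starts r D = begin
      shift N (r ℕ.* (n/2^_ N (k ℕ.+ 1))) (M₀ N D k)
        ≡⟨ cong (λ z → shift N (r ℕ.* z) (M₀ N D k)) cell-width ⟩
      shift N (r ℕ.* w) (M₀ N D k)
        ≡⟨ cong (shift N (r ℕ.* w)) (List.concatMap-cong blocks (upTo G)) ⟩
      shift N (r ℕ.* w) (concatMap (λ ℓ → List.map (λ i → pos N (ℓ ℕ.* (4 ℕ.* w) ℕ.+ i) , pos N (ℓ ℕ.* (4 ℕ.* w) ℕ.+ (i ℕ.+ D))) (upTo w)) (upTo G))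
        ≡⟨ List.map-concatMap _ _ (upTo G) ⟩
      concatMap (λ ℓ → shift N (r ℕ.* w) (List.map (λ i → pos N (ℓ ℕ.* (4 ℕ.* w) ℕ.+ i) , pos N (ℓ ℕ.* (4 ℕ.* w) ℕ.+ (i ℕ.+ D))) (upTo w))) (upTo G)
        ≡⟨ List.concatMap-cong shifted (upTo G) ⟩
      concatMap (λ ℓ → List.map (λ a → pos N a , pos N (a ℕ.+ D)) (List.map (λ i → r ℕ.* w ℕ.+ (ℓ ℕ.* (4 ℕ.* w) ℕ.+ i)) (upTo w))) (upTo G)
        ≡⟨ List.map-concatMap _ _ (upTo G) ⟨
      List.map (λ a → pos N a , pos N (a ℕ.+ D)) (starts r) ∎
      where
      open ≡-Reasoning
      blocks : ∀ ℓ → shift N (ℓ ℕ.* (n/2^_ N (k ∸ 1))) (E N D k) ≡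
        List.map (λ i → pos N (ℓ ℕ.* (4 ℕ.* w) ℕ.+ i) , pos N (ℓ ℕ.* (4 ℕ.* w) ℕ.+ (i ℕ.+ D))) (upTo w)
      blocks ℓ = trans (cong₂ (λ x y → shift N (ℓ ℕ.* x) (List.map (λ i → pos N i , pos N (i ℕ.+ D)) (upTo y))) group-width cell-width)
        (trans (sym (List.map-∘ (upTo w)))
          (List.map-cong (λ i → cong₂ _,_ (pos-shift N _ i) (pos-shift N _ (i ℕ.+ D))) (upTo w)))
      assoc : ∀ a b c d → a ℕ.+ (b ℕ.+ (c ℕ.+ d)) ≡ a ℕ.+ (b ℕ.+ c) ℕ.+ d
      assoc = ℕSolver.solve-∀
      shifted : ∀ ℓ → shift N (r ℕ.* w) (List.map (λ i → pos N (ℓ ℕ.* (4 ℕ.* w) ℕ.+ i) , pos N (ℓ ℕ.* (4 ℕ.* w) ℕ.+ (i ℕ.+ D))) (upTo w)) ≡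
        List.map (λ a → pos N a , pos N (a ℕ.+ D)) (List.map (λ i → r ℕ.* w ℕ.+ (ℓ ℕ.* (4 ℕ.* w) ℕ.+ i)) (upTo w))
      shifted ℓ = trans (sym (List.map-∘ (upTo w)))
        (trans (List.map-cong (λ i → cong₂ _,_ (pos-shift N _ _)
            (trans (pos-shift N _ _) (cong (pos N) (assoc (r ℕ.* w) (ℓ ℕ.* (4 ℕ.* w)) i D)))) (upTo w))
          (List.map-∘ (upTo w)))

    length-starts : ∀ r → length (starts r) ≡ G ℕ.* w
    length-starts r = trans (length-concatMap _ (λ ℓ → trans (List.length-map _ (upTo w)) (List.length-upTo w)) (upTo G))
      (cong (ℕ._* w) (List.length-upTo G))

    matching-size : ∀ r D → 4 ℕ.* length (M[_] N r D k) ≡ n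
    matching-size r D = trans
      (cong (4 ℕ.*_) (trans (cong length (matching-starts r D)) (trans (List.length-map _ (starts r)) (length-starts r))))
      (trans (lemma G w) (sym size))
      where
      lemma : ∀ b w → 4 ℕ.* (b ℕ.* w) ≡ b ℕ.* (4 ℕ.* w)
      lemma = ℕSolver.solve-∀

    Start : ℕ → ℕ → Set
    Start r a = ∃[ ℓ ] ∃[ i ] ℓ ℕ.< G × i ℕ.< w × a ≡ r ℕ.* w ℕ.+ (ℓ ℕ.* (4 ℕ.* w) ℕ.+ i)

    All-starts : ∀ r → All (Start r) (starts r)
    All-starts r = All.concat⁺ (All.map⁺ (All.applyUpTo⁺₁ id G λ {ℓ} ℓ<G →
      All.map⁺ (All.applyUpTo⁺₁ id w λ {i} i<w → ℓ , i , ℓ<G , i<w , refl)))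

    block-< : ∀ {i} ℓ ℓ′ → i ℕ.< 4 ℕ.* w → ℓ ℕ.< ℓ′ → ℓ ℕ.* (4 ℕ.* w) ℕ.+ i ℕ.< ℓ′ ℕ.* (4 ℕ.* w)
    block-< {i} ℓ ℓ′ i<4w ℓ<ℓ′ = ℕ.<-≤-trans (ℕ.+-monoʳ-< (ℓ ℕ.* (4 ℕ.* w)) i<4w)
      (subst (ℕ._≤ ℓ′ ℕ.* (4 ℕ.* w)) (ℕ.+-comm (4 ℕ.* w) (ℓ ℕ.* (4 ℕ.* w))) (ℕ.*-monoˡ-≤ (4 ℕ.* w) ℓ<ℓ′))

    w≤4w : w ℕ.≤ 4 ℕ.* w
    w≤4w = ℕ.m≤m+n w _

    starts-unique : ∀ r → Unique (starts r)
    starts-unique r = Unique.concat⁺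
      (All.map⁺ (All.universal (λ ℓ → Unique.map⁺ (λ eq → ℕ.+-cancelˡ-≡ _ _ _ (ℕ.+-cancelˡ-≡ (r ℕ.* w) _ _ eq)) (Unique.upTo⁺ w)) (upTo G)))
      (AllPairs.map⁺ (AllPairs.applyUpTo⁺₁ id G λ {ℓ} {ℓ′} ℓ<ℓ′ _ {v} (v∈ , v∈′) → separate ℓ<ℓ′ v∈ v∈′))
      where
      separate : ∀ {ℓ ℓ′ v} → ℓ ℕ.< ℓ′ →
        v ∈ List.map (λ i → r ℕ.* w ℕ.+ (ℓ ℕ.* (4 ℕ.* w) ℕ.+ i)) (upTo w) →
        ¬ (v ∈ List.map (λ i → r ℕ.* w ℕ.+ (ℓ′ ℕ.* (4 ℕ.* w) ℕ.+ i)) (upTo w))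
      separate {ℓ} {ℓ′} ℓ<ℓ′ v∈ v∈′ with ∈.∈-map⁻ _ v∈ | ∈.∈-map⁻ _ v∈′
      ... | i , i∈ , refl | i′ , i′∈ , eq = ℕ.<⇒≢
        (ℕ.<-≤-trans (block-< ℓ ℓ′ (ℕ.<-≤-trans (∈.∈-upTo⁻ i∈) w≤4w) ℓ<ℓ′) (ℕ.m≤m+n _ i′))
        (ℕ.+-cancelˡ-≡ (r ℕ.* w) _ _ eq)

    start-< : ∀ {r a} → r ℕ.< 4 → Start r a → a ℕ.< n
    start-< {r} r<4 (ℓ , i , ℓ<G , i<w , refl) = subst₂ ℕ._<_ (regroup (ℓ ℕ.* (4 ℕ.* w)) (r ℕ.* w) i) (sym size)
      (block-< ℓ G (ℕ.<-≤-trans (ℕ.+-monoʳ-< (r ℕ.* w) i<w)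
        (subst (ℕ._≤ 4 ℕ.* w) (ℕ.+-comm w (r ℕ.* w)) (ℕ.*-monoˡ-≤ w r<4))) ℓ<G)
      where
      regroup : ∀ a b c → a ℕ.+ (b ℕ.+ c) ≡ b ℕ.+ (a ℕ.+ c)
      regroup = ℕSolver.solve-∀

    -- Reduce modulo the group width `4w`, which divides `n`. Relative to the start of the `r`-th
    -- cell, left endpoints have residues in `[0, w)`, while right endpoints have `i′ + D` in
    -- `[w, 3w)`.
    start-apart : ∀ {r D a a′} → w ℕ.≤ D → D ℕ.≤ 2 ℕ.* w → Start r a → Start r a′ →
      a ℕ.% n ≢ (a′ ℕ.+ D) ℕ.% n
    start-apart {r} {D} w≤D D≤2w (ℓ , i , _ , i<w , refl) (ℓ′ , i′ , _ , i′<w , refl) eq =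
      ℕ.<⇒≢ (ℕ.<-≤-trans i<w (ℕ.≤-trans w≤D (ℕ.m≤n+m D i′))) (begin
        i                      ≡⟨ ℕ.m<n⇒m%n≡m (ℕ.<-≤-trans i<w w≤4w) ⟨
        i ℕ.% m                ≡⟨ %-cancelʳ (r ℕ.* w) m (begin
          (i ℕ.+ r ℕ.* w) ℕ.% m                           ≡⟨ ℕ.[m+kn]%n≡m%n (i ℕ.+ r ℕ.* w) ℓ m ⟨
          (i ℕ.+ r ℕ.* w ℕ.+ ℓ ℕ.* m) ℕ.% m               ≡⟨ cong (ℕ._% m) (regroup i (r ℕ.* w) (ℓ ℕ.* m)) ⟩
          a ℕ.% m                                         ≡⟨ ℕ.m∣n⇒o%n%m≡o%m m n a m∣n ⟨
          a ℕ.% n ℕ.% m                                   ≡⟨ cong (ℕ._% m) eq ⟩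
          (a′ ℕ.+ D) ℕ.% n ℕ.% m                          ≡⟨ ℕ.m∣n⇒o%n%m≡o%m m n (a′ ℕ.+ D) m∣n ⟩
          (a′ ℕ.+ D) ℕ.% m                                ≡⟨ cong (ℕ._% m) (regroup′ i′ (r ℕ.* w) (ℓ′ ℕ.* m) D) ⟨
          (i′ ℕ.+ D ℕ.+ r ℕ.* w ℕ.+ ℓ′ ℕ.* m) ℕ.% m       ≡⟨ ℕ.[m+kn]%n≡m%n (i′ ℕ.+ D ℕ.+ r ℕ.* w) ℓ′ m ⟩
          (i′ ℕ.+ D ℕ.+ r ℕ.* w) ℕ.% m                    ∎) ⟩
        (i′ ℕ.+ D) ℕ.% m       ≡⟨ ℕ.m<n⇒m%n≡m (ℕ.<-≤-trans (ℕ.+-mono-<-≤ i′<w D≤2w) (ℕ.*-monoˡ-≤ w (ℕ.n≤1+n 3))) ⟩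
        i′ ℕ.+ D               ∎)
      where
      open ≡-Reasoning
      m = 4 ℕ.* w
      a = r ℕ.* w ℕ.+ (ℓ ℕ.* m ℕ.+ i)
      a′ = r ℕ.* w ℕ.+ (ℓ′ ℕ.* m ℕ.+ i′)
      m∣n : m ℕ.∣ n
      m∣n = ℕ.divides G size
      regroup : ∀ i x y → i ℕ.+ x ℕ.+ y ≡ x ℕ.+ (y ℕ.+ i)
      regroup = ℕSolver.solve-∀
      regroup′ : ∀ i x y d → i ℕ.+ d ℕ.+ x ℕ.+ y ≡ x ℕ.+ (y ℕ.+ i) ℕ.+ d
      regroup′ = ℕSolver.solve-∀

    isMatching : ∀ {r D} → r ℕ.< 4 → w ℕ.≤ D → D ℕ.≤ 2 ℕ.* w → IsMatching {N} (M[_] N r D k)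
    isMatching {r} {D} r<4 w≤D D≤2w = subst (λ M → IsMatching {N} M) (sym (matching-starts r D))
      (endpoints-unique (pos N) (λ a → pos N (a ℕ.+ D))
        (λ sx sy eq → start-injective sx sy (residues eq))
        (λ sx sy eq → start-injective sx sy (%-cancelʳ D n (residues eq)))
        (λ sx sy eq → start-apart {r} w≤D D≤2w sx sy (residues eq))
        (All-starts r) (starts-unique r))
      where
      residues : ∀ {x y} → pos N x ≡ pos N y → x ℕ.% n ≡ y ℕ.% n
      residues {x} {y} eq = trans (sym (toℕ-pos N x)) (trans (cong toℕ eq) (toℕ-pos N y))
      start-injective : ∀ {x y} → Start r x → Start r y → x ℕ.% n ≡ y ℕ.% n → x ≡ y
      start-injective sx sy eq = trans (sym (ℕ.m<n⇒m%n≡m (start-< r<4 sx)))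
        (trans eq (ℕ.m<n⇒m%n≡m (start-< r<4 sy)))

    -- Four cells tile a group and the groups tile `[n]`, so the four matchings together contain
    -- every cyclic pair `{a, a+D}` exactly once.
    matchings-sum : ∀ D (F : Pos N × Pos N → ℚ) →
      listSum (upTo 4) (λ r → listSum (M[_] N r D k) F) ≡ ∑[ a < n ] F (pos N a , pos N (a ℕ.+ D))
    matchings-sum D F = begin
      listSum (upTo 4) (λ r → listSum (M[_] N r D k) F)
        ≡⟨ listSum-cong (upTo 4) (λ r → trans (cong (λ M → listSum M F) (matching-starts r D))
             (trans (listSum-map _ (starts r) F) (listSum-starts r))) ⟩
      listSum (upTo 4) (λ r → ∑[ ℓ < G ] ∑[ i < w ] f (r ℕ.* w ℕ.+ (ℓ ℕ.* (4 ℕ.* w) ℕ.+ i)))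
        ≡⟨ listSum-upTo 4 (λ r → ∑[ ℓ < G ] ∑[ i < w ] f (r ℕ.* w ℕ.+ (ℓ ℕ.* (4 ℕ.* w) ℕ.+ i))) ⟩
      ∑[ r < 4 ] ∑[ ℓ < G ] ∑[ i < w ] f (r ℕ.* w ℕ.+ (ℓ ℕ.* (4 ℕ.* w) ℕ.+ i))
        ≡⟨ ∑-swap 4 G (λ r ℓ → ∑[ i < w ] f (r ℕ.* w ℕ.+ (ℓ ℕ.* (4 ℕ.* w) ℕ.+ i))) ⟩
      ∑[ ℓ < G ] ∑[ r < 4 ] ∑[ i < w ] f (r ℕ.* w ℕ.+ (ℓ ℕ.* (4 ℕ.* w) ℕ.+ i))
        ≡⟨ ∑-cong G (λ ℓ _ → trans
             (∑-cong 4 λ r _ → ∑-cong w λ i _ → cong f (regroup (r ℕ.* w) (ℓ ℕ.* (4 ℕ.* w)) i))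
             (sym (∑-block 4 w (λ j → f (ℓ ℕ.* (4 ℕ.* w) ℕ.+ j))))) ⟩
      ∑[ ℓ < G ] ∑[ j < 4 ℕ.* w ] f (ℓ ℕ.* (4 ℕ.* w) ℕ.+ j)
        ≡⟨ ∑-block G (4 ℕ.* w) f ⟨
      sum (G ℕ.* (4 ℕ.* w)) f
        ≡⟨ cong (λ z → sum z f) size ⟨
      sum n f ∎
      where
      open ≡-Reasoning
      f : ℕ → ℚ
      f a = F (pos N a , pos N (a ℕ.+ D))
      regroup : ∀ a b c → a ℕ.+ (b ℕ.+ c) ≡ b ℕ.+ (a ℕ.+ c)
      regroup = ℕSolver.solve-∀
      listSum-starts : ∀ r → listSum (starts r) f ≡ ∑[ ℓ < G ] ∑[ i < w ] f (r ℕ.* w ℕ.+ (ℓ ℕ.* (4 ℕ.* w) ℕ.+ i))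
      listSum-starts r = trans (listSum-concatMap _ (upTo G) f)
        (trans (listSum-upTo G _) (∑-cong G λ ℓ _ → trans (listSum-map _ (upTo w) f) (listSum-upTo w _)))

  -- The law of the matching

  𝔼-cong-surely : {μ : Dist A} {f g : A → ℚ} → Surely (λ x → f x ≡ g x) μ → 𝔼 μ f ≡ 𝔼 μ g
  𝔼-cong-surely []         = refl
  𝔼-cong-surely {μ = (w , _) ∷ _} (eq ∷ eqs) = cong₂ _+_ (cong (w *_) eq) (𝔼-cong-surely eqs)

  applyUpTo-++ : (f : ℕ → A) (m n : ℕ) → applyUpTo f (m ℕ.+ n) ≡ applyUpTo f m ++ applyUpTo (f ∘ (m ℕ.+_)) n
  applyUpTo-++ f zero    n = refl
  applyUpTo-++ f (suc m) n = cong (f 0 ∷_) (applyUpTo-++ (f ∘ suc) m n)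

  filter-interval : ∀ {p} {P : Pred ℕ p} (P? : Decidable P) (a b {n} : ℕ) → a ℕ.+ b ℕ.≤ n →
    (∀ {d} → P d → a ℕ.≤ d × d ℕ.< a ℕ.+ b) → (∀ {d} → a ℕ.≤ d → d ℕ.< a ℕ.+ b → P d) →
    List.filter P? (upTo n) ≡ applyUpTo (a ℕ.+_) b
  filter-interval {P = P} P? a b {n} a+b≤n sound complete = begin
    filter (upTo n)                                               ≡⟨ cong (filter ∘ upTo) (ℕ.m+[n∸m]≡n a+b≤n) ⟨
    filter (upTo (a ℕ.+ b ℕ.+ c))                                 ≡⟨ cong filter (applyUpTo-++ id (a ℕ.+ b) c) ⟩
    filter (upTo (a ℕ.+ b) ++ above)                              ≡⟨ cong (λ xs → filter (xs ++ above)) (applyUpTo-++ id a b) ⟩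
    filter ((upTo a ++ inside) ++ above)                          ≡⟨ List.filter-++ P? (upTo a ++ inside) above ⟩
    filter (upTo a ++ inside) ++ filter above                     ≡⟨ cong (_++ filter above) (List.filter-++ P? (upTo a) inside) ⟩
    (filter (upTo a) ++ filter inside) ++ filter above            ≡⟨ cong₂ (λ xs ys → (xs ++ filter inside) ++ ys) (List.filter-none P? below-out) (List.filter-none P? above-out) ⟩
    filter inside ++ []                                           ≡⟨ List.++-identityʳ _ ⟩
    filter inside                                                 ≡⟨ List.filter-all P? inside-in ⟩
    inside                                                        ∎
    where
    open ≡-Reasoning
    filter : List ℕ → List ℕ
    filter = List.filter P?
    c : ℕ
    c = n ∸ (a ℕ.+ b)
    inside above : List ℕ
    inside = applyUpTo (a ℕ.+_) b
    above  = applyUpTo (a ℕ.+ b ℕ.+_) c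
    below-out : All (λ d → ¬ P d) (upTo a)
    below-out = All.applyUpTo⁺₁ id a λ d<a pd → ℕ.<⇒≱ d<a (proj₁ (sound pd))
    inside-in : All P inside
    inside-in = All.applyUpTo⁺₁ (a ℕ.+_) b λ {i} i<b → complete (ℕ.m≤m+n a i) (ℕ.+-monoʳ-< a i<b)
    above-out : All (λ d → ¬ P d) above
    above-out = All.applyUpTo⁺₁ (a ℕ.+ b ℕ.+_) c λ {i} _ pd → ℕ.<⇒≱ (proj₂ (sound pd)) (ℕ.m≤m+n (a ℕ.+ b) i)

  inRange? : ∀ N k → Decidable (λ d → 2 ℕ.^ N ℕ.< d ℕ.* 2 ℕ.^ (k ℕ.+ 1) × d ℕ.* 2 ℕ.^ k ℕ.≤ 2 ℕ.^ N)
  inRange? N k d = (2 ℕ.^ N ℕ.<? d ℕ.* 2 ℕ.^ (k ℕ.+ 1)) ×-dec (d ℕ.* 2 ℕ.^ k ℕ.≤? 2 ℕ.^ N)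

  -- Cancelling the powers of two turns the two conditions into `w < d ≤ 2w`.
  distances-below : ∀ {N k} → k ℕ.< N → let w = 2 ℕ.^ (N ∸ suc k) in
    distances N k ≡ applyUpTo (suc w ℕ.+_) w
  distances-below {N} {k} k<N = filter-interval (inRange? N k) (suc w) w bound
    (λ {d} (lo , hi) → ℕ.*-cancelʳ-< (2 ℕ.^ (k ℕ.+ 1)) w d (subst (ℕ._< _) n≡ lo) ,
      s≤s (ℕ.*-cancelʳ-≤ d (w ℕ.+ w) (2 ℕ.^ k) {{ℕ.m^n≢0 2 k}} (subst (d ℕ.* 2 ℕ.^ k ℕ.≤_) n≡′ hi)))
    (λ {d} lo hi → subst (ℕ._< d ℕ.* 2 ℕ.^ (k ℕ.+ 1)) (sym n≡) (ℕ.*-monoˡ-< (2 ℕ.^ (k ℕ.+ 1)) {{ℕ.m^n≢0 2 (k ℕ.+ 1)}} lo) ,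
      subst (d ℕ.* 2 ℕ.^ k ℕ.≤_) (sym n≡′) (ℕ.*-monoˡ-≤ (2 ℕ.^ k) (ℕ.s≤s⁻¹ hi)))
    where
    w : ℕ
    w = 2 ℕ.^ (N ∸ suc k)
    n≡ : 2 ℕ.^ N ≡ w ℕ.* 2 ℕ.^ (k ℕ.+ 1)
    n≡ = trans (cong (2 ℕ.^_) (trans (sym (ℕ.m∸n+n≡m k<N)) (cong (N ∸ suc k ℕ.+_) (ℕ.+-comm 1 k))))
      (ℕ.^-distribˡ-+-* 2 (N ∸ suc k) (k ℕ.+ 1))
    n≡′ : 2 ℕ.^ N ≡ (w ℕ.+ w) ℕ.* 2 ℕ.^ k
    n≡′ = trans n≡ (trans (cong (w ℕ.*_) (cong (2 ℕ.^_) (ℕ.+-comm k 1))) (lemma w (2 ℕ.^ k)))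
      where
      lemma : ∀ w x → w ℕ.* (2 ℕ.* x) ≡ (w ℕ.+ w) ℕ.* x
      lemma = ℕSolver.solve-∀
    bound : suc w ℕ.+ w ℕ.≤ suc (2 ℕ.^ N)
    bound = s≤s (subst (w ℕ.+ w ℕ.≤_) (sym n≡′) (ℕ.m≤m*n (w ℕ.+ w) (2 ℕ.^ k) {{ℕ.m^n≢0 2 k}}))

  -- The interval is `(1/2, 1]`, and 1 is its only integer.
  distances-top : ∀ N → distances N N ≡ 1 ∷ []
  distances-top N = filter-interval (inRange? N N) 1 1 (s≤s (ℕ.m^n>0 2 N))
    (λ { {zero}  (() , _)
       ; {suc d} (_ , hi) → s≤s z≤n , s≤s (ℕ.*-cancelʳ-≤ (suc d) 1 (2 ℕ.^ N) {{ℕ.m^n≢0 2 N}} (subst (suc d ℕ.* 2 ℕ.^ N ℕ.≤_) (sym (ℕ.*-identityˡ (2 ℕ.^ N))) hi)) })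
    (λ { {1} _ _ → subst (2 ℕ.^ N ℕ.<_) (sym (ℕ.*-identityˡ (2 ℕ.^ (N ℕ.+ 1)))) (ℕ.^-monoʳ-< 2 (s≤s (s≤s z≤n)) (ℕ.≤-reflexive (ℕ.+-comm 1 N))) ,
                   ℕ.≤-reflexive (ℕ.*-identityˡ (2 ℕ.^ N))
       ; {suc (suc d)} _ (s≤s (s≤s ())) })

  -- `K = N` is kept apart: its distance is 1, while its cells are those of scale `N - 1`.
  data Scale (N k : ℕ) : Set where
    below : k ℕ.< N → k ℕ.⊓ (N ∸ 1) ≡ k → Scale N k
    top   : k ≡ N → k ℕ.⊓ (N ∸ 1) ≡ N ∸ 1 → Scale N k

  scale : ∀ {N k} → k ℕ.≤ N → Scale N k
  scale {N} {k} k≤N with ℕ.m≤n⇒m<n∨m≡n k≤N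
  ... | inj₁ k<N  = below k<N (ℕ.m≤n⇒m⊓n≡m (ℕ.∸-monoˡ-≤ 1 k<N))
  ... | inj₂ refl = top refl (ℕ.m≥n⇒m⊓n≡n (ℕ.m∸n≤m k 1))

  -- Below the top scale `D` exceeds `w`. At the top scale `D = w = 1`, which is why the lower bound
  -- on `D` is not strict.
  distances-cells : ∀ {N k} → 1 ℕ.≤ k → k ℕ.≤ N →
    All (λ D → let w = 2 ℕ.^ (N ∸ suc (k ℕ.⊓ (N ∸ 1))) in w ℕ.≤ D × D ℕ.≤ 2 ℕ.* w) (distances N k)
  distances-cells {N} {k} 1≤k k≤N with scale k≤N
  ... | below k<N eq rewrite eq | distances-below k<N = All.applyUpTo⁺₁ (suc w ℕ.+_) w λ {i} i<w →
    ℕ.m≤n⇒m≤1+n (ℕ.m≤m+n w i) ,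
    subst (ℕ._≤ 2 ℕ.* w) (ℕ.+-suc w i) (ℕ.+-monoʳ-≤ w (subst (suc i ℕ.≤_) (sym (ℕ.+-identityʳ w)) i<w))
    where
    w : ℕ
    w = 2 ℕ.^ (N ∸ suc k)
  ... | top refl eq rewrite eq | distances-top N | ℕ.suc-pred N {{ℕ.>-nonZero 1≤k}} | ℕ.n∸n≡0 N =
    (s≤s z≤n , s≤s z≤n) ∷ []

  cell-scale : ∀ {N k} → 2 ℕ.≤ N → 1 ℕ.≤ k → 1 ℕ.≤ k ℕ.⊓ (N ∸ 1) × k ℕ.⊓ (N ∸ 1) ℕ.< N
  cell-scale {suc N} {k} (s≤s 1≤N) 1≤k = ℕ.⊓-glb 1≤k 1≤N , s≤s (ℕ.m⊓n≤n k N)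

  -- q̃ N is, by definition, unif (map suc (upTo N)) >>= drawDistance N.
  drawShift : (N k D : ℕ) → Dist (Pairs N)
  drawShift N k D = unif (upTo 4) >>= λ R → pure (M[_] N R D k)

  drawDistance : (N K : ℕ) → Dist (Pairs N)
  drawDistance N K = unif (distances N K) >>= drawShift N (K ℕ.⊓ (N ∸ 1))

  QuarterMatching : ∀ N → Pairs N → Set
  QuarterMatching N M = IsMatching {N} M × 4 ℕ.* length M ≡ 2 ℕ.^ N

  q̃-matching : ∀ N → 2 ℕ.≤ N → Surely (QuarterMatching N) (q̃ N)
  q̃-matching N 2≤N = Surely->>= (unif (List.map suc (upTo N))) (drawDistance N)
    (Surely-unif (All.map⁺ (All.applyUpTo⁺₁ id N λ {κ} κ<N →
    let k         = suc κ ℕ.⊓ (N ∸ 1)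
        1≤k , k<N = cell-scale {N} {suc κ} 2≤N (s≤s z≤n) in
    Surely->>= (unif (distances N (suc κ))) (drawShift N k) (Surely-unif (All.map (λ {D} (w≤D , D≤2w) →
      Surely->>= (unif (upTo 4)) (λ R → pure (M[_] N R D k)) (Surely-unif (All.applyUpTo⁺₁ id 4 λ {r} r<4 →
        Surely-pure {P = QuarterMatching N} {x = M[_] N r D k}
          (Cells.isMatching N k 1≤k k<N r<4 w≤D D≤2w , Cells.matching-size N k 1≤k k<N r D))))
      (distances-cells (s≤s z≤n) κ<N))))))

  Law-distances : ∀ {N K} → 1 ℕ.≤ K → K ℕ.≤ N → Law (unif (distances N K))
  Law-distances {N} {K} 1≤K K≤N with scale K≤N
  ... | below K<N _ rewrite distances-below K<N = go (2 ℕ.^ (N ∸ suc K)) (ℕ.m^n>0 2 (N ∸ suc K))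
    where
    go : ∀ w → 0 ℕ.< w → Law (unif (applyUpTo (suc w ℕ.+_) w))
    go (suc w) _ = Law-unif _ _
  ... | top refl _ rewrite distances-top N = Law-unif 1 []

  q̃-Law : ∀ N → 2 ℕ.≤ N → Law (q̃ N)
  q̃-Law N@(suc N-1) 2≤N = Law->>= (unif (List.map suc (upTo N))) (drawDistance N)
    (Law-unif 1 (List.map suc (applyUpTo suc N-1)))
    (Surely-unif (All.map⁺ (All.applyUpTo⁺₁ id N λ {κ} κ<N →
      Law->>= (unif (distances N (suc κ))) (drawShift N (suc κ ℕ.⊓ (N ∸ 1))) (Law-distances (s≤s z≤n) κ<N)
        (All.universal (λ (_ , D) →
          Law->>= (unif (upTo 4)) (λ R → pure (M[_] N R D (suc κ ℕ.⊓ (N ∸ 1)))) (Law-unif 0 (applyUpTo suc 3))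
            (All.universal (λ (_ , R) → Law-pure (M[_] N R D (suc κ ℕ.⊓ (N ∸ 1)))) _)) _))))

  -- By `matchings-sum` the average over `R` is the same cyclic sum at every admissible cell scale.
  -- The scale thus disappears from the formula, and `K = N` needs no case of its own.
  q̃-sum : ∀ N-1 → 2 ℕ.≤ suc N-1 → let N = suc N-1 in (F : Pos N × Pos N → ℚ) →
    𝔼 (q̃ N) (λ M → listSum M F) ≡
    recip N-1 * (∑[ κ < N ] 𝔼 (unif (distances N (suc κ))) λ D →
      recip 3 * (∑[ a < 2 ℕ.^ N ] F (pos N a , pos N (a ℕ.+ D))))
  q̃-sum N-1 2≤N F = begin
    𝔼 (q̃ N) ΣF
      ≡⟨ 𝔼->>= (unif (List.map suc (upTo N))) (drawDistance N) ΣF ⟩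
    𝔼 (unif (List.map suc (upTo N))) g
      ≡⟨ 𝔼-unif 1 (List.map suc (applyUpTo suc N-1)) g ⟩
    recip (length (List.map suc (applyUpTo suc N-1))) * listSum (List.map suc (upTo N)) g
      ≡⟨ cong₂ (λ x y → recip x * y) (trans (List.length-map suc (applyUpTo suc N-1)) (List.length-applyUpTo suc N-1))
           (trans (listSum-map suc (upTo N) g) (listSum-upTo N (g ∘ suc))) ⟩
    recip N-1 * (∑[ κ < N ] g (suc κ))
      ≡⟨ cong (recip N-1 *_) (∑-cong N λ κ κ<N → inner κ) ⟩
    recip N-1 * (∑[ κ < N ] 𝔼 (unif (distances N (suc κ))) λ D →
      recip 3 * (∑[ a < 2 ℕ.^ N ] F (pos N a , pos N (a ℕ.+ D)))) ∎
    where
    open ≡-Reasoning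
    N : ℕ
    N = suc N-1
    ΣF : Pairs N → ℚ
    ΣF M = listSum M F
    g : ℕ → ℚ
    g K = 𝔼 (drawDistance N K) ΣF
    inner : ∀ κ → 𝔼 (drawDistance N (suc κ)) ΣF ≡
      𝔼 (unif (distances N (suc κ))) λ D → recip 3 * (∑[ a < 2 ℕ.^ N ] F (pos N a , pos N (a ℕ.+ D)))
    inner κ = trans (𝔼->>= (unif (distances N (suc κ))) (drawShift N k) ΣF) (𝔼-cong (unif (distances N (suc κ))) λ D → begin
      𝔼 (drawShift N k D) ΣF
        ≡⟨ 𝔼->>= (unif (upTo 4)) (λ R → pure (M[_] N R D k)) ΣF ⟩
      𝔼 (unif (upTo 4)) (λ R → 𝔼 (pure (M[_] N R D k)) ΣF)
        ≡⟨ 𝔼-cong (unif (upTo 4)) (λ R → 𝔼-pure (M[_] N R D k) ΣF) ⟩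
      𝔼 (unif (upTo 4)) (λ R → ΣF (M[_] N R D k))
        ≡⟨ 𝔼-unif 0 (applyUpTo suc 3) (λ R → ΣF (M[_] N R D k)) ⟩
      recip 3 * listSum (upTo 4) (λ R → ΣF (M[_] N R D k))
        ≡⟨ cong (recip 3 *_) (Cells.matchings-sum N k 1≤k k<N D F) ⟩
      recip 3 * (∑[ a < 2 ℕ.^ N ] F (pos N a , pos N (a ℕ.+ D))) ∎)
      where
      k = suc κ ℕ.⊓ (N ∸ 1)
      1≤k = proj₁ (cell-scale {N} {suc κ} 2≤N (s≤s z≤n))
      k<N = proj₂ (cell-scale {N} {suc κ} 2≤N (s≤s z≤n))

  -- Averaging over the distance

  recip-compare : ∀ m n c → 0ℚ ≤ c → fromℕ (suc n) ≤ c * fromℕ (suc m) → recip m ≤ c * recip n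
  recip-compare m n c 0≤c le = subst₂ _≤_ left right
    (*-monoˡ (0≤* (0≤recip m) (0≤recip n)) le)
    where
    left : recip m * recip n * fromℕ (suc n) ≡ recip m
    left = trans (lemma (recip m) (recip n) (fromℕ (suc n))) (trans (cong (_* recip m) (recip-*ˡ n)) (*-identityˡ _))
      where
      lemma : ∀ a b x → a * b * x ≡ x * b * a
      lemma = solve-∀ ℚ-ring
    right : recip m * recip n * (c * fromℕ (suc m)) ≡ c * recip n
    right = trans (lemma (recip m) (recip n) c (fromℕ (suc m))) (trans (cong (_* (c * recip n)) (recip-*ˡ m)) (*-identityˡ _))
      where
      lemma : ∀ a b c x → a * b * (c * x) ≡ x * a * (c * b)
      lemma = solve-∀ ℚ-ring

  recip-antimono : ∀ {m n} → m ℕ.≤ n → recip n ≤ recip m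
  recip-antimono {m} {n} m≤n = subst (recip n ≤_) (*-identityˡ (recip m))
    (recip-compare n m 1ℚ 0≤1 (subst (fromℕ (suc m) ≤_) (sym (*-identityˡ (fromℕ (suc n)))) (fromℕ-mono-≤ (s≤s m≤n))))

  -- N times 𝔼[ G D ].
  scaleSum : ℕ → (ℕ → ℚ) → ℚ
  scaleSum N G = ∑[ κ < N ] 𝔼 (unif (distances N (suc κ))) G

  -- The summand `j` is the average of `G` over `(2^j, 2^(j+1)]`, which comes from `K = N - 1 - j`;
  -- the isolated `G 1` comes from `K = N`.
  dyadicSum : ℕ → (ℕ → ℚ) → ℚ
  dyadicSum J G = G 1 + (∑[ j < J ] recip (2 ℕ.^ j ∸ 1) * (∑[ i < 2 ℕ.^ j ] G (suc (2 ℕ.^ j ℕ.+ i))))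

  harmonicSum : ℕ → (ℕ → ℚ) → ℚ
  harmonicSum m G = ∑[ d < m ] recip d * G (suc d)

  scaleSum-dyadic : ∀ J G → scaleSum (suc J) G ≡ dyadicSum J G
  scaleSum-dyadic J G = begin
    scaleSum (suc J) G
      ≡⟨ ∑-last J _ ⟩
    (∑[ κ < J ] 𝔼 (unif (distances (suc J) (suc κ))) G) + 𝔼 (unif (distances (suc J) (suc J))) G
      ≡⟨ cong₂ _+_ (∑-cong J below-top) (trans (cong (λ xs → 𝔼 (unif xs) G) (distances-top (suc J))) single) ⟩
    (∑[ κ < J ] block (J ∸ suc κ)) + G 1
      ≡⟨ cong (_+ G 1) (∑-reverse J block) ⟨
    (∑[ j < J ] block j) + G 1
      ≡⟨ +-comm (sum J block) (G 1) ⟩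
    dyadicSum J G ∎
    where
    open ≡-Reasoning
    block : ℕ → ℚ
    block j = recip (2 ℕ.^ j ∸ 1) * (∑[ i < 2 ℕ.^ j ] G (suc (2 ℕ.^ j ℕ.+ i)))
    single : 𝔼 (unif (1 ∷ [])) G ≡ G 1
    single = trans (𝔼-unif 1 [] G) (trans (*-identityˡ _) (+-identityʳ (G 1)))
    interval : ∀ w v → 0 ℕ.< w → 𝔼 (unif (applyUpTo (v ℕ.+_) w)) G ≡ recip (w ∸ 1) * (∑[ i < w ] G (v ℕ.+ i))
    interval (suc w) v _ = trans (𝔼-unif (v ℕ.+ 0) (applyUpTo ((v ℕ.+_) ∘ suc) w) G)
      (cong₂ (λ x y → recip x * y) (List.length-applyUpTo ((v ℕ.+_) ∘ suc) w)
        (trans (cong (λ xs → listSum xs G) (sym (List.map-upTo (v ℕ.+_) (suc w))))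
          (trans (listSum-map (v ℕ.+_) (upTo (suc w)) G) (listSum-upTo (suc w) (G ∘ (v ℕ.+_))))))
    below-top : ∀ κ → κ ℕ.< J → 𝔼 (unif (distances (suc J) (suc κ))) G ≡ block (J ∸ suc κ)
    below-top κ κ<J = trans (cong (λ xs → 𝔼 (unif xs) G) (distances-below (s≤s κ<J)))
      (interval (2 ℕ.^ (J ∸ suc κ)) _ (ℕ.m^n>0 2 (J ∸ suc κ)))

  pow-suc : ∀ j → 2 ℕ.^ suc j ≡ 2 ℕ.^ j ℕ.+ 2 ℕ.^ j
  pow-suc j = cong (2 ℕ.^ j ℕ.+_) (ℕ.+-identityʳ (2 ℕ.^ j))

  module _ (G : ℕ → ℚ) where

    private
      block-sum : ∀ j → harmonicSum (2 ℕ.^ suc j) G ≡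
        harmonicSum (2 ℕ.^ j) G + (∑[ i < 2 ℕ.^ j ] recip (2 ℕ.^ j ℕ.+ i) * G (suc (2 ℕ.^ j ℕ.+ i)))
      block-sum j = trans (cong (λ m → harmonicSum m G) (pow-suc j)) (∑-split (2 ℕ.^ j) (2 ℕ.^ j) _)

      in-range : ∀ j {i} → i ℕ.< 2 ℕ.^ j → 2 ℕ.^ j ℕ.+ i ℕ.< 2 ℕ.^ suc j
      in-range j {i} i< = subst (2 ℕ.^ j ℕ.+ i ℕ.<_) (sym (pow-suc j)) (ℕ.+-monoʳ-< (2 ℕ.^ j) i<)

      one-term : harmonicSum 1 G ≡ G 1
      one-term = trans (+-identityʳ _) (*-identityˡ (G 1))

    -- On the block `(2^j, 2^(j+1)]` the uniform weight `1/2^j` is at least `1/d`, as `d > 2^j`.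
    harmonicSum≤dyadicSum : ∀ J → (∀ d → d ℕ.< 2 ℕ.^ J → 0ℚ ≤ G (suc d)) → harmonicSum (2 ℕ.^ J) G ≤ dyadicSum J G
    harmonicSum≤dyadicSum zero    0≤G = ≤-reflexive (trans one-term (sym (+-identityʳ (G 1))))
    harmonicSum≤dyadicSum (suc j) 0≤G = ≤-trans (≤-reflexive (block-sum j)) (≤-trans
      (+-mono-≤ (harmonicSum≤dyadicSum j λ d d< → 0≤G d (ℕ.<-≤-trans d< (ℕ.^-monoʳ-≤ 2 (ℕ.n≤1+n j))))
        (≤-trans (∑-mono (2 ℕ.^ j) λ i i< → *-monoʳ (0≤G _ (in-range j i<))
            (recip-antimono (ℕ.≤-trans (ℕ.m∸n≤m (2 ℕ.^ j) 1) (ℕ.m≤m+n (2 ℕ.^ j) i))))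
          (≤-reflexive (∑-*ˡ (2 ℕ.^ j) (recip (2 ℕ.^ j ∸ 1)) (λ i → G (suc (2 ℕ.^ j ℕ.+ i)))))))
      (≤-reflexive (trans (+-assoc (G 1) _ _) (cong (G 1 +_) (sym (∑-last j _))))))

    -- On the same block `d ≤ 2^(j+1)` gives `1/2^j ≤ 2/d`. This factor 2 is the whole loss incurred
    -- by replacing the law of `D` by a harmonic one.
    dyadicSum≤2harmonicSum : ∀ J → (∀ d → d ℕ.< 2 ℕ.^ J → 0ℚ ≤ G (suc d)) →
      dyadicSum J G ≤ fromℕ 2 * harmonicSum (2 ℕ.^ J) G
    dyadicSum≤2harmonicSum zero    0≤G = ≤-by (G 1) (0≤G 0 (s≤s z≤n))
      (trans (lemma (G 1)) (cong (fromℕ 2 *_) (sym one-term)))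
      where
      lemma : ∀ g → g + 0ℚ + g ≡ fromℕ 2 * g
      lemma = solve-∀ ℚ-ring
    dyadicSum≤2harmonicSum (suc j) 0≤G = ≤-trans
      (≤-reflexive (trans (cong (G 1 +_) (∑-last j _)) (sym (+-assoc (G 1) _ _)))) (≤-trans
      (+-mono-≤ (dyadicSum≤2harmonicSum j λ d d< → 0≤G d (ℕ.<-≤-trans d< (ℕ.^-monoʳ-≤ 2 (ℕ.n≤1+n j))))
        (≤-trans (≤-reflexive (sym (∑-*ˡ (2 ℕ.^ j) (recip (2 ℕ.^ j ∸ 1)) (λ i → G (suc (2 ℕ.^ j ℕ.+ i))))))
          (≤-trans (∑-mono (2 ℕ.^ j) λ i i< → ≤-trans (*-monoʳ (0≤G _ (in-range j i<)) (compare i i<))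
              (≤-reflexive (*-assoc (fromℕ 2) (recip (2 ℕ.^ j ℕ.+ i)) (G (suc (2 ℕ.^ j ℕ.+ i))))))
            (≤-reflexive (∑-*ˡ (2 ℕ.^ j) (fromℕ 2) (λ i → recip (2 ℕ.^ j ℕ.+ i) * G (suc (2 ℕ.^ j ℕ.+ i))))))))
      (≤-reflexive (trans (sym (*-distribˡ-+ (fromℕ 2) (harmonicSum (2 ℕ.^ j) G) (∑[ i < 2 ℕ.^ j ] recip (2 ℕ.^ j ℕ.+ i) * G (suc (2 ℕ.^ j ℕ.+ i))))) (cong (fromℕ 2 *_) (sym (block-sum j))))))
      where
      compare : ∀ i → i ℕ.< 2 ℕ.^ j → recip (2 ℕ.^ j ∸ 1) ≤ fromℕ 2 * recip (2 ℕ.^ j ℕ.+ i)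
      compare i i< = recip-compare (2 ℕ.^ j ∸ 1) (2 ℕ.^ j ℕ.+ i) (fromℕ 2) (0≤fromℕ 2)
        (≤-trans (fromℕ-mono-≤ (subst (suc (2 ℕ.^ j ℕ.+ i) ℕ.≤_)
            (trans (sym (pow-suc j)) (cong (2 ℕ.*_) (sym (ℕ.suc-pred (2 ℕ.^ j) {{ℕ.m^n≢0 2 j}}))))
            (ℕ.+-monoʳ-< (2 ℕ.^ j) i<)))
          (≤-reflexive (fromℕ-* 2 (suc (2 ℕ.^ j ∸ 1)))))

  -- The effect of a round on a weighted count of the entries above a threshold

  transpose-other : ∀ {n} {i j k : Fin n} → k ≢ i → k ≢ j → transpose i j k ≡ k
  transpose-other {i = i} {j} {k} k≢i k≢j
    rewrite dec-false (k Fin.≟ i) k≢i | dec-false (k Fin.≟ j) k≢j = refl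

  transpose-left : ∀ {n} (i j : Fin n) → transpose i j i ≡ j
  transpose-left i j rewrite dec-true (i Fin.≟ i) refl = refl

  transpose-right : ∀ {n} {i j : Fin n} → i ≢ j → transpose i j j ≡ i
  transpose-right {i = i} {j} i≢j
    rewrite dec-false (j Fin.≟ i) (i≢j ∘ sym) | dec-true (j Fin.≟ j) refl = refl

  module Threshold {a ℓ₁ ℓ₂} (O : DecTotalOrder a ℓ₁ ℓ₂) (N : ℕ) where

    open DecTotalOrder O using (Carrier) renaming (_≤_ to _≼_; _≤?_ to _≼?_; total to ≼-total; trans to ≼-trans)
    open Sorter O N

    private
      n : ℕ
      n = 2 ℕ.^ N

    ⋠⇒≽ : ∀ {c d} → ¬ c ≼ d → d ≼ c
    ⋠⇒≽ {c} {d} c⋠d with ≼-total c d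
    ... | inj₁ c≼d = ⊥-elim (c⋠d c≼d)
    ... | inj₂ d≼c = d≼c

    module _ (i j : Pos N) where

      sortPair-cases : ∀ x → sortPair x (i , j) ≡ x ⊎ sortPair x (i , j) ≡ x ∘ transpose i j ⊎ sortPair x (i , j) ≡ x ∘ transpose j i
      sortPair-cases x with does (i Fin.≤? j)
      ... | true  with does (x i ≼? x j)
      ...   | true  = inj₁ refl
      ...   | false = inj₂ (inj₁ refl)
      sortPair-cases x | false with does (x j ≼? x i)
      ...   | true  = inj₁ refl
      ...   | false = inj₂ (inj₂ refl)

      sortPair-other : ∀ x {k} → k ≢ i → k ≢ j → sortPair x (i , j) k ≡ x k
      sortPair-other x {k} k≢i k≢j with sortPair-cases x
      ... | inj₁ eq        = cong (λ y → y k) eq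
      ... | inj₂ (inj₁ eq) = trans (cong (λ y → y k) eq) (cong x (transpose-other k≢i k≢j))
      ... | inj₂ (inj₂ eq) = trans (cong (λ y → y k) eq) (cong x (transpose-other k≢j k≢i))

    module _ (v : Carrier) where

      -- The labels stay in the abstract order and are only viewed through this indicator, so a
      -- single run of the sorter serves all thresholds at once.
      above : Carrier → ℚ
      above c = if does (c ≼? v) then 0ℚ else 1ℚ

      above-cases : ∀ c → (c ≼ v × above c ≡ 0ℚ) ⊎ (¬ c ≼ v × above c ≡ 1ℚ)
      above-cases c with c ≼? v
      ... | yes c≼v = inj₁ (c≼v , refl)
      ... | no  c⋠v = inj₂ (c⋠v , refl)

      above-idem : ∀ c → above c * above c ≡ above c
      above-idem c with above-cases c
      ... | inj₁ (_ , eq) rewrite eq = refl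
      ... | inj₂ (_ , eq) rewrite eq = refl

      0≤above : ∀ c → 0ℚ ≤ above c
      0≤above c with above-cases c
      ... | inj₁ (_ , eq) rewrite eq = ≤-refl
      ... | inj₂ (_ , eq) rewrite eq = 0≤1

      above≤1 : ∀ c → above c ≤ 1ℚ
      above≤1 c with above-cases c
      ... | inj₁ (_ , eq) rewrite eq = 0≤1
      ... | inj₂ (_ , eq) rewrite eq = ≤-refl

      -- In product form, so that sums over pairs of positions factor into counts of high labels.
      inverted : Carrier → Carrier → ℚ
      inverted c d = above c * (1ℚ - above d)

      0≤inverted : ∀ c d → 0ℚ ≤ inverted c d
      0≤inverted c d = 0≤* (0≤above c) (p≤q⇒0≤q-p (above≤1 d))

      inverted-≼ : ∀ {c d} → c ≼ d → inverted c d ≡ 0ℚ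
      inverted-≼ {c} {d} c≼d with above-cases c | above-cases d
      ... | inj₁ (_ , eq) | _ rewrite eq = *-zeroˡ (1ℚ - above d)
      ... | inj₂ (c⋠v , _) | inj₁ (d≼v , _) = ⊥-elim (c⋠v (≼-trans c≼d d≼v))
      ... | inj₂ (_ , eq) | inj₂ (_ , eq′) rewrite eq | eq′ = refl

      -- A swap takes place only when the labels are in the wrong order. In that case the linear
      -- difference produced by a transposition coincides with the product indicator.
      inverted-≽ : ∀ {c d} → d ≼ c → inverted c d ≡ above c - above d
      inverted-≽ {c} {d} d≼c with above-cases c | above-cases d
      ... | _ | inj₁ (_ , eq) rewrite eq = trans (*-identityʳ (above c)) (sym (+-identityʳ (above c)))
      ... | inj₁ (c≼v , _) | inj₂ (d⋠v , _) = ⊥-elim (d⋠v (≼-trans d≼c c≼v))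
      ... | inj₂ (_ , eq) | inj₂ (_ , eq′) rewrite eq | eq′ = refl

      module _ (φ : ℕ → ℚ) where

        weight : Labelling → ℚ
        weight x = ∑[ a < n ] φ a * above (x (pos N a))

        -- Both orientations occur: in a pair `(a , a + D)` that wraps around, the second component
        -- is the smaller position.
        gain : Labelling → Pos N × Pos N → ℚ
        gain x (i , j) =
          if does (i Fin.≤? j) then (φ (toℕ j) - φ (toℕ i)) * inverted (x i) (x j)
                               else (φ (toℕ i) - φ (toℕ j)) * inverted (x j) (x i)

        weight-transpose : ∀ x {i j} → i ≢ j →
          weight (x ∘ transpose i j) ≡ weight x + (φ (toℕ j) - φ (toℕ i)) * (above (x i) - above (x j))
        weight-transpose x {i} {j} i≢j = begin
          weight (x ∘ transpose i j)
            ≡⟨ ∑-cong n (λ a a<n → pointwise a a<n) ⟩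
          (∑[ a < n ] (φ a * above (x (pos N a)) + ([ toℕ i ≡ᵇ a ] * (φ a * δ) + [ toℕ j ≡ᵇ a ] * (φ a * - δ))))
            ≡⟨ trans (∑-distrib-+ n _ _) (cong (weight x +_) (∑-distrib-+ n _ _)) ⟩
          weight x + ((∑[ a < n ] [ toℕ i ≡ᵇ a ] * (φ a * δ)) + (∑[ a < n ] [ toℕ j ≡ᵇ a ] * (φ a * - δ)))
            ≡⟨ cong (weight x +_) (cong₂ _+_ (∑-delta (Fin.toℕ<n i) (λ a → φ a * δ)) (∑-delta (Fin.toℕ<n j) (λ a → φ a * - δ))) ⟩
          weight x + (φ (toℕ i) * δ + φ (toℕ j) * - δ)
            ≡⟨ cong (weight x +_) (collect (φ (toℕ i)) (φ (toℕ j)) (above (x i)) (above (x j))) ⟩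
          weight x + (φ (toℕ j) - φ (toℕ i)) * (above (x i) - above (x j)) ∎
          where
          open ≡-Reasoning
          δ : ℚ
          δ = above (x j) - above (x i)
          collect : ∀ p q c d → p * (d - c) + q * - (d - c) ≡ (q - p) * (c - d)
          collect = solve-∀ ℚ-ring
          at-i : ∀ p c d → p * d ≡ p * c + (1ℚ * (p * (d - c)) + 0ℚ * (p * - (d - c)))
          at-i = solve-∀ ℚ-ring
          at-j : ∀ p c d → p * c ≡ p * d + (0ℚ * (p * (d - c)) + 1ℚ * (p * - (d - c)))
          at-j = solve-∀ ℚ-ring
          elsewhere : ∀ p c d → p * c ≡ p * c + (0ℚ * (p * d) + 0ℚ * (p * - d))
          elsewhere = solve-∀ ℚ-ring
          hit : ∀ k → [ k ≡ᵇ k ] ≡ 1ℚ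
          hit k = cong (if_then 1ℚ else 0ℚ) (dec-true (k ℕ.≟ k) refl)
          miss : ∀ {k l} → k ≢ l → [ k ≡ᵇ l ] ≡ 0ℚ
          miss {k} {l} k≢l = cong (if_then 1ℚ else 0ℚ) (dec-false (k ℕ.≟ l) k≢l)
          Pointwise : Pos N → Set
          Pointwise k = φ (toℕ k) * above (x (transpose i j k)) ≡
            φ (toℕ k) * above (x k) + ([ toℕ i ≡ᵇ toℕ k ] * (φ (toℕ k) * δ) + [ toℕ j ≡ᵇ toℕ k ] * (φ (toℕ k) * - δ))
          pointwise-pos : ∀ k → Pointwise k
          pointwise-pos k = cases (k Fin.≟ i) (k Fin.≟ j)
            where
            cases : Dec (k ≡ i) → Dec (k ≡ j) → Pointwise k
            cases (yes refl) _
              rewrite transpose-left k j | hit (toℕ k) | miss (i≢j ∘ sym ∘ Fin.toℕ-injective)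
              = at-i (φ (toℕ k)) (above (x k)) (above (x j))
            cases (no _) (yes refl)
              rewrite transpose-right i≢j | hit (toℕ k) | miss (i≢j ∘ Fin.toℕ-injective)
              = at-j (φ (toℕ k)) (above (x i)) (above (x k))
            cases (no k≢i) (no k≢j)
              rewrite transpose-other k≢i k≢j | miss (k≢i ∘ sym ∘ Fin.toℕ-injective) | miss (k≢j ∘ sym ∘ Fin.toℕ-injective)
              = elsewhere (φ (toℕ k)) (above (x k)) δ
          pointwise : ∀ a → a ℕ.< n → φ a * above (x (transpose i j (pos N a))) ≡
            φ a * above (x (pos N a)) + ([ toℕ i ≡ᵇ a ] * (φ a * δ) + [ toℕ j ≡ᵇ a ] * (φ a * - δ))
          pointwise a a<n = subst (λ b → φ b * above (x (transpose i j (pos N a))) ≡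
            φ b * above (x (pos N a)) + ([ toℕ i ≡ᵇ b ] * (φ b * δ) + [ toℕ j ≡ᵇ b ] * (φ b * - δ)))
            (toℕ-pos-< N a<n) (pointwise-pos (pos N a))

        weight-compareSwap : ∀ x {i j} → i ≢ j →
          weight (compareSwap i j x) ≡ weight x + (φ (toℕ j) - φ (toℕ i)) * inverted (x i) (x j)
        weight-compareSwap x {i} {j} i≢j with x i ≼? x j
        ... | yes xi≼xj = sym (trans
          (cong (weight x +_) (trans (cong ((φ (toℕ j) - φ (toℕ i)) *_) (inverted-≼ xi≼xj)) (*-zeroʳ (φ (toℕ j) - φ (toℕ i)))))
          (+-identityʳ (weight x)))
        ... | no xi⋠xj = trans (weight-transpose x i≢j)
          (cong (λ z → weight x + (φ (toℕ j) - φ (toℕ i)) * z) (sym (inverted-≽ (⋠⇒≽ xi⋠xj))))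

        weight-sortPair : ∀ x {i j} → i ≢ j → weight (sortPair x (i , j)) ≡ weight x + gain x (i , j)
        weight-sortPair x {i} {j} i≢j with does (i Fin.≤? j)
        ... | true  = weight-compareSwap x i≢j
        ... | false = weight-compareSwap x (i≢j ∘ sym)

        gain-cong : ∀ {x y i j} → y i ≡ x i → y j ≡ x j → gain y (i , j) ≡ gain x (i , j)
        gain-cong eqᵢ eqⱼ rewrite eqᵢ | eqⱼ = refl

        -- Since the pairs are disjoint, sorting one leaves the labels at the others untouched. All
        -- gains may therefore be evaluated at the list before the round, and they add up.
        weight-step : ∀ x M → IsMatching {N} M → weight (step x M) ≡ weight x + listSum M (gain x)
        weight-step x []            _ = sym (+-identityʳ (weight x))
        weight-step x ((i , j) ∷ M) ((i≢j ∷ i∉) ∷ j∉ ∷ u) = begin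
          weight (step y M)                                      ≡⟨ weight-step y M u ⟩
          weight y + listSum M (gain y)                          ≡⟨ cong₂ _+_ (weight-sortPair x i≢j) (listSum-cong-All (untouched M i∉ j∉)) ⟩
          weight x + gain x (i , j) + listSum M (gain x)         ≡⟨ +-assoc (weight x) (gain x (i , j)) _ ⟩
          weight x + listSum ((i , j) ∷ M) (gain x)              ∎
          where
          open ≡-Reasoning
          y : Labelling
          y = sortPair x (i , j)
          untouched : ∀ M → All (i ≢_) (endpoints M) → All (j ≢_) (endpoints M) → All (λ p → gain y p ≡ gain x p) M
          untouched []            _ _ = []
          untouched ((k , l) ∷ M) (i≢k ∷ i≢l ∷ i∉) (j≢k ∷ j≢l ∷ j∉) =
            gain-cong (sortPair-other i j x (i≢k ∘ sym) (j≢k ∘ sym)) (sortPair-other i j x (i≢l ∘ sym) (j≢l ∘ sym))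
            ∷ untouched M i∉ j∉

  -- The expected effect of a round

  module Drift {a ℓ₁ ℓ₂} (O : DecTotalOrder a ℓ₁ ℓ₂) (J : ℕ) (1≤J : 1 ℕ.≤ J) where

    private
      N n h : ℕ
      N = suc J
      n = 2 ℕ.^ N
      h = 2 ℕ.^ J

    open DecTotalOrder O using (Carrier)
    open Sorter O N
    open Threshold O N

    module _ (v : Carrier) where

      inversionsAt : Labelling → ℕ → ℕ → ℚ
      inversionsAt x i j = inverted v (x (pos N i)) (x (pos N j))

      0≤inversionsAt : ∀ x i j → 0ℚ ≤ inversionsAt x i j
      0≤inversionsAt x i j = 0≤inverted v (x (pos N i)) (x (pos N j))

      module _ (φ : ℕ → ℚ) where

        gap : Labelling → ℕ → ℕ → ℚ
        gap x i j = (φ j - φ i) * inversionsAt x i j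

        cyclicGain : Labelling → ℕ → ℚ
        cyclicGain x D = ∑[ a < n ] gain v φ x (pos N a , pos N (a ℕ.+ D))

        -- `recip J` is the probability `1/N` of a scale, and `recip 3` the probability `1/4` that
        -- `R` selects a given cyclic pair.
        expected-weight : ∀ x → 𝔼 (q̃ N) (λ M → weight v φ (step x M)) ≡
          weight v φ x + recip J * scaleSum N (λ D → recip 3 * cyclicGain x D)
        expected-weight x = begin
          𝔼 (q̃ N) (λ M → weight v φ (step x M))
            ≡⟨ 𝔼-cong-surely (All.map (λ {(_ , M)} (matching , _) → weight-step v φ x M matching) (q̃-matching N (s≤s 1≤J))) ⟩
          𝔼 (q̃ N) (λ M → weight v φ x + listSum M (gain v φ x))
            ≡⟨ 𝔼-+ (q̃ N) (λ _ → weight v φ x) (λ M → listSum M (gain v φ x)) ⟩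
          𝔼 (q̃ N) (λ _ → weight v φ x) + 𝔼 (q̃ N) (λ M → listSum M (gain v φ x))
            ≡⟨ cong₂ _+_ (𝔼-const (q̃-Law N (s≤s 1≤J)) (weight v φ x)) (q̃-sum J (s≤s 1≤J) (gain v φ x)) ⟩
          weight v φ x + recip J * scaleSum N (λ D → recip 3 * cyclicGain x D) ∎
          where open ≡-Reasoning

        gain-< : ∀ x {i j} → i ℕ.≤ j → j ℕ.< n → gain v φ x (pos N i , pos N j) ≡ gap x i j
        gain-< x {i} {j} i≤j j<n
          rewrite toℕ-pos-< N (ℕ.≤-<-trans i≤j j<n) | toℕ-pos-< N j<n | dec-true (i ℕ.≤? j) i≤j = refl

        gain-> : ∀ x {i j} → j ℕ.< i → i ℕ.< n → gain v φ x (pos N i , pos N j) ≡ gap x j i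
        gain-> x {i} {j} j<i i<n
          rewrite toℕ-pos-< N (ℕ.<-trans j<i i<n) | toℕ-pos-< N i<n | dec-false (i ℕ.≤? j) (ℕ.<⇒≱ j<i) = refl

        -- The second sum collects the pairs that wrap around.
        cyclicGain-split : ∀ x {D} → D ℕ.≤ h → cyclicGain x D ≡
          (∑[ i < n ∸ D ] gap x i (i ℕ.+ D)) + (∑[ i < D ] gap x i (i ℕ.+ (n ∸ D)))
        cyclicGain-split x {D} D≤h = begin
          cyclicGain x D
            ≡⟨ cong (λ z → sum z g) (ℕ.m∸n+n≡m D≤n) ⟨
          sum (n ∸ D ℕ.+ D) g
            ≡⟨ ∑-split (n ∸ D) D g ⟩
          sum (n ∸ D) g + (∑[ i < D ] g (n ∸ D ℕ.+ i))
            ≡⟨ cong₂ _+_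
                 (∑-cong (n ∸ D) λ i i< → gain-< x (ℕ.m≤m+n i D) (subst (i ℕ.+ D ℕ.<_) (ℕ.m∸n+n≡m D≤n) (ℕ.+-monoˡ-< D i<)))
                 (∑-cong D λ i i<D → wrap i i<D) ⟩
          (∑[ i < n ∸ D ] gap x i (i ℕ.+ D)) + (∑[ i < D ] gap x i (i ℕ.+ (n ∸ D))) ∎
          where
          open ≡-Reasoning
          g : ℕ → ℚ
          g i = gain v φ x (pos N i , pos N (i ℕ.+ D))
          D≤n : D ℕ.≤ n
          D≤n = ℕ.≤-trans D≤h (ℕ.m≤m+n h _)
          D≤n∸D : D ℕ.≤ n ∸ D
          D≤n∸D = ℕ.m+n≤o⇒m≤o∸n D (subst (D ℕ.+ D ℕ.≤_) (sym (pow-suc J)) (ℕ.+-mono-≤ D≤h D≤h))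
          wrap : ∀ i → i ℕ.< D → g (n ∸ D ℕ.+ i) ≡ gap x i (i ℕ.+ (n ∸ D))
          wrap i i<D = begin
            gain v φ x (pos N (n ∸ D ℕ.+ i) , pos N (n ∸ D ℕ.+ i ℕ.+ D))
              ≡⟨ cong₂ (λ k l → gain v φ x (pos N k , l)) (ℕ.+-comm (n ∸ D) i)
                   (pos-≡ N (trans (cong (λ z → (z ℕ.% n) {{ℕ.m^n≢0 2 N}}) (around (ℕ.m∸n+n≡m D≤n)))
                     (ℕ.[m+n]%n≡m%n i n {{ℕ.m^n≢0 2 N}}))) ⟩
            gain v φ x (pos N (i ℕ.+ (n ∸ D)) , pos N i)
              ≡⟨ gain-> x (ℕ.m<m+n i (ℕ.<-≤-trans (ℕ.≤-<-trans z≤n i<D) D≤n∸D))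
                   (ℕ.<-≤-trans (ℕ.+-monoˡ-< (n ∸ D) i<D) (ℕ.≤-reflexive (ℕ.m+[n∸m]≡n D≤n))) ⟩
            gap x i (i ℕ.+ (n ∸ D)) ∎
            where
            around : ∀ {m} → m ℕ.+ D ≡ n → m ℕ.+ i ℕ.+ D ≡ i ℕ.+ n
            around {m} eq = trans (regroup m i D) (cong (i ℕ.+_) eq)
              where
              regroup : ∀ m i d → m ℕ.+ i ℕ.+ d ≡ i ℕ.+ (m ℕ.+ d)
              regroup = ℕSolver.solve-∀

      inversions : Labelling → ℚ
      inversions x = ∑[ j < n ] ∑[ i < j ] inversionsAt x i j

      0≤inversions : ∀ x → 0ℚ ≤ inversions x
      0≤inversions x = 0≤∑ n λ j _ → 0≤∑ j λ i _ → 0≤inversionsAt x i j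

      moment count : Labelling → ℚ
      moment = weight v fromℕ
      count = weight v (λ _ → 1ℚ)

      count-step : ∀ x M → IsMatching {N} M → count (step x M) ≡ count x
      count-step x M matching = trans (weight-step v (λ _ → 1ℚ) x M matching)
        (trans (cong (count x +_) (no-gain M)) (+-identityʳ (count x)))
        where
        no-gain : ∀ M → listSum M (gain v (λ _ → 1ℚ) x) ≡ 0ℚ
        no-gain []            = refl
        no-gain ((i , j) ∷ M) = trans (cong₂ _+_ zero-gain (no-gain M)) (+-identityˡ 0ℚ)
          where
          zero-gain : gain v (λ _ → 1ℚ) x (i , j) ≡ 0ℚ
          zero-gain with does (i Fin.≤? j)
          ... | true  = *-zeroˡ (inverted v (x i) (x j))
          ... | false = *-zeroˡ (inverted v (x j) (x i))

      -- Hence a swap lowers the number of inversions by exactly the distance of the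
      -- swapped positions.
      inversions-moment : ∀ x → fromℕ 2 * (inversions x + moment x) ≡
        (fromℕ 2 * fromℕ n - 1ℚ) * count x - count x * count x
      inversions-moment x = go n
        where
        Y : ℕ → ℚ
        Y i = above v (x (pos N i))
        go : ∀ m → let c = ∑[ i < m ] 1ℚ * Y i in
          fromℕ 2 * ((∑[ j < m ] ∑[ i < j ] Y i * (1ℚ - Y j)) + (∑[ i < m ] fromℕ i * Y i)) ≡
          (fromℕ 2 * fromℕ m - 1ℚ) * c - c * c
        go zero    = refl
        go (suc m) = begin
          fromℕ 2 * ((∑[ j < suc m ] ∑[ i < j ] Y i * (1ℚ - Y j)) + (∑[ i < suc m ] fromℕ i * Y i))
            ≡⟨ cong (fromℕ 2 *_) (cong₂ _+_
                 (trans (∑-last m _) (cong (I +_) (trans (∑-*ʳ m (1ℚ - y) Y)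
                   (cong (_* (1ℚ - y)) (∑-cong m λ i _ → sym (*-identityˡ (Y i)))))))
                 (∑-last m _)) ⟩
          fromℕ 2 * ((I + c * (1ℚ - y)) + (S + fromℕ m * y))
            ≡⟨ regroup I S c y (fromℕ m) ⟩
          fromℕ 2 * (I + S) + (fromℕ 2 * (c * (1ℚ - y)) + fromℕ 2 * (fromℕ m * y))
            ≡⟨ cong₂ _+_ (go m) refl ⟩
          (fromℕ 2 * fromℕ m - 1ℚ) * c - c * c + (fromℕ 2 * (c * (1ℚ - y)) + fromℕ 2 * (fromℕ m * y))
            ≡⟨ expand c y (fromℕ m) ⟩
          (fromℕ 2 * (1ℚ + fromℕ m) - 1ℚ) * (c + y) - (c * c + fromℕ 2 * (c * y) + y)
            -- The label is seen as 0 or 1, so `y = y * y`; this completes the square `(c + y)²`.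
            ≡⟨ cong₂ (λ p q → (fromℕ 2 * p - 1ℚ) * (c + y) - (c * c + fromℕ 2 * (c * y) + q)) (fromℕ-suc m) (above-idem v (x (pos N m))) ⟨
          (fromℕ 2 * fromℕ (suc m) - 1ℚ) * (c + y) - (c * c + fromℕ 2 * (c * y) + y * y)
            ≡⟨ square c y (fromℕ (suc m)) ⟩
          (fromℕ 2 * fromℕ (suc m) - 1ℚ) * (c + y) - (c + y) * (c + y)
            ≡⟨ cong (λ z → (fromℕ 2 * fromℕ (suc m) - 1ℚ) * z - z * z)
                 (trans (∑-last m (λ i → 1ℚ * Y i)) (cong (c +_) (*-identityˡ y))) ⟨
          (fromℕ 2 * fromℕ (suc m) - 1ℚ) * (∑[ i < suc m ] 1ℚ * Y i) - (∑[ i < suc m ] 1ℚ * Y i) * (∑[ i < suc m ] 1ℚ * Y i) ∎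
          where
          open ≡-Reasoning
          I S c y : ℚ
          I = ∑[ j < m ] ∑[ i < j ] Y i * (1ℚ - Y j)
          S = ∑[ i < m ] fromℕ i * Y i
          c = ∑[ i < m ] 1ℚ * Y i
          y = Y m
          regroup : ∀ I S c y k → fromℕ 2 * ((I + c * (1ℚ - y)) + (S + k * y)) ≡
            fromℕ 2 * (I + S) + (fromℕ 2 * (c * (1ℚ - y)) + fromℕ 2 * (k * y))
          regroup = solve-∀ ℚ-ring
          expand : ∀ c y k → (fromℕ 2 * k - 1ℚ) * c - c * c + (fromℕ 2 * (c * (1ℚ - y)) + fromℕ 2 * (k * y)) ≡
            (fromℕ 2 * (1ℚ + k) - 1ℚ) * (c + y) - (c * c + fromℕ 2 * (c * y) + y)
          expand = solve-∀ ℚ-ring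
          square : ∀ c y k → (fromℕ 2 * k - 1ℚ) * (c + y) - (c * c + fromℕ 2 * (c * y) + y * y) ≡
            (fromℕ 2 * k - 1ℚ) * (c + y) - (c + y) * (c + y)
          square = solve-∀ ℚ-ring

      -- `inversions + moment` is a function of the number of high labels alone, which a round
      -- preserves. The inversions lost are therefore the moment gained, and the moment is linear in
      -- the gains.
      inversions-step : ∀ x M → IsMatching {N} M →
        inversions (step x M) ≡ inversions x + moment x - moment (step x M)
      inversions-step x M matching = trans (isolate (inversions (step x M)) (moment (step x M)))
        (cong (_- moment (step x M)) (*-cancelˡ-≡ {p = inversions (step x M) + moment (step x M)} {q = inversions x + moment x} {r = fromℕ 2} (0<fromℕ-suc 1) (trans (inversions-moment (step x M))
          (trans (cong (λ c → (fromℕ 2 * fromℕ n - 1ℚ) * c - c * c) (count-step x M matching))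
            (sym (inversions-moment x))))))
        where
        isolate : ∀ p q → p ≡ p + q - q
        isolate = solve-∀ ℚ-ring

      distanceInversions : Labelling → ℕ → ℚ
      distanceInversions x d = ∑[ i < n ∸ d ] inversionsAt x i (i ℕ.+ d)

      0≤distanceInversions : ∀ x d → 0ℚ ≤ distanceInversions x d
      0≤distanceInversions x d = 0≤∑ (n ∸ d) λ i _ → 0≤inversionsAt x i (i ℕ.+ d)

      -- Pairs the linear distance `d ≤ h` with `n - d`, the two distances that a cyclic distance
      -- `d` serves. Only `h` is counted twice, whence an inequality.
      inversions≤ : ∀ x → inversions x ≤ ∑[ d < h ] (distanceInversions x (suc d) + distanceInversions x (n ∸ suc d))
      inversions≤ x = begin
        inversions x
          ≡⟨ ∑-triangle n (inversionsAt x) ⟨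
        (∑[ d < n ] at (suc d))
          ≡⟨ cong (λ m → ∑[ d < m ] at (suc d)) n≡ ⟩
        (∑[ d < h ℕ.+ h ] at (suc d))
          ≡⟨ ∑-split h h (at ∘ suc) ⟩
        near + (∑[ d < h ] at (suc (h ℕ.+ d)))
          ≤⟨ +-monoʳ-≤ near (≤-by (at h) (0≤distanceInversions x h) shift-index) ⟩
        near + (∑[ d < h ] at (h ℕ.+ d))
          ≡⟨ cong (near +_) (∑-reverse h (λ d → at (h ℕ.+ d))) ⟩
        near + (∑[ d < h ] at (h ℕ.+ (h ∸ suc d)))
          ≡⟨ cong (near +_) (∑-cong h λ d d<h → cong at (trans (sym (ℕ.+-∸-assoc h d<h)) (cong (_∸ suc d) (sym n≡)))) ⟩
        near + (∑[ d < h ] at (n ∸ suc d))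
          ≡⟨ ∑-distrib-+ h (λ d → at (suc d)) (λ d → at (n ∸ suc d)) ⟨
        (∑[ d < h ] (at (suc d) + at (n ∸ suc d))) ∎
        where
        open ≤-Reasoning
        at : ℕ → ℚ
        at = distanceInversions x
        near : ℚ
        near = ∑[ d < h ] at (suc d)
        n≡ : n ≡ h ℕ.+ h
        n≡ = pow-suc J
        at-2h : at (h ℕ.+ h) ≡ 0ℚ
        at-2h = cong (λ m → ∑[ i < m ] inversionsAt x i (i ℕ.+ (h ℕ.+ h))) (trans (cong (_∸ (h ℕ.+ h)) n≡) (ℕ.n∸n≡0 (h ℕ.+ h)))
        shift-index : (∑[ d < h ] at (suc (h ℕ.+ d))) + at h ≡ ∑[ d < h ] at (h ℕ.+ d)
        shift-index = trans (+-comm _ (at h)) (trans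
          (cong₂ _+_ (cong at (sym (ℕ.+-identityʳ h))) (∑-cong h λ d _ → cong at (sym (ℕ.+-suc h d))))
          (trans (∑-last h (λ d → at (h ℕ.+ d))) (trans (cong ((∑[ d < h ] at (h ℕ.+ d)) +_) at-2h) (+-identityʳ _))))

      private
        G : Labelling → ℕ → ℚ
        G x D = recip 3 * cyclicGain fromℕ x D

        G-value : ∀ x {D} → D ℕ.≤ h → G x D ≡
          recip 3 * (fromℕ D * distanceInversions x D + fromℕ (n ∸ D) * distanceInversions x (n ∸ D))
        G-value x {D} D≤h = cong (recip 3 *_) (trans (cyclicGain-split fromℕ x D≤h)
          (cong₂ _+_ (scaled (n ∸ D) D)
            (trans (scaled D (n ∸ D)) (cong (λ m → fromℕ (n ∸ D) * (∑[ i < m ] inversionsAt x i (i ℕ.+ (n ∸ D))))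
              (sym (ℕ.m∸[m∸n]≡n (ℕ.≤-trans D≤h (ℕ.m≤m+n h _))))))))
          where
          cancel : ∀ p q → p + q - p ≡ q
          cancel = solve-∀ ℚ-ring
          scaled : ∀ m d → (∑[ i < m ] gap fromℕ x i (i ℕ.+ d)) ≡ fromℕ d * (∑[ i < m ] inversionsAt x i (i ℕ.+ d))
          scaled m d = trans (∑-cong m λ i _ → cong (_* inversionsAt x i (i ℕ.+ d))
              (trans (cong (_- fromℕ i) (fromℕ-+ i d)) (cancel (fromℕ i) (fromℕ d))))
            (∑-*ˡ m (fromℕ d) (λ i → inversionsAt x i (i ℕ.+ d)))

        0≤G : ∀ x d → d ℕ.< h → 0ℚ ≤ G x (suc d)
        0≤G x d d<h = subst (0ℚ ≤_) (sym (G-value x d<h)) (0≤* (0≤recip 3)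
          (0≤+ (0≤* (0≤fromℕ (suc d)) (0≤distanceInversions x (suc d)))
               (0≤* (0≤fromℕ (n ∸ suc d)) (0≤distanceInversions x (n ∸ suc d)))))

        -- Sorting an inversion at distance `d` gains `d`, which the weight `1/d` turns into 1. A
        -- wrapped inversion gains `n - d ≥ d`, hence counts for at least 1.
        G-bound : ∀ x d → d ℕ.< h →
          recip 3 * (distanceInversions x (suc d) + distanceInversions x (n ∸ suc d)) ≤ recip d * G x (suc d)
        G-bound x d d<h = ≤-recip d (begin
          fromℕ (suc d) * (recip 3 * (p + q))                     ≡⟨ regroup (fromℕ (suc d)) (recip 3) p q ⟩
          recip 3 * (fromℕ (suc d) * p + fromℕ (suc d) * q)       ≤⟨ *-monoˡ (0≤recip 3) (+-monoʳ-≤ (fromℕ (suc d) * p)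
                                                                       (*-monoʳ (0≤distanceInversions x (n ∸ suc d)) (fromℕ-mono-≤ far))) ⟩
          recip 3 * (fromℕ (suc d) * p + fromℕ (n ∸ suc d) * q)   ≡⟨ G-value x d<h ⟨
          G x (suc d)                                             ∎)
          where
          open ≤-Reasoning
          p q : ℚ
          p = distanceInversions x (suc d)
          q = distanceInversions x (n ∸ suc d)
          regroup : ∀ s r p q → s * (r * (p + q)) ≡ r * (s * p + s * q)
          regroup = solve-∀ ℚ-ring
          far : suc d ℕ.≤ n ∸ suc d
          far = ℕ.m+n≤o⇒m≤o∸n (suc d) (subst (suc d ℕ.+ suc d ℕ.≤_) (sym (pow-suc J)) (ℕ.+-mono-≤ d<h d<h))

      inversions-contract : ∀ x →
        𝔼 (q̃ N) (λ M → inversions (step x M)) ≤ (1ℚ - recip J * recip 3) * inversions x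
      inversions-contract x = begin
        𝔼 (q̃ N) (λ M → inversions (step x M))
          ≡⟨ 𝔼-cong-surely (All.map (λ {(_ , M)} (matching , _) → inversions-step x M matching) (q̃-matching N (s≤s 1≤J))) ⟩
        𝔼 (q̃ N) (λ M → inversions x + moment x - moment (step x M))
          ≡⟨ 𝔼-cong (q̃ N) (λ M → cong (inversions x + moment x +_) (negate (moment (step x M)))) ⟩
        𝔼 (q̃ N) (λ M → inversions x + moment x + - 1ℚ * moment (step x M))
          ≡⟨ trans (𝔼-+ (q̃ N) (λ _ → inversions x + moment x) (λ M → - 1ℚ * moment (step x M)))
               (cong₂ _+_ (𝔼-const (q̃-Law N (s≤s 1≤J)) (inversions x + moment x)) (𝔼-*ˡ (q̃ N) (- 1ℚ) (λ M → moment (step x M)))) ⟩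
        inversions x + moment x + - 1ℚ * 𝔼 (q̃ N) (λ M → moment (step x M))
          ≡⟨ cong (λ z → inversions x + moment x + - 1ℚ * z) (expected-weight fromℕ x) ⟩
        inversions x + moment x + - 1ℚ * (moment x + recip J * scaleSum N (G x))
          ≡⟨ collect (inversions x) (moment x) (recip J) (scaleSum N (G x)) ⟩
        inversions x - recip J * scaleSum N (G x)
          ≤⟨ +-monoʳ-≤ (inversions x) (neg-antimono-≤ (*-monoˡ (0≤recip J) (begin
               recip 3 * inversions x
                 ≤⟨ *-monoˡ (0≤recip 3) (inversions≤ x) ⟩
               recip 3 * (∑[ d < h ] (distanceInversions x (suc d) + distanceInversions x (n ∸ suc d)))
                 ≡⟨ ∑-*ˡ h (recip 3) _ ⟨
               (∑[ d < h ] recip 3 * (distanceInversions x (suc d) + distanceInversions x (n ∸ suc d)))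
                 ≤⟨ ∑-mono h (G-bound x) ⟩
               harmonicSum h (G x)
                 ≤⟨ harmonicSum≤dyadicSum (G x) J (0≤G x) ⟩
               dyadicSum J (G x)
                 ≡⟨ scaleSum-dyadic J (G x) ⟨
               scaleSum N (G x) ∎))) ⟩
        inversions x - recip J * (recip 3 * inversions x)
          ≡⟨ factor (inversions x) (recip J) (recip 3) ⟩
        (1ℚ - recip J * recip 3) * inversions x ∎
        where
        open ≤-Reasoning
        negate : ∀ p → - p ≡ - 1ℚ * p
        negate = solve-∀ ℚ-ring
        collect : ∀ i m r s → i + m + - 1ℚ * (m + r * s) ≡ i - r * s
        collect = solve-∀ ℚ-ring
        factor : ∀ i r s → i - r * (s * i) ≡ (1ℚ - r * s) * i
        factor = solve-∀ ℚ-ring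

  -- Powers

  private
    module ℚ^ = Exp (CommutativeRing.commutativeSemiring +-*-commutativeRing)

  ^-distrib-* : ∀ p q n → (p * q) ^ n ≡ p ^ n * q ^ n
  ^-distrib-* = ℚ^.^-distrib-*

  ^-+ : ∀ p m n → p ^ (m ℕ.+ n) ≡ p ^ m * p ^ n
  ^-+ = ℚ^.^-homo-*

  ^-* : ∀ p m n → p ^ (m ℕ.* n) ≡ (p ^ m) ^ n
  ^-* p m n = sym (ℚ^.^-assocʳ p m n)

  0≤^ : ∀ {p} n → 0ℚ ≤ p → 0ℚ ≤ p ^ n
  0≤^ zero    0≤p = 0≤1
  0≤^ (suc n) 0≤p = 0≤* 0≤p (0≤^ n 0≤p)

  ^-mono : ∀ {p q} n → 0ℚ ≤ p → p ≤ q → p ^ n ≤ q ^ n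
  ^-mono zero    0≤p p≤q = ≤-refl
  ^-mono (suc n) 0≤p p≤q = *-mono-≤ (0≤^ n 0≤p) (≤-trans 0≤p p≤q) p≤q (^-mono n 0≤p p≤q)

  1^ : ∀ n → 1ℚ ^ n ≡ 1ℚ
  1^ zero    = refl
  1^ (suc n) = trans (*-identityˡ (1ℚ ^ n)) (1^ n)

  ^≤1 : ∀ {p} n → 0ℚ ≤ p → p ≤ 1ℚ → p ^ n ≤ 1ℚ
  ^≤1 {p} n 0≤p p≤1 = subst (p ^ n ≤_) (1^ n) (^-mono n 0≤p p≤1)

  1≤^ : ∀ {p} n → 1ℚ ≤ p → 1ℚ ≤ p ^ n
  1≤^ {p} n 1≤p = subst (_≤ p ^ n) (1^ n) (^-mono n 0≤1 1≤p)

  ^-antimono-exponent : ∀ {p m n} → 0ℚ ≤ p → p ≤ 1ℚ → m ℕ.≤ n → p ^ n ≤ p ^ m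
  ^-antimono-exponent {p} {m} {n} 0≤p p≤1 m≤n = ≤-trans
    (≤-reflexive (trans (cong (p ^_) (sym (ℕ.m+[n∸m]≡n m≤n))) (^-+ p m (n ∸ m))))
    (≤-trans (*-monoˡ (0≤^ m 0≤p) (^≤1 (n ∸ m) 0≤p p≤1)) (≤-reflexive (*-identityʳ (p ^ m))))

  ^-mono-exponent : ∀ {p m n} → 1ℚ ≤ p → m ℕ.≤ n → p ^ m ≤ p ^ n
  ^-mono-exponent {p} {m} {n} 1≤p m≤n = ≤-trans
    (≤-reflexive (sym (*-identityʳ (p ^ m))))
    (≤-trans (*-monoˡ (0≤^ m (≤-trans 0≤1 1≤p)) (1≤^ (n ∸ m) 1≤p))
      (≤-reflexive (trans (sym (^-+ p m (n ∸ m))) (cong (p ^_) (ℕ.m+[n∸m]≡n m≤n)))))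

  fromℕ-^ : ∀ m k → fromℕ (m ℕ.^ k) ≡ fromℕ m ^ k
  fromℕ-^ m zero    = refl
  fromℕ-^ m (suc k) = trans (fromℕ-* m (m ℕ.^ k)) (cong (fromℕ m *_) (fromℕ-^ m k))

  -- Assumed only for `ε ≥ -1`, because `growth-pow` applies it to a negative increment.
  bernoulli : ∀ ε n → 0ℚ ≤ 1ℚ + ε → 1ℚ + fromℕ n * ε ≤ (1ℚ + ε) ^ n
  bernoulli ε zero    0≤1+ε = ≤-reflexive (trans (cong (1ℚ +_) (*-zeroˡ ε)) (+-identityʳ 1ℚ))
  bernoulli ε (suc n) 0≤1+ε = ≤-trans
    (≤-by (fromℕ n * (ε * ε)) (0≤* (0≤fromℕ n) 0≤ε²)
      (trans (cong (λ k → 1ℚ + k * ε + fromℕ n * (ε * ε)) (fromℕ-suc n)) (expand ε (fromℕ n))))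
    (*-monoˡ 0≤1+ε (bernoulli ε n 0≤1+ε))
    where
    expand : ∀ ε k → 1ℚ + (1ℚ + k) * ε + k * (ε * ε) ≡ (1ℚ + ε) * (1ℚ + k * ε)
    expand = solve-∀ ℚ-ring
    0≤ε² : 0ℚ ≤ ε * ε
    0≤ε² with ≤-total 0ℚ ε
    ... | inj₁ 0≤ε = 0≤* 0≤ε 0≤ε
    ... | inj₂ ε≤0 = subst (0ℚ ≤_) (square ε) (0≤* (neg-antimono-≤ ε≤0) (neg-antimono-≤ ε≤0))
      where
      square : ∀ ε → - ε * - ε ≡ ε * ε
      square = solve-∀ ℚ-ring

  -- Turns a lower bound on one of the two powers into an upper bound on the other, in place of an
  -- exponential estimate.
  1-ε²-pow : ∀ {ε} n → 0ℚ ≤ ε → ε ≤ 1ℚ → (1ℚ - ε) ^ n * (1ℚ + ε) ^ n ≤ 1ℚ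
  1-ε²-pow {ε} n 0≤ε ε≤1 = ≤-trans (≤-reflexive (sym (^-distrib-* (1ℚ - ε) (1ℚ + ε) n)))
    (^≤1 n (0≤* (p≤q⇒0≤q-p ε≤1) (0≤+ 0≤1 0≤ε)) (≤-by (ε * ε) (0≤* 0≤ε 0≤ε) (expand ε)))
    where
    expand : ∀ ε → (1ℚ - ε) * (1ℚ + ε) + ε * ε ≡ 1ℚ
    expand = solve-∀ ℚ-ring

  -- For `ε = 1/m` Bernoulli gives `(1 + ε) ^ m ≥ 2`, and `(1 - ε) ^ m` is at most the inverse.
  decay-pow : ∀ {ε} m → 0ℚ ≤ ε → ε ≤ 1ℚ → fromℕ m * ε ≡ 1ℚ → fromℕ 2 * (1ℚ - ε) ^ m ≤ 1ℚ
  decay-pow {ε} m 0≤ε ε≤1 mε≡1 = ≤-trans (≤-reflexive (*-comm (fromℕ 2) ((1ℚ - ε) ^ m)))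
    (≤-trans (*-monoˡ (0≤^ m (p≤q⇒0≤q-p ε≤1)) (subst (λ z → 1ℚ + z ≤ (1ℚ + ε) ^ m) mε≡1 (bernoulli ε m (0≤+ 0≤1 0≤ε))))
      (1-ε²-pow m 0≤ε ε≤1))

  -- For `ε = 1/(2m)` Bernoulli with `-ε` gives `(1 - ε) ^ m ≥ 1/2`, and `(1 + ε) ^ m` is at most
  -- the inverse. The identity `double` avoids the division: its second summand vanishes because
  -- `2mε = 1`.
  growth-pow : ∀ {ε} m → 0ℚ ≤ ε → ε ≤ 1ℚ → fromℕ 2 * (fromℕ m * ε) ≡ 1ℚ → (1ℚ + ε) ^ m ≤ fromℕ 2
  growth-pow {ε} m 0≤ε ε≤1 2mε≡1 = begin
    (1ℚ + ε) ^ m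
      ≡⟨ double ((1ℚ + ε) ^ m) (fromℕ m * ε) ⟩
    fromℕ 2 * ((1ℚ - fromℕ m * ε) * (1ℚ + ε) ^ m) + (fromℕ 2 * (fromℕ m * ε) - 1ℚ) * (1ℚ + ε) ^ m
      ≡⟨ cong (λ z → fromℕ 2 * ((1ℚ - fromℕ m * ε) * (1ℚ + ε) ^ m) + (z - 1ℚ) * (1ℚ + ε) ^ m) 2mε≡1 ⟩
    fromℕ 2 * ((1ℚ - fromℕ m * ε) * (1ℚ + ε) ^ m) + (1ℚ - 1ℚ) * (1ℚ + ε) ^ m
      ≡⟨ trans (cong (fromℕ 2 * ((1ℚ - fromℕ m * ε) * (1ℚ + ε) ^ m) +_) (*-zeroˡ ((1ℚ + ε) ^ m))) (+-identityʳ (fromℕ 2 * ((1ℚ - fromℕ m * ε) * (1ℚ + ε) ^ m))) ⟩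
    fromℕ 2 * ((1ℚ - fromℕ m * ε) * (1ℚ + ε) ^ m)
      ≤⟨ *-monoˡ (0≤fromℕ 2) (*-monoʳ (0≤^ m (0≤+ 0≤1 0≤ε))
           (≤-trans (≤-reflexive (cong (1ℚ +_) (negate (fromℕ m) ε))) (bernoulli (- ε) m (p≤q⇒0≤q-p ε≤1)))) ⟩
    fromℕ 2 * ((1ℚ - ε) ^ m * (1ℚ + ε) ^ m)
      ≤⟨ *-monoˡ (0≤fromℕ 2) (1-ε²-pow m 0≤ε ε≤1) ⟩
    fromℕ 2 ∎
    where
    open ≤-Reasoning
    double : ∀ p q → p ≡ fromℕ 2 * ((1ℚ - q) * p) + (fromℕ 2 * q - 1ℚ) * p
    double = solve-∀ ℚ-ring
    negate : ∀ p q → - (p * q) ≡ p * - q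
    negate = solve-∀ ℚ-ring

  -- As `q ≤ 1/n ≤ 1`, further powers only decrease `q`. The upper tail can thus be stated with the
  -- exponent that the lower tail dictates.
  PolySmall-from-inverse : ∀ e-1 N {q} → 0ℚ ≤ q → fromℕ (2 ℕ.^ N) * q ≤ 1ℚ → PolySmall (suc e-1) N q
  PolySmall-from-inverse e-1 N {q} 0≤q nq≤1 = ≤-trans (*-monoˡ (0≤fromℕ (2 ℕ.^ N)) q^e≤q) nq≤1
    where
    q≤1 : q ≤ 1ℚ
    q≤1 = ≤-trans (≤-trans (≤-reflexive (sym (*-identityˡ q))) (*-monoʳ 0≤q (fromℕ-mono-≤ (ℕ.m^n>0 2 N)))) nq≤1
    q^e≤q : q ^ suc e-1 ≤ q
    q^e≤q = ≤-trans (*-monoˡ 0≤q (^≤1 e-1 0≤q q≤1)) (≤-reflexive (*-identityʳ q))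

  -- The number of rounds

  indicator-mono : ∀ {p q} {P : Set p} {Q : Set q} (P? : Dec P) (Q? : Dec Q) → (P → Q) →
    (if does P? then 1ℚ else 0ℚ) ≤ (if does Q? then 1ℚ else 0ℚ)
  indicator-mono (yes p) (yes q) P⇒Q = ≤-refl
  indicator-mono (yes p) (no ¬q) P⇒Q = ⊥-elim (¬q (P⇒Q p))
  indicator-mono (no ¬p) (yes q) P⇒Q = 0≤1
  indicator-mono (no ¬p) (no ¬q) P⇒Q = ≤-refl

  0≤indicator : ∀ {p} {P : Set p} (P? : Dec P) → 0ℚ ≤ (if does P? then 1ℚ else 0ℚ)
  0≤indicator (yes _) = 0≤1
  0≤indicator (no _)  = ≤-refl

  indicator≤1 : ∀ {p} {P : Set p} (P? : Dec P) → (if does P? then 1ℚ else 0ℚ) ≤ 1ℚ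
  indicator≤1 (yes _) = ≤-refl
  indicator≤1 (no _)  = 0≤1

  indicator-¬ : ∀ {p} {P : Set p} (P? : Dec P) →
    (if does P? then 1ℚ else 0ℚ) + (if does (¬? P?) then 1ℚ else 0ℚ) ≡ 1ℚ
  indicator-¬ (yes _) = refl
  indicator-¬ (no _)  = refl

  ℙ-mono : ∀ {p q} {P : Pred A p} {Q : Pred A q} {μ : Dist A} → Law μ → (P? : Decidable P) (Q? : Decidable Q) →
    (∀ x → P x → Q x) → ℙ μ P? ≤ ℙ μ Q?
  ℙ-mono law P? Q? P⇒Q = 𝔼-mono law λ x → indicator-mono (P? x) (Q? x) (P⇒Q x)

  0≤ℙ : ∀ {p} {P : Pred A p} {μ : Dist A} → Law μ → (P? : Decidable P) → 0ℚ ≤ ℙ μ P?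
  0≤ℙ law P? = ≤-trans (≤-reflexive (sym (𝔼-const law 0ℚ))) (𝔼-mono law λ x → 0≤indicator (P? x))

  ℙ≤1 : ∀ {p} {P : Pred A p} {μ : Dist A} → Law μ → (P? : Decidable P) → ℙ μ P? ≤ 1ℚ
  ℙ≤1 law P? = ≤-trans (𝔼-mono law λ x → indicator≤1 (P? x)) (≤-reflexive (𝔼-const law 1ℚ))

  ℙ-¬ : ∀ {p} {P : Pred A p} {μ : Dist A} → Law μ → (P? : Decidable P) → ℙ μ P? + ℙ μ (¬? ∘ P?) ≡ 1ℚ
  ℙ-¬ {μ = μ} law P? = trans (sym (𝔼-+ μ _ _)) (trans (𝔼-cong μ λ x → indicator-¬ (P? x)) (𝔼-const law 1ℚ))

  module Rounds {a ℓ₁ ℓ₂} (O : DecTotalOrder a ℓ₁ ℓ₂) (J : ℕ) (1≤J : 1 ℕ.≤ J) where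

    private
      N : ℕ
      N = suc J

    open Sorter O N

    round-Law : Law (q̃ N)
    round-Law = q̃-Law N (s≤s 1≤J)

    rounds-Law : ∀ t → Law (iid (q̃ N) t)
    rounds-Law = Law-iid round-Law

    0≤𝔼[T∧] : ∀ t x → 0ℚ ≤ 𝔼[T∧ t ] x
    0≤𝔼[T∧] t x = ≤-trans (≤-reflexive (sym (𝔼-const (rounds-Law t) 0ℚ)))
      (𝔼-mono (rounds-Law t) λ Ms → 0≤fromℕ (cappedRounds x Ms))

    module _ {t : ℕ} {x : Labelling} where

      𝔼[T∧suc]-sorted : Sorted x → 𝔼[T∧ suc t ] x ≡ 0ℚ
      𝔼[T∧suc]-sorted sorted = trans (𝔼-iid-suc (q̃ N) t (fromℕ ∘ cappedRounds x))
        (trans (𝔼-cong (q̃ N) λ M → trans (𝔼-cong (iid (q̃ N) t) λ Ms →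
            cong (λ b → fromℕ (if b then 0 else suc (cappedRounds (step x M) Ms))) (dec-true (sorted? x) sorted))
          (𝔼-const (rounds-Law t) 0ℚ)) (𝔼-const round-Law 0ℚ))

      𝔼[T∧suc]-unsorted : ¬ Sorted x → 𝔼[T∧ suc t ] x ≡ 1ℚ + 𝔼 (q̃ N) (λ M → 𝔼[T∧ t ] (step x M))
      𝔼[T∧suc]-unsorted unsorted = trans (𝔼-iid-suc (q̃ N) t (fromℕ ∘ cappedRounds x))
        (trans (𝔼-cong (q̃ N) λ M → trans (𝔼-cong (iid (q̃ N) t) λ Ms → trans
            (cong (λ b → fromℕ (if b then 0 else suc (cappedRounds (step x M) Ms))) (dec-false (sorted? x) unsorted))
            (fromℕ-suc (cappedRounds (step x M) Ms)))
          (trans (𝔼-+ (iid (q̃ N) t) (λ _ → 1ℚ) (fromℕ ∘ cappedRounds (step x M)))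
            (cong (_+ 𝔼[T∧ t ] (step x M)) (𝔼-const (rounds-Law t) 1ℚ))))
        (trans (𝔼-+ (q̃ N) (λ _ → 1ℚ) (λ M → 𝔼[T∧ t ] (step x M)))
          (cong (_+ 𝔼 (q̃ N) (λ M → 𝔼[T∧ t ] (step x M))) (𝔼-const round-Law 1ℚ))))

      ℙ[T>suc] : ℙ[T> suc t ] x ≤ 𝔼 (q̃ N) (λ M → ℙ[T> t ] (step x M))
      ℙ[T>suc] = ≤-trans (≤-reflexive (𝔼-iid-suc (q̃ N) t _)) (𝔼-mono round-Law λ M →
        ℙ-mono (rounds-Law t) (λ Ms → ¬? (sortedWithin? x (M ∷ Ms))) (¬? ∘ sortedWithin? (step x M)) λ Ms ¬within → ¬within ∘ inj₂)

      ℙ[T≤suc]-unsorted : ¬ Sorted x → ℙ[T≤ suc t ] x ≤ 𝔼 (q̃ N) (λ M → ℙ[T≤ t ] (step x M))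
      ℙ[T≤suc]-unsorted unsorted = ≤-trans (≤-reflexive (𝔼-iid-suc (q̃ N) t _)) (𝔼-mono round-Law λ M →
        ℙ-mono (rounds-Law t) (λ Ms → sortedWithin? x (M ∷ Ms)) (sortedWithin? (step x M)) λ where
          Ms (inj₁ sorted) → ⊥-elim (unsorted sorted)
          Ms (inj₂ within) → within)

    -- 1+Lρ≡L says that ρ = 1 - 1/L, so that L Φ bounds the expected number of rounds.
    module Contraction {p} (Inv : Pred Labelling p) (inv-step : ∀ {x} M → Inv x → Inv (step x M))
      (Φ : Labelling → ℚ) (0≤Φ : ∀ x → 0ℚ ≤ Φ x) (1≤Φ : ∀ {x} → Inv x → ¬ Sorted x → 1ℚ ≤ Φ x)
      (ρ L : ℚ) (0≤ρ : 0ℚ ≤ ρ) (0≤L : 0ℚ ≤ L) (1+Lρ≡L : 1ℚ + L * ρ ≡ L)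
      (contract : ∀ x → 𝔼 (q̃ N) (λ M → Φ (step x M)) ≤ ρ * Φ x) where

      private
        mono-inv : ∀ {x} {f g : Labelling → ℚ} → Inv x → (∀ {y} → Inv y → f y ≤ g y) →
          𝔼 (q̃ N) (λ M → f (step x M)) ≤ 𝔼 (q̃ N) (λ M → g (step x M))
        mono-inv inv f≤g = 𝔼-mono round-Law λ M → f≤g (inv-step M inv)

        shift-power : ∀ c s → c * ρ ^ s * ρ ≡ c * ρ ^ suc s
        shift-power c s = lemma c (ρ ^ s) ρ
          where
          lemma : ∀ c p r → c * p * r ≡ c * (r * p)
          lemma = solve-∀ ℚ-ring

      -- Markov's inequality unrolled over the rounds: `Φ` dominates the indicator of being
      -- unsorted, and `Inv` is carried along so that this domination is available at the last
      -- round.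
      tail : ∀ t {x} → Inv x → ℙ[T> t ] x ≤ ρ ^ t * Φ x
      tail zero {x} inv = ≤-trans (≤-reflexive (𝔼-pure [] (λ Ms → if does (¬? (sortedWithin? x Ms)) then 1ℚ else 0ℚ)))
        (≤-trans (unsorted-bound (sorted? x)) (≤-reflexive (sym (*-identityˡ (Φ x)))))
        where
        unsorted-bound : (S? : Dec (Sorted x)) → (if does (¬? S?) then 1ℚ else 0ℚ) ≤ Φ x
        unsorted-bound (yes _)       = 0≤Φ x
        unsorted-bound (no unsorted) = 1≤Φ inv unsorted
      tail (suc t) {x} inv = begin
        ℙ[T> suc t ] x                              ≤⟨ ℙ[T>suc] {t} {x} ⟩
        𝔼 (q̃ N) (λ M → ℙ[T> t ] (step x M))         ≤⟨ mono-inv {f = ℙ[T> t ]} {g = λ y → ρ ^ t * Φ y} inv (tail t) ⟩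
        𝔼 (q̃ N) (λ M → ρ ^ t * Φ (step x M))        ≡⟨ 𝔼-*ˡ (q̃ N) (ρ ^ t) (λ M → Φ (step x M)) ⟩
        ρ ^ t * 𝔼 (q̃ N) (λ M → Φ (step x M))        ≤⟨ *-monoˡ (0≤^ t 0≤ρ) (contract x) ⟩
        ρ ^ t * (ρ * Φ x)                           ≡⟨ lemma (ρ ^ t) ρ (Φ x) ⟩
        ρ ^ suc t * Φ x                             ∎
        where
        open ≤-Reasoning
        lemma : ∀ p r f → p * (r * f) ≡ r * p * f
        lemma = solve-∀ ℚ-ring

      -- While the list is unsorted, one round lowers the expectation of `L * Φ` by at least
      -- `Φ ≥ 1`, which pays for the round.
      expectation₀ : ∀ t {x} → Inv x → 𝔼[T∧ t ] x ≤ L * Φ x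
      expectation₀ zero    {x} inv = 0≤* 0≤L (0≤Φ x)
      expectation₀ (suc t) {x} inv = cases (sorted? x)
        where
        open ≤-Reasoning
        lemma : ∀ L r f → 1ℚ + L * (r * f) ≡ 1ℚ + (1ℚ + L * r) * f - f
        lemma = solve-∀ ℚ-ring
        swap : ∀ p q → 1ℚ + p - q + (q - 1ℚ) ≡ p
        swap = solve-∀ ℚ-ring
        cases : Dec (Sorted x) → 𝔼[T∧ suc t ] x ≤ L * Φ x
        cases (yes sorted)  = ≤-trans (≤-reflexive (𝔼[T∧suc]-sorted {t} sorted)) (0≤* 0≤L (0≤Φ x))
        cases (no unsorted) = begin
          𝔼[T∧ suc t ] x                                ≡⟨ 𝔼[T∧suc]-unsorted {t} unsorted ⟩
          1ℚ + 𝔼 (q̃ N) (λ M → 𝔼[T∧ t ] (step x M))      ≤⟨ +-monoʳ-≤ 1ℚ (mono-inv {f = 𝔼[T∧ t ]} {g = λ y → L * Φ y} inv (expectation₀ t)) ⟩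
          1ℚ + 𝔼 (q̃ N) (λ M → L * Φ (step x M))         ≡⟨ cong (1ℚ +_) (𝔼-*ˡ (q̃ N) L (λ M → Φ (step x M))) ⟩
          1ℚ + L * 𝔼 (q̃ N) (λ M → Φ (step x M))         ≤⟨ +-monoʳ-≤ 1ℚ (*-monoˡ 0≤L (contract x)) ⟩
          1ℚ + L * (ρ * Φ x)                            ≡⟨ lemma L ρ (Φ x) ⟩
          1ℚ + (1ℚ + L * ρ) * Φ x - Φ x                 ≡⟨ cong (λ z → 1ℚ + z * Φ x - Φ x) 1+Lρ≡L ⟩
          1ℚ + L * Φ x - Φ x                            ≤⟨ ≤-by (Φ x - 1ℚ) (p≤q⇒0≤q-p (1≤Φ inv unsorted)) (swap (L * Φ x) (Φ x)) ⟩
          L * Φ x                                       ∎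

      -- The bound `L * Φ` alone would cost a factor `n³`. Conceding `s` rounds first shrinks the
      -- potential by `ρ ^ s`, so an `s` of order `N²` is enough.
      expectation : ∀ s t {x} → Inv x → 𝔼[T∧ t ] x ≤ fromℕ s + L * ρ ^ s * Φ x
      expectation zero t {x} inv = ≤-trans (expectation₀ t inv)
        (≤-reflexive (sym (trans (+-identityˡ (L * 1ℚ * Φ x)) (cong (_* Φ x) (*-identityʳ L)))))
      expectation (suc s) t {x} inv = by-rounds t
        where
        open ≤-Reasoning
        0≤bound : 0ℚ ≤ fromℕ (suc s) + L * ρ ^ suc s * Φ x
        0≤bound = 0≤+ (0≤fromℕ (suc s)) (0≤* (0≤* 0≤L (0≤^ (suc s) 0≤ρ)) (0≤Φ x))
        cases : ∀ t → Dec (Sorted x) → 𝔼[T∧ suc t ] x ≤ fromℕ (suc s) + L * ρ ^ suc s * Φ x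
        cases t (yes sorted)  = ≤-trans (≤-reflexive (𝔼[T∧suc]-sorted {t} sorted)) 0≤bound
        cases t (no unsorted) = begin
          𝔼[T∧ suc t ] x
            ≡⟨ 𝔼[T∧suc]-unsorted {t} unsorted ⟩
          1ℚ + 𝔼 (q̃ N) (λ M → 𝔼[T∧ t ] (step x M))
            ≤⟨ +-monoʳ-≤ 1ℚ (mono-inv {f = 𝔼[T∧ t ]} {g = λ y → fromℕ s + L * ρ ^ s * Φ y} inv (expectation s t)) ⟩
          1ℚ + 𝔼 (q̃ N) (λ M → fromℕ s + L * ρ ^ s * Φ (step x M))
            ≡⟨ cong (1ℚ +_) (trans (𝔼-+ (q̃ N) (λ _ → fromℕ s) (λ M → L * ρ ^ s * Φ (step x M)))
                 (cong₂ _+_ (𝔼-const round-Law (fromℕ s)) (𝔼-*ˡ (q̃ N) (L * ρ ^ s) (λ M → Φ (step x M))))) ⟩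
          1ℚ + (fromℕ s + L * ρ ^ s * 𝔼 (q̃ N) (λ M → Φ (step x M)))
            ≤⟨ +-monoʳ-≤ 1ℚ (+-monoʳ-≤ (fromℕ s) (*-monoˡ (0≤* 0≤L (0≤^ s 0≤ρ)) (contract x))) ⟩
          1ℚ + (fromℕ s + L * ρ ^ s * (ρ * Φ x))
            ≡⟨ trans (sym (+-assoc 1ℚ (fromℕ s) _)) (cong₂ _+_ (sym (fromℕ-suc s))
                 (trans (sym (*-assoc (L * ρ ^ s) ρ (Φ x))) (cong (_* Φ x) (shift-power L s)))) ⟩
          fromℕ (suc s) + L * ρ ^ suc s * Φ x ∎
        by-rounds : ∀ t → 𝔼[T∧ t ] x ≤ fromℕ (suc s) + L * ρ ^ suc s * Φ x
        by-rounds zero    = 0≤bound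
        by-rounds (suc t) = cases t (sorted? x)

  -- The upper bounds

  module UpperBound {a ℓ₁ ℓ₂} (O : DecTotalOrder a ℓ₁ ℓ₂) (J : ℕ) (1≤J : 1 ℕ.≤ J) where

    private
      N n : ℕ
      N = suc J
      n = 2 ℕ.^ N

    open DecTotalOrder O using () renaming (_≤_ to _≼_; _≤?_ to _≼?_; reflexive to ≼-reflexive)
    open DecTotalOrder O using (module Eq)
    open Sorter O N
    open Threshold O N
    open Drift O J 1≤J
    open Rounds O J 1≤J

    unsorted-pair : ∀ {x} → ¬ Sorted x → ∃[ i ] ∃[ j ] i Fin.≤ j × ¬ x i ≼ x j
    unsorted-pair {x} unsorted
      with i , ¬i ← Fin.¬∀⟶∃¬ n (λ i → ∀ j → i Fin.≤ j → x i ≼ x j)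
                      (λ i → Fin.all? λ j → (i Fin.≤? j) →-dec (x i ≼? x j)) unsorted
      with j , ¬j ← Fin.¬∀⟶∃¬ n (λ j → i Fin.≤ j → x i ≼ x j)
                      (λ j → (i Fin.≤? j) →-dec (x i ≼? x j)) ¬i
      with i Fin.≤? j
    ... | yes i≤j = i , j , i≤j , λ xi≼xj → ¬j (λ _ → xi≼xj)
    ... | no  i≰j = ⊥-elim (¬j (λ i≤j → ⊥-elim (i≰j i≤j)))

    inversions≤n² : ∀ v x → inversions v x ≤ fromℕ (n ℕ.* n)
    inversions≤n² v x = begin
      inversions v x                          ≤⟨ ∑-mono n (λ j j<n → ∑-extend (λ i → inversionsAt v x i j) (λ i _ → 0≤inversionsAt v x i j) (ℕ.<⇒≤ j<n)) ⟩
      (∑[ j < n ] ∑[ i < n ] inversionsAt v x i j)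
                                              ≤⟨ ∑-mono n (λ j _ → ∑-mono n λ i _ → at-most-one (x (pos N i)) (x (pos N j))) ⟩
      (∑[ j < n ] ∑[ i < n ] 1ℚ)              ≡⟨ trans (∑-cong n λ j _ → ∑-const n 1ℚ) (∑-const n (fromℕ n * 1ℚ)) ⟩
      fromℕ n * (fromℕ n * 1ℚ)                ≡⟨ cong (fromℕ n *_) (*-identityʳ (fromℕ n)) ⟩
      fromℕ n * fromℕ n                       ≡⟨ fromℕ-* n n ⟨
      fromℕ (n ℕ.* n)                         ∎
      where
      open ≤-Reasoning
      at-most-one : ∀ c d → inverted v c d ≤ 1ℚ
      at-most-one c d = *-mono-≤ (p≤q⇒0≤q-p (above≤1 v d)) 0≤1 (above≤1 v c)
        (≤-by (above v d) (0≤above v d) (lemma (above v d)))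
        where
        lemma : ∀ p → 1ℚ - p + p ≡ 1ℚ
        lemma = solve-∀ ℚ-ring

    module _ (y : Labelling) where

      -- The thresholds are the entries of the initial list `y`, one for each position, with
      -- repetitions. They stay fixed during the run, and `ValuesOf` keeps every current label among
      -- them.
      Φ : Labelling → ℚ
      Φ x = ∑[ k < n ] inversions (y (pos N k)) x

      ValuesOf : Labelling → Set a
      ValuesOf x = ∀ i → ∃[ k ] x i ≡ y k

      values-sortPair : ∀ {x} p → ValuesOf x → ValuesOf (sortPair x p)
      values-sortPair {x} (i , j) vals with sortPair-cases i j x
      ... | inj₁ eq        = subst ValuesOf (sym eq) vals
      ... | inj₂ (inj₁ eq) = subst ValuesOf (sym eq) (vals ∘ transpose i j)
      ... | inj₂ (inj₂ eq) = subst ValuesOf (sym eq) (vals ∘ transpose j i)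

      values-step : ∀ {x} M → ValuesOf x → ValuesOf (step x M)
      values-step []      vals = vals
      values-step (p ∷ M) vals = values-step M (values-sortPair p vals)

      0≤Φ : ∀ x → 0ℚ ≤ Φ x
      0≤Φ x = 0≤∑ n λ k _ → 0≤inversions (y (pos N k)) x

      -- For a pair out of order, the threshold at the label of its right endpoint separates the two
      -- labels, so this pair alone contributes 1.
      1≤Φ : ∀ {x} → ValuesOf x → ¬ Sorted x → 1ℚ ≤ Φ x
      1≤Φ {x} vals unsorted
        with i , j , i≤j , xi⋠xj ← unsorted-pair unsorted
        with k , xj≡yk ← vals j = begin
          1ℚ                                           ≡⟨ is-inverted ⟨
          inverted (y k) (x i) (x j)                   ≡⟨ cong₂ (λ i j → inverted (y k) (x i) (x j)) (pos-toℕ N i) (pos-toℕ N j) ⟨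
          inversionsAt (y k) x (toℕ i) (toℕ j)         ≤⟨ ∑-term (λ i′ → inversionsAt (y k) x i′ (toℕ j)) (λ i′ _ → 0≤inversionsAt (y k) x i′ (toℕ j)) i<j ⟩
          (∑[ i′ < toℕ j ] inversionsAt (y k) x i′ (toℕ j))
                                                       ≤⟨ ∑-term (λ j′ → ∑[ i′ < j′ ] inversionsAt (y k) x i′ j′) (λ j′ _ → 0≤∑ j′ λ i′ _ → 0≤inversionsAt (y k) x i′ j′) (Fin.toℕ<n j) ⟩
          inversions (y k) x                           ≡⟨ cong (λ k → inversions (y k) x) (pos-toℕ N k) ⟨
          inversions (y (pos N (toℕ k))) x             ≤⟨ ∑-term (λ k → inversions (y (pos N k)) x) (λ k _ → 0≤inversions (y (pos N k)) x) (Fin.toℕ<n k) ⟩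
          Φ x                                          ∎
        where
        open ≤-Reasoning
        i<j : toℕ i ℕ.< toℕ j
        i<j = ℕ.≤∧≢⇒< i≤j λ eq → xi⋠xj (≼-reflexive (Eq.reflexive (cong x (Fin.toℕ-injective eq))))
        is-inverted : inverted (y k) (x i) (x j) ≡ 1ℚ
        is-inverted with above-cases (y k) (x i) | above-cases (y k) (x j)
        ... | inj₁ (xi≼yk , _) | _                = ⊥-elim (xi⋠xj (subst (x i ≼_) (sym xj≡yk) xi≼yk))
        ... | inj₂ _           | inj₂ (xj⋠yk , _) = ⊥-elim (xj⋠yk (≼-reflexive (Eq.reflexive xj≡yk)))
        ... | inj₂ (_ , eq)    | inj₁ (_ , eq′)   = cong₂ (λ p q → p * (1ℚ - q)) eq eq′

      ε ρ L : ℚ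
      ε = recip J * recip 3
      ρ = 1ℚ - ε
      L = fromℕ (4 ℕ.* N)

      Lε≡1 : L * ε ≡ 1ℚ
      Lε≡1 = trans (cong (_* ε) (fromℕ-* 4 N)) (trans (regroup (fromℕ 4) (fromℕ N) (recip J) (recip 3))
        (trans (cong₂ _*_ (recip-*ˡ J) (recip-*ˡ 3)) (*-identityˡ 1ℚ)))
        where
        regroup : ∀ a b c d → a * b * (c * d) ≡ b * c * (a * d)
        regroup = solve-∀ ℚ-ring

      0≤ε : 0ℚ ≤ ε
      0≤ε = 0≤* (0≤recip J) (0≤recip 3)

      ε≤1 : ε ≤ 1ℚ
      ε≤1 = ≤-trans (≤-reflexive (sym (*-identityˡ ε)))
        (≤-trans (*-monoʳ 0≤ε (fromℕ-mono-≤ {1} {4 ℕ.* N} (s≤s z≤n))) (≤-reflexive Lε≡1))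

      0≤ρ : 0ℚ ≤ ρ
      0≤ρ = p≤q⇒0≤q-p ε≤1

      ρ≤1 : ρ ≤ 1ℚ
      ρ≤1 = ≤-by ε 0≤ε (lemma ε)
        where
        lemma : ∀ p → 1ℚ - p + p ≡ 1ℚ
        lemma = solve-∀ ℚ-ring

      1+Lρ≡L : 1ℚ + L * ρ ≡ L
      1+Lρ≡L = trans (expand L ε) (trans (cong (λ z → 1ℚ + L - z) Lε≡1) (cancel L))
        where
        expand : ∀ L e → 1ℚ + L * (1ℚ - e) ≡ 1ℚ + L - L * e
        expand = solve-∀ ℚ-ring
        cancel : ∀ L → 1ℚ + L - 1ℚ ≡ L
        cancel = solve-∀ ℚ-ring

      Φ-contract : ∀ x → 𝔼 (q̃ N) (λ M → Φ (step x M)) ≤ ρ * Φ x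
      Φ-contract x = ≤-trans (≤-reflexive (𝔼-∑ (q̃ N) n (λ k M → inversions (y (pos N k)) (step x M))))
        (≤-trans (∑-mono n λ k _ → inversions-contract (y (pos N k)) x)
          (≤-reflexive (∑-*ˡ n ρ (λ k → inversions (y (pos N k)) x))))

      open Contraction ValuesOf values-step Φ 0≤Φ 1≤Φ ρ L 0≤ρ (0≤fromℕ (4 ℕ.* N)) 1+Lρ≡L Φ-contract public

      Φ≤n³ : ∀ x → Φ x ≤ fromℕ (2 ℕ.^ (3 ℕ.* N))
      Φ≤n³ x = ≤-trans (∑-mono n λ k _ → inversions≤n² (y (pos N k)) x)
        (≤-reflexive (trans (∑-const n (fromℕ (n ℕ.* n))) (trans (sym (fromℕ-* n (n ℕ.* n))) (cong fromℕ cube))))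
        where
        cube : n ℕ.* (n ℕ.* n) ≡ 2 ℕ.^ (3 ℕ.* N)
        cube = sym (trans (cong (2 ℕ.^_) (ℕ.*-comm 3 N)) (trans (sym (ℕ.^-*-assoc 2 N 3))
          (cong (λ z → n ℕ.* (n ℕ.* z)) (ℕ.*-identityʳ n))))

      -- `L = 4N` rounds halve the potential, and `4N` halvings bring it down by `n⁴`: a factor `n³`
      -- for its initial size and one `n` left for the failure probability.
      threshold : ℕ
      threshold = 4 ℕ.* N ℕ.* (4 ℕ.* N)

      ρ-decay : fromℕ (2 ℕ.^ (4 ℕ.* N)) * ρ ^ threshold ≤ 1ℚ
      ρ-decay = ≤-trans (≤-reflexive (trans
          (cong₂ _*_ (fromℕ-^ 2 (4 ℕ.* N)) (^-* ρ (4 ℕ.* N) (4 ℕ.* N)))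
          (sym (^-distrib-* (fromℕ 2) (ρ ^ (4 ℕ.* N)) (4 ℕ.* N)))))
        (^≤1 (4 ℕ.* N) (0≤* (0≤fromℕ 2) (0≤^ (4 ℕ.* N) 0≤ρ)) (decay-pow (4 ℕ.* N) 0≤ε ε≤1 Lε≡1))

      Φ-decay : ∀ x → fromℕ n * (ρ ^ threshold * Φ x) ≤ 1ℚ
      Φ-decay x = ≤-trans (≤-reflexive (regroup (fromℕ n) (ρ ^ threshold) (Φ x)))
        (≤-trans (*-monoʳ (0≤^ threshold 0≤ρ) (≤-trans (*-monoˡ (0≤fromℕ n) (Φ≤n³ x))
            (≤-reflexive (trans (sym (fromℕ-* n (2 ℕ.^ (3 ℕ.* N)))) (cong fromℕ (sym (ℕ.^-distribˡ-+-* 2 N (3 ℕ.* N))))))))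
          ρ-decay)
        where
        regroup : ∀ a b c → a * (b * c) ≡ a * c * b
        regroup = solve-∀ ℚ-ring

      values-self : ValuesOf y
      values-self i = i , refl

    tail-bound : ∀ x t → 16 ℕ.* (N ℕ.* N) ℕ.≤ t → fromℕ n * ℙ[T> t ] x ≤ 1ℚ
    tail-bound x t 16N²≤t = begin
      fromℕ n * ℙ[T> t ] x                          ≤⟨ *-monoˡ (0≤fromℕ n) (tail x t (values-self x)) ⟩
      fromℕ n * (ρ x ^ t * Φ x x)                   ≤⟨ *-monoˡ (0≤fromℕ n) (*-monoʳ (0≤Φ x x)
                                                         (^-antimono-exponent (0≤ρ x) (ρ≤1 x) (subst (ℕ._≤ t) (sym (square N)) 16N²≤t))) ⟩
      fromℕ n * (ρ x ^ threshold x * Φ x x)         ≤⟨ Φ-decay x x ⟩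
      1ℚ                                            ∎
      where
      open ≤-Reasoning
      square : ∀ N → 4 ℕ.* N ℕ.* (4 ℕ.* N) ≡ 16 ℕ.* (N ℕ.* N)
      square = ℕSolver.solve-∀

    -- `16N²` rounds bring the potential to at most 1, and `L = 4N ≤ 4N²` further rounds are
    -- expected from there; hence the constant 20.
    expectation-bound : ∀ x → 𝔼[T]≤ x (fromℕ 20 * lg² N)
    expectation-bound x t = begin
      𝔼[T∧ t ] x
        ≤⟨ expectation x s t (values-self x) ⟩
      fromℕ s + L x * ρ x ^ s * Φ x x
        ≡⟨ cong (fromℕ s +_) (*-assoc (L x) (ρ x ^ s) (Φ x x)) ⟩
      fromℕ s + L x * (ρ x ^ s * Φ x x)
        ≤⟨ +-monoʳ-≤ (fromℕ s) (≤-trans (*-monoˡ (0≤fromℕ (4 ℕ.* N)) ≤1) (≤-reflexive (*-identityʳ (L x)))) ⟩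
      fromℕ s + fromℕ (4 ℕ.* N)
        ≡⟨ fromℕ-+ s (4 ℕ.* N) ⟨
      fromℕ (s ℕ.+ 4 ℕ.* N)
        ≤⟨ fromℕ-mono-≤ (ℕ.≤-trans (ℕ.+-monoʳ-≤ s (ℕ.*-monoʳ-≤ 4 (ℕ.m≤m*n N N))) (ℕ.≤-reflexive (total N))) ⟩
      fromℕ (20 ℕ.* (N ℕ.* N))
        ≡⟨ fromℕ-* 20 (N ℕ.* N) ⟩
      fromℕ 20 * lg² N ∎
      where
      open ≤-Reasoning
      s : ℕ
      s = threshold x
      total : ∀ N → 4 ℕ.* N ℕ.* (4 ℕ.* N) ℕ.+ 4 ℕ.* (N ℕ.* N) ≡ 20 ℕ.* (N ℕ.* N)
      total = ℕSolver.solve-∀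
      ≤1 : ρ x ^ s * Φ x x ≤ 1ℚ
      ≤1 = ≤-trans (≤-reflexive (sym (*-identityˡ (ρ x ^ s * Φ x x))))
        (≤-trans (*-monoʳ (0≤* (0≤^ s (0≤ρ x)) (0≤Φ x x)) (fromℕ-mono-≤ (ℕ.m^n>0 2 N))) (Φ-decay x x))

    tail-small : ∀ x t → fromℕ 20 * lg² N ≤ fromℕ t → PolySmall 16 N (ℙ[T> t ] x)
    tail-small x t 20N²≤t = PolySmall-from-inverse 15 N (0≤ℙ (rounds-Law t) (¬? ∘ sortedWithin? x))
      (tail-bound x t (ℕ.≤-trans (ℕ.*-monoˡ-≤ (N ℕ.* N) (ℕ.m≤m+n 16 4))
        (fromℕ-cancel-≤ (≤-trans (≤-reflexive (fromℕ-* 20 (N ℕ.* N))) 20N²≤t))))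

  -- The profile of the lower-bound potential

  -- profile h = ∏_{i ≤ h} (2i-1)/(2i), the coefficient of z^h in (1-z)^{-1/2}, of
  -- order h^{-1/2}.  Convolving with 1/d, the coefficients of -log(1-z), gives
  -- the coefficients of -log(1-z)(1-z)^{-1/2}, which are explicit.
  profile : ℕ → ℚ
  profile zero    = 1ℚ
  profile (suc h) = fromℕ (2 ℕ.* h ℕ.+ 1) * (recip (2 ℕ.* h ℕ.+ 1) * profile h)

  odd : ∀ h → fromℕ (2 ℕ.* h ℕ.+ 1) ≡ fromℕ 2 * fromℕ h + 1ℚ
  odd h = trans (fromℕ-+ (2 ℕ.* h) 1) (cong (_+ 1ℚ) (fromℕ-* 2 h))

  even : ∀ h → fromℕ (suc (2 ℕ.* h ℕ.+ 1)) ≡ fromℕ 2 * fromℕ (suc h)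
  even h = trans (cong fromℕ (lemma h)) (fromℕ-* 2 (suc h))
    where
    lemma : ∀ h → suc (2 ℕ.* h ℕ.+ 1) ≡ 2 ℕ.* suc h
    lemma = ℕSolver.solve-∀

  profile-suc : ∀ h → fromℕ 2 * fromℕ (suc h) * profile (suc h) ≡ (fromℕ 2 * fromℕ h + 1ℚ) * profile h
  profile-suc h = begin
    fromℕ 2 * fromℕ (suc h) * (o * (r * profile h))               ≡⟨ cong (_* (o * (r * profile h))) (even h) ⟨
    fromℕ (suc (2 ℕ.* h ℕ.+ 1)) * (o * (r * profile h))           ≡⟨ regroup (fromℕ (suc (2 ℕ.* h ℕ.+ 1))) o r (profile h) ⟩
    fromℕ (suc (2 ℕ.* h ℕ.+ 1)) * r * (o * profile h)             ≡⟨ cong (_* (o * profile h)) (recip-*ˡ (2 ℕ.* h ℕ.+ 1)) ⟩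
    1ℚ * (o * profile h)                                          ≡⟨ *-identityˡ (o * profile h) ⟩
    o * profile h                                                 ≡⟨ cong (_* profile h) (odd h) ⟩
    (fromℕ 2 * fromℕ h + 1ℚ) * profile h                          ∎
    where
    open ≡-Reasoning
    o r : ℚ
    o = fromℕ (2 ℕ.* h ℕ.+ 1)
    r = recip (2 ℕ.* h ℕ.+ 1)
    regroup : ∀ a b c d → a * (b * (c * d)) ≡ a * c * (b * d)
    regroup = solve-∀ ℚ-ring

  0≤profile : ∀ h → 0ℚ ≤ profile h
  0≤profile zero    = 0≤1
  0≤profile (suc h) = 0≤* (0≤fromℕ (2 ℕ.* h ℕ.+ 1)) (0≤* (0≤recip (2 ℕ.* h ℕ.+ 1)) (0≤profile h))

  0<2* : ∀ h → 0ℚ < fromℕ 2 * fromℕ (suc h)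
  0<2* h = subst (0ℚ <_) (even h) (0<fromℕ-suc (2 ℕ.* h ℕ.+ 1))

  profile-step : ∀ h → profile (suc h) ≤ profile h
  profile-step h = *-cancelˡ-≤ (0<2* h) (≤-trans (≤-reflexive (profile-suc h))
    (*-monoʳ (0≤profile h) (≤-by {p = fromℕ 2 * fromℕ h + 1ℚ} 1ℚ 0≤1 (trans (lemma (fromℕ h)) (cong (fromℕ 2 *_) (sym (fromℕ-suc h)))))))
    where
    lemma : ∀ k → fromℕ 2 * k + 1ℚ + 1ℚ ≡ fromℕ 2 * (1ℚ + k)
    lemma = solve-∀ ℚ-ring

  profile-antimono : ∀ {i j} → i ℕ.≤ j → profile j ≤ profile i
  profile-antimono {i} {j} i≤j = subst (λ m → profile m ≤ profile i) (ℕ.m+[n∸m]≡n i≤j) (go (j ∸ i))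
    where
    go : ∀ d → profile (i ℕ.+ d) ≤ profile i
    go zero    = ≤-reflexive (cong profile (ℕ.+-identityʳ i))
    go (suc d) = ≤-trans (≤-reflexive (cong profile (ℕ.+-suc i d))) (≤-trans (profile-step (i ℕ.+ d)) (go d))

  -- The squared form of `profile h ≤ (h+1)^(-1/2)`. The induction rests on
  -- `(h+2)(2h+1)² ≤ 4(h+1)³`, where the sides differ by `3h + 2`.
  profile-square : ∀ h → fromℕ (suc h) * (profile h * profile h) ≤ 1ℚ
  profile-square zero    = ≤-refl
  profile-square (suc h) = *-cancelˡ-≤ {r = d * d} (0<d²) (begin
    d * d * (fromℕ (suc (suc h)) * (g′ * g′))               ≡⟨ regroup d (fromℕ (suc (suc h))) g′ ⟩
    fromℕ (suc (suc h)) * ((d * g′) * (d * g′))             ≡⟨ cong₂ (λ p q → p * (q * q)) (trans (fromℕ-suc (suc h)) (cong (1ℚ +_) (fromℕ-suc h))) (profile-suc h) ⟩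
    (1ℚ + (1ℚ + k)) * (((fromℕ 2 * k + 1ℚ) * g) * ((fromℕ 2 * k + 1ℚ) * g))
                                                            ≤⟨ ≤-by ((fromℕ 3 * k + fromℕ 2) * (g * g))
                                                                 (0≤* (0≤+ (0≤* (0≤fromℕ 3) (0≤fromℕ h)) (0≤fromℕ 2)) (0≤* (0≤profile h) (0≤profile h)))
                                                                 (expand k g) ⟩
    (fromℕ 2 * (1ℚ + k)) * (fromℕ 2 * (1ℚ + k)) * ((1ℚ + k) * (g * g))
                                                            ≡⟨ cong (λ z → (fromℕ 2 * z) * (fromℕ 2 * z) * (z * (g * g))) (fromℕ-suc h) ⟨
    d * d * (fromℕ (suc h) * (g * g))                       ≤⟨ *-monoˡ (<⇒≤ 0<d²) (profile-square h) ⟩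
    d * d * 1ℚ                                              ∎)
    where
    open ≤-Reasoning
    d g g′ k : ℚ
    d = fromℕ 2 * fromℕ (suc h)
    g = profile h
    g′ = profile (suc h)
    k = fromℕ h
    0<d² : 0ℚ < d * d
    0<d² = subst (_< d * d) (*-zeroʳ d) (*-monoʳ-<-pos d {{positive (0<2* h)}} (0<2* h))
    regroup : ∀ d s g → d * d * (s * (g * g)) ≡ s * ((d * g) * (d * g))
    regroup = solve-∀ ℚ-ring
    expand : ∀ k g → (1ℚ + (1ℚ + k)) * (((fromℕ 2 * k + 1ℚ) * g) * ((fromℕ 2 * k + 1ℚ) * g)) + (fromℕ 3 * k + fromℕ 2) * (g * g) ≡
      (fromℕ 2 * (1ℚ + k)) * (fromℕ 2 * (1ℚ + k)) * ((1ℚ + k) * (g * g))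
    expand = solve-∀ ℚ-ring

  convolution : ℕ → ℚ
  convolution h = ∑[ i < h ] profile i * recip (h ∸ suc i)

  telescope : ∀ h (f : ℕ → ℚ) → ∑[ i < h ] (f (suc i) - f i) ≡ f h - f 0
  telescope zero    f = sym (+-inverseʳ (f 0))
  telescope (suc h) f = trans (cong (f 1 - f 0 +_) (telescope h (f ∘ suc))) (lemma (f 0) (f 1) (f (suc h)))
    where
    lemma : ∀ a b c → b - a + (c - b) ≡ c - a
    lemma = solve-∀ ℚ-ring

  -- Coefficient form of `(1-z) F′ = (1-z)^(-1/2) + F/2` for `F = -log(1-z) (1-z)^(-1/2)`.
  convolution-suc : ∀ h → fromℕ 2 * fromℕ (suc h) * convolution (suc h) ≡
    (fromℕ 2 * fromℕ h + 1ℚ) * convolution h + fromℕ 2 * profile h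
  convolution-suc h = begin
    d * (1ℚ * recip h + (∑[ k < h ] profile (suc k) * recip (h ∸ suc k)))
      ≡⟨ trans (*-distribˡ-+ d _ _) (cong₂ _+_ first (sym (∑-*ˡ h d _))) ⟩
    fromℕ 2 + (∑[ k < h ] d * (profile (suc k) * recip (h ∸ suc k)))
      ≡⟨ cong (fromℕ 2 +_) (∑-cong h term) ⟩
    fromℕ 2 + (∑[ k < h ] (fromℕ 2 * (profile (suc k) - profile k) + o * (profile k * recip (h ∸ suc k))))
      ≡⟨ cong (fromℕ 2 +_) (trans (∑-distrib-+ h _ _) (cong₂ _+_
           (trans (∑-*ˡ h (fromℕ 2) _) (cong (fromℕ 2 *_) (telescope h profile))) (∑-*ˡ h o _))) ⟩
    fromℕ 2 + (fromℕ 2 * (profile h - 1ℚ) + o * convolution h)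
      ≡⟨ collect (profile h) (o * convolution h) ⟩
    o * convolution h + fromℕ 2 * profile h ∎
    where
    open ≡-Reasoning
    d o : ℚ
    d = fromℕ 2 * fromℕ (suc h)
    o = fromℕ 2 * fromℕ h + 1ℚ
    first : d * (1ℚ * recip h) ≡ fromℕ 2
    first = trans (lemma (fromℕ 2) (fromℕ (suc h)) (recip h)) (trans (cong (fromℕ 2 *_) (recip-*ˡ h)) (*-identityʳ (fromℕ 2)))
      where
      lemma : ∀ a b c → a * b * (1ℚ * c) ≡ a * (b * c)
      lemma = solve-∀ ℚ-ring
    collect : ∀ p q → fromℕ 2 + (fromℕ 2 * (p - 1ℚ) + q) ≡ q + fromℕ 2 * p
    collect = solve-∀ ℚ-ring
    term : ∀ k → k ℕ.< h → d * (profile (suc k) * recip (h ∸ suc k)) ≡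
      fromℕ 2 * (profile (suc k) - profile k) + o * (profile k * recip (h ∸ suc k))
    term k k<h = begin
      fromℕ 2 * fromℕ (suc h) * (g′ * r)
        -- Split `h + 1` as `(k + 1) + e` with `e = h - k`: the first part meets the recurrence of
        -- the profile, the second cancels the reciprocal and leaves a telescoping sum.
        ≡⟨ cong (λ z → fromℕ 2 * z * (g′ * r)) suc-h≡ ⟩
      fromℕ 2 * (fromℕ (suc k) + e) * (g′ * r)
        ≡⟨ split (fromℕ (suc k)) e g′ r ⟩
      fromℕ 2 * fromℕ (suc k) * g′ * r + fromℕ 2 * g′ * (e * r)
        ≡⟨ cong₂ (λ p q → p * r + fromℕ 2 * g′ * q) (profile-suc k) er≡1 ⟩
      (fromℕ 2 * fromℕ k + 1ℚ) * g * r + fromℕ 2 * g′ * 1ℚ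
        ≡⟨ add-cancel (fromℕ k) g g′ r e ⟩
      fromℕ 2 * (g′ - g * (e * r)) + (fromℕ 2 * (fromℕ k + e) + 1ℚ) * (g * r)
        ≡⟨ cong₂ (λ p q → fromℕ 2 * (g′ - p) + (fromℕ 2 * q + 1ℚ) * (g * r))
             (trans (cong (g *_) er≡1) (*-identityʳ g)) (sym h≡) ⟩
      fromℕ 2 * (g′ - g) + o * (g * r) ∎
      where
      g g′ r e : ℚ
      g = profile k
      g′ = profile (suc k)
      r = recip (h ∸ suc k)
      e = fromℕ (suc (h ∸ suc k))
      er≡1 : e * r ≡ 1ℚ
      er≡1 = recip-*ˡ (h ∸ suc k)
      h≡ : fromℕ h ≡ fromℕ k + e
      h≡ = trans (cong fromℕ (sym (trans (ℕ.+-suc k (h ∸ suc k)) (ℕ.m+[n∸m]≡n k<h)))) (fromℕ-+ k (suc (h ∸ suc k)))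
      suc-h≡ : fromℕ (suc h) ≡ fromℕ (suc k) + e
      suc-h≡ = trans (fromℕ-suc h) (trans (cong (1ℚ +_) h≡) (trans (sym (+-assoc 1ℚ (fromℕ k) e)) (cong (_+ e) (sym (fromℕ-suc k)))))
      split : ∀ k e g r → fromℕ 2 * (k + e) * (g * r) ≡ fromℕ 2 * k * g * r + fromℕ 2 * g * (e * r)
      split = solve-∀ ℚ-ring
      add-cancel : ∀ k g g′ r e → (fromℕ 2 * k + 1ℚ) * g * r + fromℕ 2 * g′ * 1ℚ ≡
        fromℕ 2 * (g′ - g * (e * r)) + (fromℕ 2 * (k + e) + 1ℚ) * (g * r)
      add-cancel = solve-∀ ℚ-ring

  -- `2/1 + 2/3 + ... + 2/(2h-1)`.
  oddHarmonic : ℕ → ℚ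
  oddHarmonic h = ∑[ i < h ] fromℕ 2 * recip (2 ℕ.* i)

  -- Divided by the recurrence of the profile, the recurrence of the convolution says that the
  -- quotient of the two grows by `2/(2h+1)` at each step.
  convolution-value : ∀ h → convolution h ≡ profile h * oddHarmonic h
  convolution-value zero    = refl
  convolution-value (suc h) = *-cancelˡ-≡ {r = fromℕ 2 * fromℕ (suc h)} (0<2* h) (begin
    fromℕ 2 * fromℕ (suc h) * convolution (suc h)
      ≡⟨ convolution-suc h ⟩
    o * convolution h + fromℕ 2 * profile h
      ≡⟨ cong₂ (λ p q → o * p + fromℕ 2 * q) (convolution-value h) (trans (sym (*-identityˡ (profile h))) (cong (_* profile h) (sym o*r≡1))) ⟩
    o * (profile h * oddHarmonic h) + fromℕ 2 * (o * r * profile h)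
      ≡⟨ regroup o (profile h) (oddHarmonic h) r ⟩
    o * profile h * (oddHarmonic h + fromℕ 2 * r)
      ≡⟨ cong₂ _*_ (profile-suc h) (∑-last h (λ i → fromℕ 2 * recip (2 ℕ.* i))) ⟨
    fromℕ 2 * fromℕ (suc h) * profile (suc h) * oddHarmonic (suc h)
      ≡⟨ *-assoc (fromℕ 2 * fromℕ (suc h)) (profile (suc h)) (oddHarmonic (suc h)) ⟩
    fromℕ 2 * fromℕ (suc h) * (profile (suc h) * oddHarmonic (suc h)) ∎)
    where
    open ≡-Reasoning
    o r : ℚ
    o = fromℕ 2 * fromℕ h + 1ℚ
    r = recip (2 ℕ.* h)
    o*r≡1 : o * r ≡ 1ℚ
    o*r≡1 = trans (cong (_* r) (trans (sym (odd h)) (cong fromℕ (ℕ.+-comm (2 ℕ.* h) 1)))) (recip-*ˡ (2 ℕ.* h))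
    regroup : ∀ o p b r → o * (p * b) + fromℕ 2 * (o * r * p) ≡ o * p * (b + fromℕ 2 * r)
    regroup = solve-∀ ℚ-ring

  -- The excess over the harmonic sum tends to `2 log 2`, so a constant must suffice. The correction
  -- `- 2/(h+1)` makes the induction close: the step is `2/(2h+1) - 1/(h+1) ≤ 2/(h+1) - 2/(h+2)`.
  oddHarmonic-excess : ∀ h → oddHarmonic h ≤ (∑[ i < h ] recip i) + fromℕ 2 - fromℕ 2 * recip h
  oddHarmonic-excess zero    = ≤-refl
  oddHarmonic-excess (suc h) = begin
    oddHarmonic (suc h)
      ≡⟨ ∑-last h (λ i → fromℕ 2 * recip (2 ℕ.* i)) ⟩
    oddHarmonic h + fromℕ 2 * rₚ
      ≤⟨ +-monoˡ-≤ (fromℕ 2 * rₚ) (oddHarmonic-excess h) ⟩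
    (∑[ i < h ] recip i) + fromℕ 2 - fromℕ 2 * rₛ + fromℕ 2 * rₚ
      ≤⟨ ≤-by (fromℕ 3 * rₛ - (fromℕ 2 * rₚ + fromℕ 2 * r_q)) (p≤q⇒0≤q-p three) (regroup (∑[ i < h ] recip i) rₛ rₚ r_q) ⟩
    (∑[ i < h ] recip i) + rₛ + fromℕ 2 - fromℕ 2 * r_q
      ≡⟨ cong (λ z → z + fromℕ 2 - fromℕ 2 * r_q) (∑-last h recip) ⟨
    (∑[ i < suc h ] recip i) + fromℕ 2 - fromℕ 2 * r_q ∎
    where
    open ≤-Reasoning
    k p q s rₚ r_q rₛ : ℚ
    k = fromℕ h
    p = fromℕ (suc (2 ℕ.* h))
    q = fromℕ (suc (suc h))
    s = fromℕ (suc h)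
    rₚ = recip (2 ℕ.* h)
    r_q = recip (suc h)
    rₛ = recip h
    p≡ : p ≡ 1ℚ + fromℕ 2 * k
    p≡ = trans (fromℕ-suc (2 ℕ.* h)) (cong (1ℚ +_) (fromℕ-* 2 h))
    s≡ : s ≡ 1ℚ + k
    s≡ = fromℕ-suc h
    q≡ : q ≡ 1ℚ + (1ℚ + k)
    q≡ = trans (fromℕ-suc (suc h)) (cong (1ℚ +_) s≡)
    0<pqs : 0ℚ < fromℕ (suc (2 ℕ.* h) ℕ.* (suc (suc h) ℕ.* suc h))
    0<pqs = fromℕ-mono-< {0} {suc (2 ℕ.* h) ℕ.* (suc (suc h) ℕ.* suc h)} (s≤s z≤n)
    pqs≡ : fromℕ (suc (2 ℕ.* h) ℕ.* (suc (suc h) ℕ.* suc h)) ≡ p * (q * s)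
    pqs≡ = trans (fromℕ-* (suc (2 ℕ.* h)) (suc (suc h) ℕ.* suc h)) (cong (p *_) (fromℕ-* (suc (suc h)) (suc h)))
    regroup : ∀ H a b c → H + fromℕ 2 - fromℕ 2 * a + fromℕ 2 * b + (fromℕ 3 * a - (fromℕ 2 * b + fromℕ 2 * c)) ≡
      H + a + fromℕ 2 - fromℕ 2 * c
    regroup = solve-∀ ℚ-ring
    left : ∀ p q s a b → p * (q * s) * (fromℕ 2 * a + fromℕ 2 * b) ≡ fromℕ 2 * (p * a * (q * s) + q * b * (p * s))
    left = solve-∀ ℚ-ring
    right : ∀ p q s c → p * (q * s) * (fromℕ 3 * c) ≡ fromℕ 3 * (s * c * (p * q))
    right = solve-∀ ℚ-ring
    expand : ∀ k → fromℕ 2 * (1ℚ * ((1ℚ + (1ℚ + k)) * (1ℚ + k)) + 1ℚ * ((1ℚ + fromℕ 2 * k) * (1ℚ + k))) + fromℕ 3 * k ≡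
      fromℕ 3 * (1ℚ * ((1ℚ + fromℕ 2 * k) * (1ℚ + (1ℚ + k))))
    expand = solve-∀ ℚ-ring
    three : fromℕ 2 * rₚ + fromℕ 2 * r_q ≤ fromℕ 3 * rₛ
    three = *-cancelˡ-≤ 0<pqs (begin
      fromℕ (suc (2 ℕ.* h) ℕ.* (suc (suc h) ℕ.* suc h)) * (fromℕ 2 * rₚ + fromℕ 2 * r_q)
        ≡⟨ trans (cong (_* (fromℕ 2 * rₚ + fromℕ 2 * r_q)) pqs≡) (left p q s rₚ r_q) ⟩
      fromℕ 2 * (p * rₚ * (q * s) + q * r_q * (p * s))
        ≡⟨ cong₂ (λ x y → fromℕ 2 * (x * (q * s) + y * (p * s))) (recip-*ˡ (2 ℕ.* h)) (recip-*ˡ (suc h)) ⟩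
      fromℕ 2 * (1ℚ * (q * s) + 1ℚ * (p * s))
        ≡⟨ trans (cong (λ z → fromℕ 2 * (1ℚ * (z * s) + 1ℚ * (p * s))) q≡)
             (cong₂ (λ y z → fromℕ 2 * (1ℚ * ((1ℚ + (1ℚ + k)) * y) + 1ℚ * (z * y))) s≡ p≡) ⟩
      fromℕ 2 * (1ℚ * ((1ℚ + (1ℚ + k)) * (1ℚ + k)) + 1ℚ * ((1ℚ + fromℕ 2 * k) * (1ℚ + k)))
        ≤⟨ ≤-by (fromℕ 3 * k) (0≤* (0≤fromℕ 3) (0≤fromℕ h)) (expand k) ⟩
      fromℕ 3 * (1ℚ * ((1ℚ + fromℕ 2 * k) * (1ℚ + (1ℚ + k))))
        ≡⟨ trans (cong (λ z → fromℕ 3 * (1ℚ * (z * (1ℚ + (1ℚ + k))))) (sym p≡)) (cong₂ (λ y z → fromℕ 3 * (y * (p * z))) (sym (recip-*ˡ h)) (sym q≡)) ⟩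
      fromℕ 3 * (s * rₛ * (p * q))
        ≡⟨ trans (cong (_* (fromℕ 3 * rₛ)) pqs≡) (right p q s rₛ) ⟨
      fromℕ (suc (2 ℕ.* h) ℕ.* (suc (suc h) ℕ.* suc h)) * (fromℕ 3 * rₛ) ∎)

  -- The sum equals `profile h` times the difference of the odd harmonic and the harmonic sum. Their
  -- logarithms cancel, which is what makes the profile grow by only a bounded factor over `N`
  -- rounds.
  profile-drift : ∀ h → ∑[ i < h ] (profile i - profile h) * recip (h ∸ suc i) ≤ fromℕ 2 * profile h
  profile-drift h = begin
    (∑[ i < h ] (profile i - profile h) * recip (h ∸ suc i))
      ≡⟨ ∑-cong h (λ i _ → split (profile i) (profile h) (recip (h ∸ suc i))) ⟩
    (∑[ i < h ] (profile i * recip (h ∸ suc i) + - profile h * recip (h ∸ suc i)))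
      ≡⟨ trans (∑-distrib-+ h _ _) (cong (convolution h +_) (trans (∑-*ˡ h (- profile h) _)
           (cong (- profile h *_) (sym (∑-reverse h recip))))) ⟩
    convolution h + - profile h * (∑[ i < h ] recip i)
      ≡⟨ trans (cong (_+ - profile h * (∑[ i < h ] recip i)) (convolution-value h))
           (factor (profile h) (oddHarmonic h) (∑[ i < h ] recip i)) ⟩
    profile h * (oddHarmonic h - (∑[ i < h ] recip i))
      ≤⟨ *-monoˡ (0≤profile h) (≤-trans (+-monoˡ-≤ (- (∑[ i < h ] recip i)) (oddHarmonic-excess h))
           (≤-by (fromℕ 2 * recip h) (0≤* (0≤fromℕ 2) (0≤recip h)) (cancel (∑[ i < h ] recip i) (recip h)))) ⟩
    profile h * fromℕ 2
      ≡⟨ *-comm (profile h) (fromℕ 2) ⟩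
    fromℕ 2 * profile h ∎
    where
    open ≤-Reasoning
    split : ∀ a b r → (a - b) * r ≡ a * r + - b * r
    split = solve-∀ ℚ-ring
    factor : ∀ a b c → a * b + - a * c ≡ a * (b - c)
    factor = solve-∀ ℚ-ring
    cancel : ∀ c r → c + fromℕ 2 - fromℕ 2 * r - c + fromℕ 2 * r ≡ fromℕ 2
    cancel = solve-∀ ℚ-ring

  -- The lower bounds

  module LowerDrift {a ℓ₁ ℓ₂} (O : DecTotalOrder a ℓ₁ ℓ₂) (J : ℕ) (1≤J : 1 ℕ.≤ J) (v : DecTotalOrder.Carrier O) where

    private
      N n h : ℕ
      N = suc J
      n = 2 ℕ.^ N
      h = 2 ℕ.^ J

    open DecTotalOrder O using () renaming (_≤_ to _≼_)
    open Sorter O N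
    open Threshold O N
    open Drift O J 1≤J

    low : Labelling → ℕ → ℚ
    low x a = 1ℚ - above v (x (pos N a))

    0≤low : ∀ x a → 0ℚ ≤ low x a
    0≤low x a = p≤q⇒0≤q-p (above≤1 v (x (pos N a)))

    potential : Labelling → ℚ
    potential x = ∑[ a < n ] profile a * low x a

    0≤potential : ∀ x → 0ℚ ≤ potential x
    0≤potential x = 0≤∑ n λ a _ → 0≤* (0≤profile a) (0≤low x a)

    -- Keeps the wrapping pairs from moving a low label: as D ≤ n/2, their larger
    -- endpoint lies in the second half.
    UpperHalf : Labelling → Set ℓ₂
    UpperHalf x = ∀ i → h ℕ.≤ toℕ i → ¬ x i ≼ v

    private
      φ : ℕ → ℚ
      φ a = - profile a

    -- Low labels are the complement of those counted by `weight`. With `φ = - profile` the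
    -- potential is a weight up to a constant, so the gain formula applies to it.
    potential-weight : ∀ x → potential x ≡ (∑[ a < n ] profile a) + weight v φ x
    potential-weight x = trans (∑-cong n λ a _ → lemma (profile a) (above v (x (pos N a)))) (∑-distrib-+ n _ _)
      where
      lemma : ∀ p c → p * (1ℚ - c) ≡ p + - p * c
      lemma = solve-∀ ℚ-ring

    module _ {x : Labelling} (upper : UpperHalf x) where

      low-upper : ∀ {j} → h ℕ.≤ j → j ℕ.< n → low x j ≡ 0ℚ
      low-upper {j} h≤j j<n with above-cases v (x (pos N j))
      ... | inj₁ (xj≼v , _) = ⊥-elim (upper (pos N j) (subst (h ℕ.≤_) (sym (toℕ-pos-< N j<n)) h≤j) xj≼v)
      ... | inj₂ (_ , eq)   = cong (λ z → 1ℚ - z) eq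

      loss : ℕ → ℕ → ℚ
      loss i j = (profile i - profile j) * low x j

      0≤loss : ∀ {i j} → i ℕ.≤ j → 0ℚ ≤ loss i j
      0≤loss {i} {j} i≤j = 0≤* (p≤q⇒0≤q-p (profile-antimono i≤j)) (0≤low x j)

      gap-flip : ∀ i j → gap v φ x i j ≡ loss i j * above v (x (pos N i))
      gap-flip i j = lemma (profile i) (profile j) (above v (x (pos N i))) (low x j)
        where
        lemma : ∀ p q c l → (- q - - p) * (c * l) ≡ (p - q) * l * c
        lemma = solve-∀ ℚ-ring

      cyclicGain-direct : ∀ {D} → D ℕ.≤ h → cyclicGain v φ x D ≡ ∑[ i < n ∸ D ] gap v φ x i (i ℕ.+ D)
      cyclicGain-direct {D} D≤h = trans (cyclicGain-split v φ x D≤h)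
        (trans (cong ((∑[ i < n ∸ D ] gap v φ x i (i ℕ.+ D)) +_) (∑-0 D wrapped)) (+-identityʳ _))
        where
        D≤n : D ℕ.≤ n
        D≤n = ℕ.≤-trans D≤h (ℕ.m≤m+n h _)
        wrapped : ∀ i → i ℕ.< D → gap v φ x i (i ℕ.+ (n ∸ D)) ≡ 0ℚ
        wrapped i i<D = trans (gap-flip i (i ℕ.+ (n ∸ D)))
          (trans (cong (λ l → (profile i - profile (i ℕ.+ (n ∸ D))) * l * above v (x (pos N i)))
              (low-upper (ℕ.≤-trans h≤n∸D (ℕ.m≤n+m (n ∸ D) i))
                (ℕ.<-≤-trans (ℕ.+-monoˡ-< (n ∸ D) i<D) (ℕ.≤-reflexive (ℕ.m+[n∸m]≡n D≤n)))))
            (lemma (profile i - profile (i ℕ.+ (n ∸ D))) (above v (x (pos N i)))))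
          where
          lemma : ∀ p c → p * 0ℚ * c ≡ 0ℚ
          lemma = solve-∀ ℚ-ring
          h≤n∸D : h ℕ.≤ n ∸ D
          h≤n∸D = ℕ.m+n≤o⇒m≤o∸n h (subst (h ℕ.+ D ℕ.≤_) (sym (pow-suc J)) (ℕ.+-monoʳ-≤ h D≤h))

      0≤cyclicGain : ∀ d → d ℕ.< h → 0ℚ ≤ cyclicGain v φ x (suc d)
      0≤cyclicGain d d<h = subst (0ℚ ≤_) (sym (cyclicGain-direct d<h)) (0≤∑ (n ∸ suc d) λ i _ →
        subst (0ℚ ≤_) (sym (gap-flip i (i ℕ.+ suc d))) (0≤* (0≤loss (ℕ.m≤m+n i (suc d))) (0≤above v (x (pos N i)))))

      -- Dropping the factor `above` and admitting every linear distance only enlarges the sum.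
      -- Regrouped by the right endpoint `j`, from which a low label would move, it is
      -- `profile-drift` weighted by `low x j`.
      harmonic-gain : harmonicSum h (cyclicGain v φ x) ≤ fromℕ 2 * potential x
      harmonic-gain = begin
        harmonicSum h (cyclicGain v φ x)
          ≤⟨ ∑-mono h (λ d d<h → per-distance d d<h) ⟩
        (∑[ d < h ] ∑[ i < n ∸ suc d ] rate i (i ℕ.+ suc d))
          ≤⟨ ∑-extend _ (λ d _ → 0≤∑ (n ∸ suc d) λ i _ → 0≤rate (ℕ.m≤m+n i (suc d))) (ℕ.m≤m+n h _) ⟩
        (∑[ d < n ] ∑[ i < n ∸ suc d ] rate i (i ℕ.+ suc d))
          ≡⟨ ∑-triangle n rate ⟩
        (∑[ j < n ] ∑[ i < j ] rate i j)
          ≤⟨ ∑-mono n (λ j _ → per-position j) ⟩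
        (∑[ j < n ] fromℕ 2 * (profile j * low x j))
          ≡⟨ ∑-*ˡ n (fromℕ 2) (λ j → profile j * low x j) ⟩
        fromℕ 2 * potential x ∎
        where
        open ≤-Reasoning
        rate : ℕ → ℕ → ℚ
        rate i j = recip (j ∸ suc i) * loss i j
        0≤rate : ∀ {i j} → i ℕ.≤ j → 0ℚ ≤ rate i j
        0≤rate {i} {j} i≤j = 0≤* (0≤recip (j ∸ suc i)) (0≤loss i≤j)
        per-distance : ∀ d → d ℕ.< h → recip d * cyclicGain v φ x (suc d) ≤ ∑[ i < n ∸ suc d ] rate i (i ℕ.+ suc d)
        per-distance d d<h = ≤-trans (≤-reflexive (trans (cong (recip d *_) (cyclicGain-direct d<h)) (sym (∑-*ˡ (n ∸ suc d) (recip d) _))))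
          (∑-mono (n ∸ suc d) λ i _ → ≤-trans
            (*-monoˡ (0≤recip d) (≤-trans (≤-reflexive (gap-flip i (i ℕ.+ suc d)))
              (≤-trans (*-monoˡ (0≤loss (ℕ.m≤m+n i (suc d))) (above≤1 v (x (pos N i)))) (≤-reflexive (*-identityʳ (loss i (i ℕ.+ suc d)))))))
            (≤-reflexive (cong (λ e → recip e * loss i (i ℕ.+ suc d))
              (sym (trans (cong (_∸ suc i) (ℕ.+-suc i d)) (ℕ.m+n∸m≡n (suc i) d))))))
        per-position : ∀ j → (∑[ i < j ] rate i j) ≤ fromℕ 2 * (profile j * low x j)
        per-position j = ≤-trans (≤-reflexive (trans
            (∑-cong j λ i _ → regroup (recip (j ∸ suc i)) (profile i - profile j) (low x j))
            (∑-*ʳ j (low x j) (λ i → (profile i - profile j) * recip (j ∸ suc i)))))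
          (≤-trans (*-monoʳ (0≤low x j) (profile-drift j)) (≤-reflexive (*-assoc (fromℕ 2) (profile j) (low x j))))
          where
          regroup : ∀ r p l → r * (p * l) ≡ p * r * l
          regroup = solve-∀ ℚ-ring

      -- The constants multiply to 1: a factor 2 from the dyadic law, `1/4` from the choice of `R`
      -- and 2 from `profile-drift`. The rate is thus `1/N`.
      potential-drift : 𝔼 (q̃ N) (λ M → potential (step x M)) ≤ (1ℚ + recip J) * potential x
      potential-drift = begin
        𝔼 (q̃ N) (λ M → potential (step x M))
          ≡⟨ 𝔼-cong (q̃ N) (λ M → potential-weight (step x M)) ⟩
        𝔼 (q̃ N) (λ M → Σp + weight v φ (step x M))
          ≡⟨ trans (𝔼-+ (q̃ N) (λ _ → Σp) (λ M → weight v φ (step x M)))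
               (cong₂ _+_ (𝔼-const (q̃-Law N (s≤s 1≤J)) Σp) (expected-weight v φ x)) ⟩
        Σp + (weight v φ x + recip J * scaleSum N G)
          ≡⟨ trans (sym (+-assoc Σp (weight v φ x) (recip J * scaleSum N G))) (cong (_+ recip J * scaleSum N G) (sym (potential-weight x))) ⟩
        potential x + recip J * scaleSum N G
          ≤⟨ +-monoʳ-≤ (potential x) (*-monoˡ (0≤recip J) (begin
               scaleSum N G                                                   ≡⟨ scaleSum-dyadic J G ⟩
               dyadicSum J G                                                  ≤⟨ dyadicSum≤2harmonicSum G J (λ d d<h → 0≤* (0≤recip 3) (0≤cyclicGain d d<h)) ⟩
               fromℕ 2 * harmonicSum h G                                      ≡⟨ cong (fromℕ 2 *_) (trans
                                                                                   (∑-cong h λ d _ → swap (recip d) (recip 3) (cyclicGain v φ x (suc d)))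
                                                                                   (∑-*ˡ h (recip 3) (λ d → recip d * cyclicGain v φ x (suc d)))) ⟩
               fromℕ 2 * (recip 3 * harmonicSum h (cyclicGain v φ x))         ≤⟨ *-monoˡ (0≤fromℕ 2) (*-monoˡ (0≤recip 3) harmonic-gain) ⟩
               fromℕ 2 * (recip 3 * (fromℕ 2 * potential x))                  ≡⟨ quarter (recip 3) (potential x) ⟩
               fromℕ 4 * recip 3 * potential x                                ≡⟨ trans (cong (_* potential x) (recip-*ˡ 3)) (*-identityˡ (potential x)) ⟩
               potential x                                                    ∎)) ⟩
        potential x + recip J * potential x
          ≡⟨ factor (recip J) (potential x) ⟩
        (1ℚ + recip J) * potential x ∎
        where
        open ≤-Reasoning
        Σp : ℚ
        Σp = ∑[ a < n ] profile a
        G : ℕ → ℚ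
        G D = recip 3 * cyclicGain v φ x D
        swap : ∀ a b c → a * (b * c) ≡ b * (a * c)
        swap = solve-∀ ℚ-ring
        quarter : ∀ r p → fromℕ 2 * (r * (fromℕ 2 * p)) ≡ fromℕ 4 * r * p
        quarter = solve-∀ ℚ-ring
        factor : ∀ r p → p + r * p ≡ (1ℚ + r) * p
        factor = solve-∀ ℚ-ring

  module LowerTail {a ℓ₁ ℓ₂} (O : DecTotalOrder a ℓ₁ ℓ₂) (J : ℕ) (1≤J : 1 ℕ.≤ J) (v : DecTotalOrder.Carrier O) where

    private
      N n h : ℕ
      N = suc J
      n = 2 ℕ.^ N
      h = 2 ℕ.^ J

    open DecTotalOrder O using () renaming (_≤_ to _≼_; _≤?_ to _≼?_; trans to ≼-trans)
    open Sorter O N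
    open Threshold O N
    open Rounds O J 1≤J
    open LowerDrift O J 1≤J v

    -- If `i` lies in the upper half then so does `j`, whose label was not low. If only `j` does, it
    -- receives a label at least as large as its own.
    upper-compareSwap : ∀ {x i j} → i Fin.≤ j → UpperHalf x → UpperHalf (compareSwap i j x)
    upper-compareSwap {x} {i} {j} i≤j upper with x i ≼? x j
    ... | yes _     = upper
    ... | no  xi⋠xj = λ k h≤k → cases k h≤k (k Fin.≟ i) (k Fin.≟ j)
      where
      cases : ∀ k → h ℕ.≤ toℕ k → Dec (k ≡ i) → Dec (k ≡ j) → ¬ x (transpose i j k) ≼ v
      cases k h≤k (yes refl) _ rewrite transpose-left k j = upper j (ℕ.≤-trans h≤k i≤j)
      cases k h≤k (no k≢i) (yes refl) rewrite transpose-right (k≢i ∘ sym) = λ xi≼v → upper k h≤k (≼-trans (⋠⇒≽ xi⋠xj) xi≼v)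
      cases k h≤k (no k≢i) (no k≢j) rewrite transpose-other k≢i k≢j = upper k h≤k

    upper-sortPair : ∀ {x} p → UpperHalf x → UpperHalf (sortPair x p)
    upper-sortPair {x} (i , j) upper with i Fin.≤? j
    ... | yes i≤j = subst UpperHalf (cong branch (sym (dec-true (i Fin.≤? j) i≤j))) (upper-compareSwap i≤j upper)
      where branch = if_then compareSwap i j x else compareSwap j i x
    ... | no  i≰j = subst UpperHalf (cong branch (sym (dec-false (i Fin.≤? j) i≰j))) (upper-compareSwap (ℕ.<⇒≤ (ℕ.≰⇒> i≰j)) upper)
      where branch = if_then compareSwap i j x else compareSwap j i x

    HasLow : Labelling → Set ℓ₂
    HasLow x = ∃[ i ] x i ≼ v

    low-sortPair : ∀ {x} p → HasLow x → HasLow (sortPair x p)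
    low-sortPair {x} (i , j) (k , xk≼v) with sortPair-cases i j x
    ... | inj₁ eq        = subst HasLow (sym eq) (k , xk≼v)
    ... | inj₂ (inj₁ eq) = subst HasLow (sym eq) (transpose j i k , subst (λ l → x l ≼ v) (sym (transpose-inverse i j)) xk≼v)
    ... | inj₂ (inj₂ eq) = subst HasLow (sym eq) (transpose i j k , subst (λ l → x l ≼ v) (sym (transpose-inverse j i)) xk≼v)

    Inv : Labelling → Set ℓ₂
    Inv x = UpperHalf x × HasLow x

    inv-step : ∀ {x} M → Inv x → Inv (step x M)
    inv-step []      inv         = inv
    inv-step (p ∷ M) (upper , l) = inv-step M (upper-sortPair p upper , low-sortPair p l)

    sorted-potential : ∀ {x} → Inv x → Sorted x → 1ℚ ≤ potential x
    sorted-potential {x} (_ , i , xi≼v) sorted = ≤-trans (≤-reflexive (sym at-0))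
      (∑-term (λ a → profile a * low x a) (λ a _ → 0≤* (0≤profile a) (0≤low x a)) 0<n)
      where
      0<n : 0 ℕ.< n
      0<n = ℕ.m^n>0 2 N
      x0≼v : x (pos N 0) ≼ v
      x0≼v = ≼-trans (sorted (pos N 0) i (subst (ℕ._≤ toℕ i) (sym (toℕ-pos-< N 0<n)) z≤n)) xi≼v
      at-0 : profile 0 * low x 0 ≡ 1ℚ
      at-0 with above-cases v (x (pos N 0))
      ... | inj₁ (_ , eq)   = cong (λ z → 1ℚ * (1ℚ - z)) eq
      ... | inj₂ (x0⋠v , _) = ⊥-elim (x0⋠v x0≼v)

    -- A sorted list that has a low label has one at position 0, where the profile is 1. So the
    -- potential dominates the indicator of being sorted, and its expectation grows by at most
    -- `1 + 1/N` per round.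
    early-bound : ∀ t {x} → Inv x → ℙ[T≤ t ] x ≤ (1ℚ + recip J) ^ t * potential x
    early-bound t {x} inv = cases t (sorted? x)
      where
      open ≤-Reasoning
      1≤1+r : 1ℚ ≤ 1ℚ + recip J
      1≤1+r = ≤-by (recip J) (0≤recip J) refl
      regroup : ∀ p r f → p * (r * f) ≡ r * p * f
      regroup = solve-∀ ℚ-ring
      cases : ∀ t → Dec (Sorted x) → ℙ[T≤ t ] x ≤ (1ℚ + recip J) ^ t * potential x
      cases t (yes sorted) = begin
        ℙ[T≤ t ] x                            ≤⟨ ℙ≤1 (rounds-Law t) (sortedWithin? x) ⟩
        1ℚ * 1ℚ                               ≤⟨ *-mono-≤ 0≤1 (0≤^ t (≤-trans 0≤1 1≤1+r)) (1≤^ t 1≤1+r) (sorted-potential inv sorted) ⟩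
        (1ℚ + recip J) ^ t * potential x      ∎
      cases zero (no unsorted) = ≤-trans (≤-reflexive (trans
          (𝔼-pure [] (λ Ms → if does (sortedWithin? x Ms) then 1ℚ else 0ℚ))
          (cong (λ b → if b then 1ℚ else 0ℚ) (dec-false (sorted? x) unsorted))))
        (0≤* 0≤1 (0≤potential x))
      cases (suc t) (no unsorted) = begin
        ℙ[T≤ suc t ] x
          ≤⟨ ℙ[T≤suc]-unsorted {t} unsorted ⟩
        𝔼 (q̃ N) (λ M → ℙ[T≤ t ] (step x M))
          ≤⟨ 𝔼-mono round-Law (λ M → early-bound t (inv-step M inv)) ⟩
        𝔼 (q̃ N) (λ M → (1ℚ + recip J) ^ t * potential (step x M))
          ≡⟨ 𝔼-*ˡ (q̃ N) ((1ℚ + recip J) ^ t) (λ M → potential (step x M)) ⟩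
        (1ℚ + recip J) ^ t * 𝔼 (q̃ N) (λ M → potential (step x M))
          ≤⟨ *-monoˡ (0≤^ t (≤-trans 0≤1 1≤1+r)) (potential-drift (proj₁ inv)) ⟩
        (1ℚ + recip J) ^ t * ((1ℚ + recip J) * potential x)
          ≡⟨ regroup ((1ℚ + recip J) ^ t) (1ℚ + recip J) (potential x) ⟩
        (1ℚ + recip J) ^ suc t * potential x ∎

  module LowerExpectation {a ℓ₁ ℓ₂} (O : DecTotalOrder a ℓ₁ ℓ₂) (J : ℕ) (1≤J : 1 ℕ.≤ J) where

    private
      N : ℕ
      N = suc J

    open Sorter O N
    open Rounds O J 1≤J

    within-sorted : ∀ {t x} → Sorted x → (Ms : Vec (Pairs N) t) → SortedWithin x Ms
    within-sorted sorted []       = sorted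
    within-sorted sorted (M ∷ Ms) = inj₁ sorted

    ℙ[T>]-sorted : ∀ t {x} → Sorted x → ℙ[T> t ] x ≡ 0ℚ
    ℙ[T>]-sorted t {x} sorted = trans (𝔼-cong (iid (q̃ N) t) λ Ms →
        cong (λ b → if b then 1ℚ else 0ℚ) (dec-false (¬? (sortedWithin? x Ms)) λ ¬within → ¬within (within-sorted sorted Ms)))
      (𝔼-const (rounds-Law t) 0ℚ)

    -- Markov's inequality at the cap `t + 1`: on the event `T > t` the capped number of rounds
    -- equals `t + 1`.
    tail-expectation : ∀ t x → fromℕ (suc t) * ℙ[T> t ] x ≤ 𝔼[T∧ suc t ] x
    tail-expectation t x = cases t (sorted? x)
      where
      open ≤-Reasoning
      cases : ∀ t → Dec (Sorted x) → fromℕ (suc t) * ℙ[T> t ] x ≤ 𝔼[T∧ suc t ] x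
      cases t (yes sorted) = ≤-trans (≤-reflexive (trans (cong (fromℕ (suc t) *_) (ℙ[T>]-sorted t sorted)) (*-zeroʳ (fromℕ (suc t)))))
        (0≤𝔼[T∧] (suc t) x)
      cases zero (no unsorted) = begin
        1ℚ * ℙ[T> 0 ] x                                   ≡⟨ *-identityˡ (ℙ[T> 0 ] x) ⟩
        ℙ[T> 0 ] x                                        ≤⟨ ℙ≤1 (rounds-Law 0) (¬? ∘ sortedWithin? x) ⟩
        1ℚ                                                ≡⟨ cong (1ℚ +_) (𝔼-const round-Law 0ℚ) ⟨
        1ℚ + 𝔼 (q̃ N) (λ M → 𝔼[T∧ 0 ] (step x M))          ≡⟨ 𝔼[T∧suc]-unsorted {0} unsorted ⟨
        𝔼[T∧ 1 ] x                                        ∎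
      cases (suc t) (no unsorted) = begin
        fromℕ (suc (suc t)) * ℙ[T> suc t ] x
          ≡⟨ trans (cong (_* ℙ[T> suc t ] x) (fromℕ-suc (suc t))) (distrib (fromℕ (suc t)) (ℙ[T> suc t ] x)) ⟩
        ℙ[T> suc t ] x + fromℕ (suc t) * ℙ[T> suc t ] x
          ≤⟨ +-mono-≤ (ℙ≤1 (rounds-Law (suc t)) (¬? ∘ sortedWithin? x)) (*-monoˡ (0≤fromℕ (suc t)) (ℙ[T>suc] {t} {x})) ⟩
        1ℚ + fromℕ (suc t) * 𝔼 (q̃ N) (λ M → ℙ[T> t ] (step x M))
          ≡⟨ cong (1ℚ +_) (𝔼-*ˡ (q̃ N) (fromℕ (suc t)) (λ M → ℙ[T> t ] (step x M))) ⟨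
        1ℚ + 𝔼 (q̃ N) (λ M → fromℕ (suc t) * ℙ[T> t ] (step x M))
          ≤⟨ +-monoʳ-≤ 1ℚ (𝔼-mono round-Law λ M → tail-expectation t (step x M)) ⟩
        1ℚ + 𝔼 (q̃ N) (λ M → 𝔼[T∧ suc t ] (step x M))
          ≡⟨ 𝔼[T∧suc]-unsorted {suc t} unsorted ⟨
        𝔼[T∧ suc (suc t) ] x ∎
        where
        distrib : ∀ k p → (1ℚ + k) * p ≡ p + k * p
        distrib = solve-∀ ℚ-ring

  -- A list with a single low label

  module LowerBound (J : ℕ) (1≤J : 1 ℕ.≤ J) where

    private
      N n h : ℕ
      N = suc J
      n = 2 ℕ.^ N
      h = 2 ℕ.^ J

    open Sorter ℕ.≤-decTotalOrder N
    open Threshold ℕ.≤-decTotalOrder N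
    open Rounds ℕ.≤-decTotalOrder J 1≤J
    open LowerDrift ℕ.≤-decTotalOrder J 1≤J 0
    open LowerTail ℕ.≤-decTotalOrder J 1≤J 0
    open LowerExpectation ℕ.≤-decTotalOrder J 1≤J

    -- The 0 sits at `n/2 - 1`, the last position that `UpperHalf` admits, which makes the initial
    -- potential as small as possible for one low label.
    bad : Labelling
    bad i = if (h ∸ 1) ℕ.≡ᵇ toℕ i then 0 else 1

    private
      suc-pred-h : suc (h ∸ 1) ≡ h
      suc-pred-h = ℕ.suc-pred h {{ℕ.m^n≢0 2 J}}

      h-1<n : h ∸ 1 ℕ.< n
      h-1<n = subst (ℕ._≤ n) (sym suc-pred-h) (ℕ.m≤m+n h _)

    bad-inv : Inv bad
    bad-inv = upper , pos N (h ∸ 1) , subst (ℕ._≤ 0) (sym at-low) z≤n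
      where
      at-low : bad (pos N (h ∸ 1)) ≡ 0
      at-low = cong (λ b → if b then 0 else 1)
        (dec-true ((h ∸ 1) ℕ.≟ toℕ (pos N (h ∸ 1))) (sym (toℕ-pos-< N h-1<n)))
      upper : UpperHalf bad
      upper i h≤i = subst (λ m → ¬ m ℕ.≤ 0) (sym (cong (λ b → if b then 0 else 1)
        (dec-false ((h ∸ 1) ℕ.≟ toℕ i) λ eq → ℕ.<⇒≱ (ℕ.≤-reflexive suc-pred-h) (subst (h ℕ.≤_) (sym eq) h≤i)))) λ ()

    potential-bad : potential bad ≡ profile (h ∸ 1)
    potential-bad = trans (∑-cong n λ a a<n → trans (cong (profile a *_) (low-bad a a<n)) (*-comm (profile a) [ h ∸ 1 ≡ᵇ a ]))
      (∑-delta h-1<n profile)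
      where
      indicator : ∀ b → 1ℚ - above 0 (if b then 0 else 1) ≡ (if b then 1ℚ else 0ℚ)
      indicator true  = refl
      indicator false = refl
      low-bad : ∀ a → a ℕ.< n → low bad a ≡ [ h ∸ 1 ≡ᵇ a ]
      low-bad a a<n = trans (cong (λ k → 1ℚ - above 0 (if (h ∸ 1) ℕ.≡ᵇ k then 0 else 1)) (toℕ-pos-< N a<n))
        (indicator ((h ∸ 1) ℕ.≡ᵇ a))

    -- With `ε = 1/(2N)`, `growth-pow` bounds `(1 + ε) ^ N` by 2, and `1 + 1/N ≤ (1 + ε)²` costs a
    -- square.
    growth : (1ℚ + recip J) ^ N ≤ fromℕ 4
    growth = begin
      (1ℚ + recip J) ^ N                      ≤⟨ ^-mono N (0≤+ 0≤1 (0≤recip J)) (≤-by (ε * ε) (0≤* 0≤ε 0≤ε) square) ⟩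
      ((1ℚ + ε) * (1ℚ + ε)) ^ N               ≡⟨ ^-distrib-* (1ℚ + ε) (1ℚ + ε) N ⟩
      (1ℚ + ε) ^ N * (1ℚ + ε) ^ N             ≤⟨ *-mono-≤ (0≤^ N (0≤+ 0≤1 0≤ε)) (0≤fromℕ 2) half half ⟩
      fromℕ 2 * fromℕ 2                       ∎
      where
      open ≤-Reasoning
      ε : ℚ
      ε = recip 1 * recip J
      0≤ε : 0ℚ ≤ ε
      0≤ε = 0≤* (0≤recip 1) (0≤recip J)
      square : 1ℚ + recip J + ε * ε ≡ (1ℚ + ε) * (1ℚ + ε)
      square = trans (cong (λ z → 1ℚ + z + ε * ε) (sym (recip-cancelˡ 1 (recip J)))) (lemma ε)
        where
        lemma : ∀ e → 1ℚ + fromℕ 2 * e + e * e ≡ (1ℚ + e) * (1ℚ + e)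
        lemma = solve-∀ ℚ-ring
      2Nε≡1 : fromℕ 2 * (fromℕ N * ε) ≡ 1ℚ
      2Nε≡1 = trans (lemma (fromℕ N) (recip 1) (recip J)) (trans (cong (fromℕ 2 * recip 1 *_) (recip-*ˡ J)) (trans (*-identityʳ (fromℕ 2 * recip 1)) (recip-*ˡ 1)))
        where
        lemma : ∀ n a b → fromℕ 2 * (n * (a * b)) ≡ fromℕ 2 * a * (n * b)
        lemma = solve-∀ ℚ-ring
      ε≤1 : ε ≤ 1ℚ
      ε≤1 = *-mono-≤ (0≤recip J) 0≤1 (recip-antimono {0} {1} z≤n) (recip-antimono {0} {J} z≤n)
      half : (1ℚ + ε) ^ N ≤ fromℕ 2
      half = growth-pow N 0≤ε ε≤1 2Nε≡1

    early : ℕ → ℚ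
    early t = ℙ[T≤ t ] bad

    0≤early : ∀ t → 0ℚ ≤ early t
    0≤early t = 0≤ℙ (rounds-Law t) (sortedWithin? bad)

    -- The sixteenth power makes all factors powers of two: the growth over `16 t ≤ N²` rounds is at
    -- most `2^(2N)`, and the profile contributes `h^(-8) = 2^(-8J)`. What remains is
    -- `(N + 2) + 2N = 3J + 5 ≤ 8J`, where `J ≥ 1` enters.
    early-pow : ∀ t → 16 ℕ.* t ℕ.≤ N ℕ.* N → fromℕ (2 ℕ.^ (N ℕ.+ 2)) * early t ^ 16 ≤ 1ℚ
    early-pow t 16t≤N² = begin
      fromℕ (2 ℕ.^ (N ℕ.+ 2)) * early t ^ 16
        ≤⟨ *-monoˡ (0≤fromℕ (2 ℕ.^ (N ℕ.+ 2))) (^-mono 16 (0≤early t) (early-bound t bad-inv)) ⟩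
      fromℕ (2 ℕ.^ (N ℕ.+ 2)) * ((1ℚ + recip J) ^ t * potential bad) ^ 16
        ≡⟨ cong (λ z → fromℕ (2 ℕ.^ (N ℕ.+ 2)) * ((1ℚ + recip J) ^ t * z) ^ 16) potential-bad ⟩
      fromℕ (2 ℕ.^ (N ℕ.+ 2)) * ((1ℚ + recip J) ^ t * p) ^ 16
        ≡⟨ cong (fromℕ (2 ℕ.^ (N ℕ.+ 2)) *_) (^-distrib-* ((1ℚ + recip J) ^ t) p 16) ⟩
      fromℕ (2 ℕ.^ (N ℕ.+ 2)) * (((1ℚ + recip J) ^ t) ^ 16 * p ^ 16)
        ≤⟨ *-monoˡ (0≤fromℕ (2 ℕ.^ (N ℕ.+ 2))) (*-monoʳ (0≤^ 16 0≤p) power) ⟩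
      fromℕ (2 ℕ.^ (N ℕ.+ 2)) * (fromℕ (2 ℕ.^ (2 ℕ.* N)) * p ^ 16)
        ≡⟨ trans (sym (*-assoc (fromℕ (2 ℕ.^ (N ℕ.+ 2))) (fromℕ (2 ℕ.^ (2 ℕ.* N))) (p ^ 16)))
             (cong (_* p ^ 16) (trans (sym (fromℕ-* (2 ℕ.^ (N ℕ.+ 2)) (2 ℕ.^ (2 ℕ.* N))))
               (cong fromℕ (sym (ℕ.^-distribˡ-+-* 2 (N ℕ.+ 2) (2 ℕ.* N)))))) ⟩
      fromℕ (2 ℕ.^ (N ℕ.+ 2 ℕ.+ 2 ℕ.* N)) * p ^ 16
        ≤⟨ *-monoʳ (0≤^ 16 0≤p) (fromℕ-mono-≤ (ℕ.^-monoʳ-≤ 2 exponents)) ⟩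
      fromℕ (2 ℕ.^ (J ℕ.* 8)) * p ^ 16
        ≡⟨ cong₂ _*_ (trans (cong fromℕ (sym (ℕ.^-*-assoc 2 J 8))) (fromℕ-^ h 8)) (trans (^-* p 2 8) (cong (λ z → (p * z) ^ 8) (*-identityʳ p))) ⟩
      fromℕ h ^ 8 * (p * p) ^ 8
        ≡⟨ ^-distrib-* (fromℕ h) (p * p) 8 ⟨
      (fromℕ h * (p * p)) ^ 8
        ≤⟨ ^≤1 8 (0≤* (0≤fromℕ h) (0≤* 0≤p 0≤p)) (≤-trans (≤-reflexive (cong (λ m → fromℕ m * (p * p)) (sym suc-pred-h))) (profile-square (h ∸ 1))) ⟩
      1ℚ ∎
      where
      open ≤-Reasoning
      p : ℚ
      p = profile (h ∸ 1)
      0≤p : 0ℚ ≤ p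
      0≤p = 0≤profile (h ∸ 1)
      power : ((1ℚ + recip J) ^ t) ^ 16 ≤ fromℕ (2 ℕ.^ (2 ℕ.* N))
      power = begin
        ((1ℚ + recip J) ^ t) ^ 16           ≡⟨ ^-* (1ℚ + recip J) t 16 ⟨
        (1ℚ + recip J) ^ (t ℕ.* 16)         ≤⟨ ^-mono-exponent (≤-by (recip J) (0≤recip J) refl) (subst (ℕ._≤ N ℕ.* N) (ℕ.*-comm 16 t) 16t≤N²) ⟩
        (1ℚ + recip J) ^ (N ℕ.* N)          ≡⟨ ^-* (1ℚ + recip J) N N ⟩
        ((1ℚ + recip J) ^ N) ^ N            ≤⟨ ^-mono N (0≤^ N (0≤+ 0≤1 (0≤recip J))) growth ⟩
        fromℕ 4 ^ N                         ≡⟨ fromℕ-^ 4 N ⟨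
        fromℕ ((2 ℕ.^ 2) ℕ.^ N)             ≡⟨ cong fromℕ (ℕ.^-*-assoc 2 2 N) ⟩
        fromℕ (2 ℕ.^ (2 ℕ.* N))             ∎
      exponents : N ℕ.+ 2 ℕ.+ 2 ℕ.* N ℕ.≤ J ℕ.* 8
      exponents = ℕ.≤-trans (ℕ.≤-reflexive (split J)) (ℕ.≤-trans (ℕ.+-monoʳ-≤ (3 ℕ.* J) (ℕ.*-monoʳ-≤ 5 1≤J)) (ℕ.≤-reflexive (join J)))
        where
        split : ∀ J → suc J ℕ.+ 2 ℕ.+ 2 ℕ.* suc J ≡ 3 ℕ.* J ℕ.+ 5 ℕ.* 1
        split = ℕSolver.solve-∀
        join : ∀ J → 3 ℕ.* J ℕ.+ 5 ℕ.* J ≡ J ℕ.* 8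
        join = ℕSolver.solve-∀

    early-weaken : ∀ {k} t → k ℕ.≤ N ℕ.+ 2 → 16 ℕ.* t ℕ.≤ N ℕ.* N → fromℕ (2 ℕ.^ k) * early t ^ 16 ≤ 1ℚ
    early-weaken t k≤ 16t≤N² = ≤-trans (*-monoʳ (0≤^ 16 (0≤early t)) (fromℕ-mono-≤ (ℕ.^-monoʳ-≤ 2 k≤))) (early-pow t 16t≤N²)

    -- Since `N + 2 ≥ 4`, the probability `q` satisfies `16 q¹⁶ ≤ 1`, so `q ≤ 2^(-1/4) < 7/8`. The
    -- expectation needs only such a constant gap below 1.
    early-7/8 : ∀ t → 16 ℕ.* t ℕ.≤ N ℕ.* N → fromℕ 8 * early t ≤ fromℕ 7
    early-7/8 t 16t≤N² with fromℕ 8 * early t ℚ.≤? fromℕ 7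
    ... | yes le = le
    -- The numerical fact `8¹⁶ < 16 · 7¹⁶`, given as `m ≤ m + k` with the difference computed by
    -- evaluation.
    ... | no  ≰  = ⊥-elim (ℕ.<⇒≱ (ℕ.m≤m+n (suc (8 ℕ.^ 16)) (16 ℕ.* 7 ℕ.^ 16 ∸ suc (8 ℕ.^ 16))) (fromℕ-cancel-≤ (begin
      fromℕ (16 ℕ.* 7 ℕ.^ 16)                           ≡⟨ trans (fromℕ-* 16 (7 ℕ.^ 16)) (cong (fromℕ 16 *_) (fromℕ-^ 7 16)) ⟩
      fromℕ 16 * fromℕ 7 ^ 16                           ≤⟨ *-monoˡ (0≤fromℕ 16) (^-mono 16 (0≤fromℕ 7) (<⇒≤ (≰⇒> ≰))) ⟩
      fromℕ 16 * (fromℕ 8 * early t) ^ 16               ≡⟨ cong (fromℕ 16 *_) (^-distrib-* (fromℕ 8) (early t) 16) ⟩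
      fromℕ 16 * (fromℕ 8 ^ 16 * early t ^ 16)          ≡⟨ swap (fromℕ 16) (fromℕ 8 ^ 16) (early t ^ 16) ⟩
      fromℕ 8 ^ 16 * (fromℕ 16 * early t ^ 16)          ≤⟨ *-monoˡ (0≤^ 16 (0≤fromℕ 8)) (early-weaken {4} t (ℕ.+-monoˡ-≤ 2 (s≤s 1≤J)) 16t≤N²) ⟩
      fromℕ 8 ^ 16 * 1ℚ                                 ≡⟨ trans (*-identityʳ (fromℕ 8 ^ 16)) (sym (fromℕ-^ 8 16)) ⟩
      fromℕ (8 ℕ.^ 16)                                  ∎)))
      where
      open ≤-Reasoning
      swap : ∀ a b c → a * (b * c) ≡ b * (a * c)
      swap = solve-∀ ℚ-ring

    early-small : ∀ t → fromℕ t < recip 127 * lg² N → PolySmall 16 N (early t)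
    early-small t t< = early-weaken t (ℕ.m≤m+n N 2) (ℕ.≤-trans (ℕ.*-monoˡ-≤ t (ℕ.m≤m+n 16 112)) (fromℕ-cancel-≤ (begin
      fromℕ (128 ℕ.* t)                             ≡⟨ fromℕ-* 128 t ⟩
      fromℕ 128 * fromℕ t                           ≤⟨ *-monoˡ (0≤fromℕ 128) (<⇒≤ t<) ⟩
      fromℕ 128 * (recip 127 * lg² N)               ≡⟨ recip-cancelˡ 127 (lg² N) ⟩
      fromℕ (N ℕ.* N)                               ∎)))
      where open ≤-Reasoning

    -- At `t = ⌊N²/16⌋` the list is still unsorted with probability at least `1/8`, and
    -- `(t + 1)/8 ≥ N²/128`; hence the constant `recip 127`. The bound is already reached at the
    -- finite cap `t + 1`.
    expectation-lower-bound : 𝔼[T]≥ bad (recip 127 * lg² N)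
    expectation-lower-bound ε 0<ε = suc t , recip-≤ 127 (begin
      fromℕ (N ℕ.* N)
        ≤⟨ fromℕ-mono-≤ N²≤ ⟩
      fromℕ (16 ℕ.* suc t)
        ≡⟨ trans (fromℕ-* 16 (suc t)) (sym (*-identityʳ (fromℕ 16 * fromℕ (suc t)))) ⟩
      fromℕ 16 * fromℕ (suc t) * 1ℚ
        ≤⟨ *-monoˡ (0≤* (0≤fromℕ 16) (0≤fromℕ (suc t))) late ⟩
      fromℕ 16 * fromℕ (suc t) * (fromℕ 8 * ℙ[T> t ] bad)
        ≡⟨ regroup (fromℕ (suc t)) (ℙ[T> t ] bad) ⟩
      fromℕ 128 * (fromℕ (suc t) * ℙ[T> t ] bad)
        ≤⟨ *-monoˡ (0≤fromℕ 128) (≤-trans (tail-expectation t bad) (≤-by ε (<⇒≤ 0<ε) refl)) ⟩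
      fromℕ 128 * (𝔼[T∧ suc t ] bad + ε) ∎)
      where
      open ≤-Reasoning
      t : ℕ
      t = N ℕ.* N ℕ./ 16
      N²≤ : N ℕ.* N ℕ.≤ 16 ℕ.* suc t
      N²≤ = ℕ.≤-trans (ℕ.≤-reflexive (ℕ.m≡m%n+[m/n]*n (N ℕ.* N) 16))
        (ℕ.≤-trans (ℕ.+-monoˡ-≤ (t ℕ.* 16) (ℕ.m%n≤n (N ℕ.* N) 16)) (ℕ.≤-reflexive (ℕ.*-comm (suc t) 16)))
      16t≤N² : 16 ℕ.* t ℕ.≤ N ℕ.* N
      16t≤N² = subst (ℕ._≤ N ℕ.* N) (ℕ.*-comm t 16) (ℕ.m/n*n≤m (N ℕ.* N) 16)
      regroup : ∀ s p → fromℕ 16 * s * (fromℕ 8 * p) ≡ fromℕ 128 * (s * p)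
      regroup = solve-∀ ℚ-ring
      late : 1ℚ ≤ fromℕ 8 * ℙ[T> t ] bad
      late = ≤-trans (≤-by (fromℕ 7 - fromℕ 8 * early t) (p≤q⇒0≤q-p (early-7/8 t 16t≤N²)) (arrange (early t)))
        (≤-reflexive (trans (cong (λ z → fromℕ 8 * z - fromℕ 8 * early t) (sym (ℙ-¬ (rounds-Law t) (sortedWithin? bad))))
          (cancel (early t) (ℙ[T> t ] bad))))
        where
        arrange : ∀ q → 1ℚ + (fromℕ 7 - fromℕ 8 * q) ≡ fromℕ 8 * 1ℚ - fromℕ 8 * q
        arrange = solve-∀ ℚ-ring
        cancel : ∀ q p → fromℕ 8 * (q + p) - fromℕ 8 * q ≡ fromℕ 8 * p
        cancel = solve-∀ ℚ-ring

open import Data.List using (length)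
open import Data.Nat using (ℕ; suc; s≤s; z≤n; _≤_; _*_; _^_)
open import Data.Nat.Properties using (≤-decTotalOrder)
open import Data.Product using (_×_; _,_; ∃-syntax; Σ-syntax)
open import Data.Rational as ℚ using (ℚ; 0ℚ)
open import Data.Rational.Properties using (positive⁻¹)
open import Relation.Binary using (DecTotalOrder)
open import Relation.Binary.PropositionalEquality using (_≡_)
open Development using (recip; q̃-matching; module UpperBound; module LowerBound)

theorem1p8 : ∀ {a ℓ₁ ℓ₂} →
    (∀ N → 2 ≤ N → Surely (λ M → IsMatching {N} M × 4 * length M ≡ 2 ^ N) (q̃ N))
    ×
    (∃[ c ] ∃[ C ] ∃[ e ] 0ℚ ℚ.< c × 0ℚ ℚ.< C × 1 ≤ e ×
    (∀ N → 2 ≤ N →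
    (∀ (O : DecTotalOrder a ℓ₁ ℓ₂) → let open Sorter O N in
    (x : Labelling) →
    𝔼[T]≤ x (C ℚ.* lg² N)
    ×
    (∀ t → C ℚ.* lg² N ℚ.≤ fromℕ t → PolySmall e N (ℙ[T> t ] x)))
    ×
    (let open Sorter ≤-decTotalOrder N in
    (Σ[ x ∈ Labelling ] 𝔼[T]≥ x (c ℚ.* lg² N))
    ×
    (Σ[ x ∈ Labelling ]
    (∀ t → fromℕ t ℚ.< c ℚ.* lg² N → PolySmall e N (ℙ[T≤ t ] x))))))
theorem1p8 = q̃-matching ,
  -- The exponent 16 comes from the lower bound; the upper tail is even at most `1/n`. The same list
  -- `bad` serves both lower bounds.
  recip 127 , fromℕ 20 , 16 , positive⁻¹ (recip 127) , positive⁻¹ (fromℕ 20) , s≤s z≤n ,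
  λ { (suc J) (s≤s 1≤J) →
    (λ O x → UpperBound.expectation-bound O J 1≤J x , UpperBound.tail-small O J 1≤J x) ,
    (LowerBound.bad J 1≤J , LowerBound.expectation-lower-bound J 1≤J) ,
    (LowerBound.bad J 1≤J , LowerBound.early-small J 1≤J) }
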